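{- Let $r\ge 2$ and let $G$ be an $r$-graph with vertex set $[n]$ and average degree $d>0$. Let $\tau,\zeta>0$ satisfy $\delta(G,\tau)\le\zeta$. Then there is a function $C:\mathcal{P}[n]\to\mathcal{P}[n]$ such that for every independent set $I\subset[n]$ of $G$ there exists $T\subset I$ with (a) $I\subset C(T)$, (b) $\mu(T)\le 2r\tau/\zeta$, (c) $|T|\le 2r\tau n/\zeta^2$, and (d) $\mu(C(T))\le 1-1/r!+4\zeta+2r\tau/\zeta$. Moreover $C(T)\cap[w]=C(T\cap[w])\cap[w]$ for all $T\in\mathcal{P}[n]$ and all $w\in[n]$. Indeed, the existence of $T\subset I$ with (a)–(d) holds for every set $I\subset[n]$ such that either $G[I]$ is $\lfloor\tau^{r-1}\zeta e(G)/n\rfloor$-degenerate or $e(G[I])\le 2r\tau^r e(G)/\zeta$.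
   Context: An $r$-graph is an $r$-uniform hypergraph; $e(G)$ is its number of edges, $G[I]$ the induced subhypergraph on $I$, and a set is independent if it contains no edge. For $\sigma\subset[n]$, $d(\sigma)$ is the number of edges containing $\sigma$, and $d(v)=d(\{v\})$; $d$ is the average vertex degree. The degree measure of $S\subset[n]$ is $\mu(S)=\frac{1}{nd}\sum_{u\in S}d(u)$. For $v\in[n]$ and $2\le j\le r$, $d^{(j)}(v)=\max\{d(\sigma'):v\in\sigma'\subset[n],|\sigma'|=j\}$. Define $\delta_j$ by $\delta_j\tau^{j-1}nd=\sum_{v\in[n]}d^{(j)}(v)$ for $2\le j\le r$, and the co-degree function $\delta(G,\tau)=2^{\binom r2-1}\sum_{j=2}^r2^{ -\binom{j-1}{2}}\delta_j$. A hypergraph is $b$-degenerate if every subhypergraph has a vertex of degree at most $b$. $[w]=\{1,\dots,w\}$ and $\mathcal{P}[n]$ is the power set of $[n]$.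
   Formalization: The parameters τ and ζ are taken to be positive rational numbers instead of positive real numbers. -}

module Defs where

open import Data.Bool using (Bool; true; false; _∧_; if_then_else_)
open import Data.Nat as ℕ using (ℕ; zero; suc; _∸_; _⊔_)
open import Data.Nat.Combinatorics using (_C_)
open import Data.Integer as ℤ using (ℤ; +_)
open import Data.Fin using (Fin; toℕ)
open import Data.Fin.Subset using (Subset; _⊆_; _∈_; ∣_∣; ⁅_⁆; Nonempty; inside; outside)
open import Data.Fin.Subset.Properties using (_⊆?_; _∈?_)
open import Data.List using (List; []; _∷_; map; _++_; foldr; upTo)
import Data.List
open import Data.Vec using (Vec; []; _∷_; tabulate)
open import Data.Rational as ℚ using (ℚ; 0ℚ; 1ℚ; _÷_; _/_; _*_; _+_; _-_; floor)
open import Data.Rational.Properties using (_≟_)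
open import Data.Product using (Σ; ∃; _×_)
open import Relation.Nullary using (¬_; yes; no; does)
open import Relation.Binary.PropositionalEquality using (_≡_)

allSubsets : (n : ℕ) → List (Subset n)
allSubsets zero    = [] ∷ []
allSubsets (suc n) = map (outside ∷_) (allSubsets n) ++ map (inside ∷_) (allSubsets n)

allFin : (n : ℕ) → List (Fin n)
allFin n = Data.List.allFin n

count : {A : Set} → (A → Bool) → List A → ℕ
count p []       = 0
count p (x ∷ xs) with p x
... | true  = suc (count p xs)
... | false = count p xs

sumL : List ℕ → ℕ
sumL = foldr ℕ._+_ 0

maxL : List ℕ → ℕ
maxL = foldr _⊔_ 0

ℕ→ℚ : ℕ → ℚ
ℕ→ℚ k = (+ k) / 1

-- total division on ℚ (p ÷ 0 := 0); only ever used with nonzero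
-- denominators under the hypotheses of the theorem.
_÷'_ : ℚ → ℚ → ℚ
p ÷' q with q ≟ 0ℚ
... | yes _  = 0ℚ
... | no q≢0 = _÷_ p q {{ℚ.≢-nonZero q≢0}}

infixl 7 _÷'_

_^ℚ_ : ℚ → ℕ → ℚ
p ^ℚ zero  = 1ℚ
p ^ℚ suc k = p * (p ^ℚ k)

-- r-uniform hypergraphs on vertex set [n] = Fin n
-- (vertex i : Fin n stands for i+1 ∈ [n]).

record RGraph (r n : ℕ) : Set where
  field
    edge    : Subset n → Bool
    uniform : ∀ σ → edge σ ≡ true → ∣ σ ∣ ≡ r

open RGraph public

module _ {r n : ℕ} (G : RGraph r n) where

  e : ℕ
  e = count (edge G) (allSubsets n)

  codeg : Subset n → ℕ
  codeg σ = count (λ f → edge G f ∧ does (σ ⊆? f)) (allSubsets n)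

  deg : Fin n → ℕ
  deg v = codeg ⁅ v ⁆

  totalDeg : ℕ
  totalDeg = sumL (map deg (allFin n))

  avgDeg : ℚ
  avgDeg = ℕ→ℚ totalDeg ÷' ℕ→ℚ n

  μ : Subset n → ℚ
  μ S = ℕ→ℚ (sumL (map (λ u → if does (u ∈? S) then deg u else 0) (allFin n)))
        ÷' (ℕ→ℚ n * avgDeg)

  degJ : ℕ → Fin n → ℕ
  degJ j v = maxL (map (λ σ → if does (v ∈? σ) ∧ (∣ σ ∣ ℕ.≡ᵇ j) then codeg σ else 0)
                       (allSubsets n))

  δj : ℚ → ℕ → ℚ
  δj τ j = ℕ→ℚ (sumL (map (degJ j) (allFin n))) ÷' ((τ ^ℚ (j ∸ 1)) * ℕ→ℚ n * avgDeg)

  δsum : ℚ → ℚ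
  δsum τ = foldr _+_ 0ℚ
             (map (λ j → δj τ j ÷' ℕ→ℚ (2 ℕ.^ ((j ∸ 1) C 2)))
                  (Data.List.map (ℕ._+ 2) (upTo (r ∸ 1))))

  δ : ℚ → ℚ
  δ τ = ℕ→ℚ (2 ℕ.^ ((r C 2) ∸ 1)) * δsum τ

  Independent : Subset n → Set
  Independent I = ∀ f → edge G f ≡ true → ¬ (f ⊆ I)

  eInduced : Subset n → ℕ
  eInduced I = count (λ f → edge G f ∧ does (f ⊆? I)) (allSubsets n)

  -- G[I] is b-degenerate: every (nonempty) subhypergraph H of G[I] has a
  -- vertex of degree at most b in H.  A subhypergraph is given by a vertex
  -- set V ⊆ I and an edge set F (characteristic function) consisting of edges
  -- of G contained in V.
  InducedDegenerate : Subset n → ℤ → Set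
  InducedDegenerate I b =
    (V : Subset n) (F : Subset n → Bool) →
    V ⊆ I → Nonempty V →
    (∀ f → F f ≡ true → (edge G f ≡ true × f ⊆ V)) →
    Σ (Fin n) λ v → v ∈ V × (+ count (λ f → F f ∧ does (v ∈? f)) (allSubsets n)) ℤ.≤ b

-- [w] = {1,…,w} ⊆ [n], i.e. the vertices i : Fin n with toℕ i < w
prefix : (n w : ℕ) → Subset n
prefix n w = tabulate (λ i → if toℕ i ℕ.<ᵇ w then inside else outside)

module Submission where

-- The algorithm of Saxton and Thomason reads the vertices in increasing order and
-- keeps, for each s ≤ r, the multiset Pₛ of s-sets f such that f together with some
-- earlier vertices of T is an edge.  When a vertex v of T is read, Fᵥₛ is added to Pₛ:
-- the sets f for which v together with f is in Pₛ₊₁, except those containing a σ whose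
-- degree in Pₛ has already reached its threshold θₛ(σ); the thresholds keep all degrees
-- in Pₛ close to τ^(r-s) times those in G.  A vertex of degree at least ζd is selected
-- if some Fᵥₛ is large or if v has reached its threshold in P₁; T is the set of selected
-- vertices of I, and C(T) consists of T and the unselected vertices.  Each selected
-- vertex of I makes some Pₛ grow or closes edges inside I, so T is small.
-- If U is the set of vertices of large degree that are neither selected nor in T, then a
-- set of Pₛ₊₁ inside U which is not counted in some Fᵥₛ contains a saturated σ, and the
-- sets of Pₛ pay for these: each pays s if it lies in U, and at most s - 1 otherwise.
-- Going down from Pᵣ = E(G) this gives W ≤ r! (ε + 3ζW), where W = nd and ε is the total
-- degree outside U.

open import Defs
open import Data.Bool using (Bool; true; false; _∧_; _∨_; not; if_then_else_; T)
open import Data.Nat as ℕ using (ℕ; zero; suc; _≤_; z≤n; s≤s; _∸_)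
open import Data.Nat using (_!)
import Data.Bool.Properties as 𝔹P
import Data.Nat.Properties as ℕP
import Data.Nat.Combinatorics as NC
open import Data.Integer as ℤ using (ℤ)
import Data.Integer.Properties as ℤP
import Data.Integer.DivMod as ℤDM
open import Data.Fin as F using (Fin; toℕ; zero; suc)
import Data.Fin.Properties as FP
open import Data.Fin.Subset using (Subset; _∈_; _∉_; _⊆_; _∩_; _∪_; ∣_∣; ⁅_⁆; inside; outside; Nonempty; ⊥; ⊤) renaming (_-_ to _∖_)
import Data.Fin.Subset.Properties as SP
open import Data.Fin.Subset.Properties using (_∈?_; _⊆?_; nonempty?; anySubset?)
open import Data.Vec using ([]; _∷_; here; there; tabulate)
import Data.Vec.Properties as VP
open import Data.Rational as ℚ using (ℚ; 0ℚ; 1ℚ; _<_; _*_; _+_; _-_; -_; floor; nonNegative; positive) renaming (_≤_ to _≤ℚ_)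
import Data.Rational.Properties as ℚP
import Data.Rational.Unnormalised as ℚᵘ
import Data.Rational.Unnormalised.Properties as ℚᵘP
open import Data.Rational.Solver using (module +-*-Solver)
open import Data.List using (List; []; _∷_; map; _++_; foldr; applyUpTo)
import Data.List.Properties as LP
open import Data.List.Membership.Propositional using () renaming (_∈_ to _∈ₗ_)
import Data.List.Membership.Propositional.Properties as MP
import Data.List.Relation.Unary.Any as LAny
import Data.Nat.Solver as NS
open import Data.Product using (Σ; ∃; _×_; _,_; proj₁; proj₂)
open import Data.Sum using (_⊎_; inj₁; inj₂)
open import Data.Empty using (⊥-elim)
open import Relation.Nullary using (¬_; yes; no; does; Dec; _×-dec_; _⊎-dec_; ¬?)
open import Relation.Binary.PropositionalEquality using (_≡_; refl; sym; trans; cong; cong₂; subst; subst₂)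
open +-*-Solver using (solve; _:=_; _:+_; _:*_; _:-_; :-_; con)

-- The obstacle is the waste, the sets refused because they contain a saturated σ. They are charged
-- to the members of Pₛ that saturated σ, and one member has up to 2^s subsets σ to answer for. The
-- factor 2^s in `θ` for |σ| ≥ 2 lowers the cost of each to 2^(-s), so that together they cost a
-- member no more than one vertex does. A single vertex gets no such factor, as its degree must
-- follow τ^(r-s) d(v) closely. The degree bounds for larger σ multiply the factors of the levels 2
-- to r - 1, whence 2^(C(r,2)-1) in δ(G,τ). In W ≤ r! (ε + 3ζW) the charges s at the levels 2 to r -
-- 1 give (r-1)!, and W = r e(G) gives the last factor r. Each level adds 3ζ/2, namely ζ for the
-- sets in some Fᵥₛ and ζ/2 for overshoots, against a factor s that at least doubles what came
-- before: 3ζ in all. Vertices of degree below ζd add a fourth ζ. The bound 2rτ/ζ has a term 2τ/ζ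
-- for each of the r ways to be selected. C can be computed from T alone because selection looks
-- only at the state left by earlier vertices, and T determines that state.

module ℕR = NS.+-*-Solver

private variable
  Elem Elem′ : Set
  n : ℕ

-- Rational arithmetic and the embedding of the naturals.

ℤ/1-mono : ∀ {i j : ℤ} → i ℤ.≤ j → (i ℚ./ 1) ≤ℚ (j ℚ./ 1)
ℤ/1-mono {i} {j} i≤j = ℚP.toℚᵘ-cancel-≤ (ℚᵘP.≤-trans (ℚᵘP.≤-reflexive (ℚP.toℚᵘ-fromℚᵘ (ℚᵘ.mkℚᵘ i 0)))
  (ℚᵘP.≤-trans (ℚᵘ.*≤* (ℤP.*-monoʳ-≤-nonNeg (ℤ.+ 1) i≤j))
    (ℚᵘP.≤-reflexive (ℚᵘP.≃-sym (ℚP.toℚᵘ-fromℚᵘ (ℚᵘ.mkℚᵘ j 0))))))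

-- Opaque, since otherwise normalisation unfolds the greatest common divisor inside ℕ→ℚ.
opaque
  κ : ℕ → ℚ
  κ = ℕ→ℚ

  κ-ℕ→ℚ : ∀ a → ℕ→ℚ a ≡ κ a
  κ-ℕ→ℚ a = refl

  κ-0 : κ 0 ≡ 0ℚ
  κ-0 = refl

  κ-1 : κ 1 ≡ 1ℚ
  κ-1 = refl

  κ-+ : ∀ a b → κ (a ℕ.+ b) ≡ κ a + κ b
  κ-+ a b = ℚP.toℚᵘ-injective (ℚᵘP.≃-trans (ℚP.toℚᵘ-fromℚᵘ (ℚᵘ.mkℚᵘ (ℤ.+ (a ℕ.+ b)) 0))
    (ℚᵘP.≃-sym (ℚᵘP.≃-trans (ℚP.toℚᵘ-homo-+ (κ a) (κ b))
      (ℚᵘP.≃-trans (ℚᵘP.+-cong (ℚP.toℚᵘ-fromℚᵘ (ℚᵘ.mkℚᵘ (ℤ.+ a) 0)) (ℚP.toℚᵘ-fromℚᵘ (ℚᵘ.mkℚᵘ (ℤ.+ b) 0)))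
        (ℚᵘ.*≡* (cong (ℤ._* ℤ.+ 1) (trans (cong₂ ℤ._+_ (ℤP.*-identityʳ (ℤ.+ a)) (ℤP.*-identityʳ (ℤ.+ b))) refl)))))))

  κ-* : ∀ a b → κ (a ℕ.* b) ≡ κ a * κ b
  κ-* a b = ℚP.toℚᵘ-injective (ℚᵘP.≃-trans (ℚP.toℚᵘ-fromℚᵘ (ℚᵘ.mkℚᵘ (ℤ.+ (a ℕ.* b)) 0))
    (ℚᵘP.≃-sym (ℚᵘP.≃-trans (ℚP.toℚᵘ-homo-* (κ a) (κ b))
      (ℚᵘP.≃-trans (ℚᵘP.*-cong (ℚP.toℚᵘ-fromℚᵘ (ℚᵘ.mkℚᵘ (ℤ.+ a) 0)) (ℚP.toℚᵘ-fromℚᵘ (ℚᵘ.mkℚᵘ (ℤ.+ b) 0)))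
        (ℚᵘ.*≡* (cong (ℤ._* ℤ.+ 1) (sym (ℤP.pos-* a b))))))))

  κ-mono : ∀ {a b} → a ≤ b → κ a ≤ℚ κ b
  κ-mono a≤b = ℤ/1-mono (ℤ.+≤+ a≤b)

  0≤κ : ∀ a → 0ℚ ≤ℚ κ a
  0≤κ a = κ-mono {0} {a} z≤n

  0<κ : ∀ {a} → 1 ≤ a → 0ℚ < κ a
  0<κ 1≤a = ℚP.<-≤-trans (ℚP.positive⁻¹ 1ℚ) (κ-mono 1≤a)

*-monoˡ : ∀ {a b c} → 0ℚ ≤ℚ a → b ≤ℚ c → a * b ≤ℚ a * c
*-monoˡ {a} 0≤a = ℚP.*-monoˡ-≤-nonNeg a {{nonNegative 0≤a}}

*-monoʳ : ∀ {a b c} → 0ℚ ≤ℚ a → b ≤ℚ c → b * a ≤ℚ c * a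
*-monoʳ {a} 0≤a = ℚP.*-monoʳ-≤-nonNeg a {{nonNegative 0≤a}}

*-cancelˡ : ∀ {a b c} → 0ℚ < a → a * b ≤ℚ a * c → b ≤ℚ c
*-cancelˡ {a} 0<a = ℚP.*-cancelˡ-≤-pos a {{positive 0<a}}

0≤* : ∀ {a b} → 0ℚ ≤ℚ a → 0ℚ ≤ℚ b → 0ℚ ≤ℚ a * b
0≤* {a} {b} 0≤a 0≤b = subst (_≤ℚ a * b) (ℚP.*-zeroʳ a) (*-monoˡ 0≤a 0≤b)

0<* : ∀ {a b} → 0ℚ < a → 0ℚ < b → 0ℚ < a * b
0<* {a} {b} 0<a 0<b = subst (_< a * b) (ℚP.*-zeroʳ a) (ℚP.*-monoʳ-<-pos a {{positive 0<a}} 0<b)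

0≤+ : ∀ {a b} → 0ℚ ≤ℚ a → 0ℚ ≤ℚ b → 0ℚ ≤ℚ a + b
0≤+ 0≤a 0≤b = ℚP.+-mono-≤ 0≤a 0≤b

≤-+ʳ : ∀ {a b} → 0ℚ ≤ℚ b → a ≤ℚ a + b
≤-+ʳ {a} {b} 0≤b = subst (_≤ℚ a + b) (ℚP.+-identityʳ a) (ℚP.+-monoʳ-≤ a 0≤b)

≤-+ˡ : ∀ {a b} → 0ℚ ≤ℚ b → a ≤ℚ b + a
≤-+ˡ {a} {b} 0≤b = subst (_≤ℚ b + a) (ℚP.+-identityˡ a) (ℚP.+-monoˡ-≤ a 0≤b)

+-cancelˡ : ∀ a {b c} → a + b ≤ℚ a + c → b ≤ℚ c
+-cancelˡ a {b} {c} h = subst (_≤ℚ c) (cancel a b) (subst (- a + (a + b) ≤ℚ_) (cancel a c) (ℚP.+-monoʳ-≤ (- a) h))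
  where
  cancel : ∀ a b → - a + (a + b) ≡ b
  cancel = solve 2 (λ a b → :- a :+ (a :+ b) := b) refl

^-pos : ∀ {a} → 0ℚ < a → ∀ k → 0ℚ < a ^ℚ k
^-pos 0<a zero = ℚP.positive⁻¹ 1ℚ
^-pos 0<a (suc k) = 0<* 0<a (^-pos 0<a k)

^-+ : ∀ a j k → a ^ℚ (j ℕ.+ k) ≡ a ^ℚ j * a ^ℚ k
^-+ a zero k = sym (ℚP.*-identityˡ _)
^-+ a (suc j) k = trans (cong (a *_) (^-+ a j k)) (sym (ℚP.*-assoc a _ _))

÷'-* : ∀ p {q} → 0ℚ < q → p ÷' q * q ≡ p
÷'-* p {q} 0<q with q ℚP.≟ 0ℚ
... | yes q≡0 = ⊥-elim (ℚP.<⇒≢ 0<q (sym q≡0))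
... | no q≢0 = let instance _ = ℚ.≢-nonZero q≢0 in
  trans (ℚP.*-assoc p _ q) (trans (cong (p *_) (ℚP.*-inverseˡ q)) (ℚP.*-identityʳ p))

-- The junk value p ÷' 0 = 0 makes this hold without positivity of q.
0≤÷' : ∀ {p q} → 0ℚ ≤ℚ p → 0ℚ ≤ℚ q → 0ℚ ≤ℚ p ÷' q
0≤÷' {p} {q} 0≤p 0≤q with q ℚP.≟ 0ℚ
... | yes q≡0 = ℚP.≤-refl
... | no q≢0 = let instance
                     _ = ℚ.≢-nonZero q≢0
                     _ = ℚP.nonNeg∧nonZero⇒pos q {{nonNegative 0≤q}}
                     _ = ℚP.1/pos⇒pos q
               in 0≤* 0≤p (ℚP.<⇒≤ (ℚP.positive⁻¹ (ℚ.1/ q)))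

≤÷' : ∀ {p q x} → 0ℚ < q → x * q ≤ℚ p → x ≤ℚ p ÷' q
≤÷' {p} {q} {x} 0<q xq≤p = ℚP.*-cancelʳ-≤-pos q {{positive 0<q}} (subst (x * q ≤ℚ_) (sym (÷'-* p 0<q)) xq≤p)

÷'≤ : ∀ {p q x} → 0ℚ < q → p ≤ℚ x * q → p ÷' q ≤ℚ x
÷'≤ {p} {q} {x} 0<q p≤xq = ℚP.*-cancelʳ-≤-pos q {{positive 0<q}} (subst (_≤ℚ x * q) (sym (÷'-* p 0<q)) p≤xq)

-- Indicators, decisions and finite sums.

ι : Bool → ℚ
ι true = 1ℚ
ι false = 0ℚ

0≤1 : 0ℚ ≤ℚ 1ℚ
0≤1 = ℚP.<⇒≤ (ℚP.positive⁻¹ 1ℚ)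

0≤ι : ∀ b → 0ℚ ≤ℚ ι b
0≤ι true = 0≤1
0≤ι false = ℚP.≤-refl

ι≤1 : ∀ b → ι b ≤ℚ 1ℚ
ι≤1 true = ℚP.≤-refl
ι≤1 false = 0≤1

ι-mono : ∀ {b c} → (b ≡ true → c ≡ true) → ι b ≤ℚ ι c
ι-mono {true} b⇒c rewrite b⇒c refl = ℚP.≤-refl
ι-mono {false} {c} _ = 0≤ι c

ι-≤ : ∀ {b x} → 0ℚ ≤ℚ x → (b ≡ true → 1ℚ ≤ℚ x) → ι b ≤ℚ x
ι-≤ {true} _ h = h refl
ι-≤ {false} 0≤x _ = 0≤x

ι-∧ : ∀ b c → ι (b ∧ c) ≡ ι b * ι c
ι-∧ true c = sym (ℚP.*-identityˡ (ι c))
ι-∧ false c = sym (ℚP.*-zeroˡ (ι c))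

∧-true : ∀ {b c} → b ∧ c ≡ true → b ≡ true × c ≡ true
∧-true {true} {true} _ = refl , refl

true-∧ : ∀ {b c} → b ≡ true → c ≡ true → b ∧ c ≡ true
true-∧ refl refl = refl

dec-true : (d : Dec Elem) → does d ≡ true → Elem
dec-true (yes a) _ = a

true-dec : (d : Dec Elem) → Elem → does d ≡ true
true-dec (yes _) _ = refl
true-dec (no ¬a) a = ⊥-elim (¬a a)

dec-false : (d : Dec Elem) → does d ≡ false → ¬ Elem
dec-false (no ¬a) _ = ¬a

false-dec : (d : Dec Elem) → ¬ Elem → does d ≡ false
false-dec (yes a) ¬a = ⊥-elim (¬a a)
false-dec (no _) _ = refl

iff-≡ : ∀ {b c} → (b ≡ true → c ≡ true) → (c ≡ true → b ≡ true) → b ≡ c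
iff-≡ {true} b⇒c _ = sym (b⇒c refl)
iff-≡ {false} {true} _ c⇒b = c⇒b refl
iff-≡ {false} {false} _ _ = refl

∑ : List Elem → (Elem → ℚ) → ℚ
∑ [] f = 0ℚ
∑ (x ∷ xs) f = f x + ∑ xs f

∑-cong : ∀ (xs : List Elem) {f g} → (∀ x → f x ≡ g x) → ∑ xs f ≡ ∑ xs g
∑-cong [] _ = refl
∑-cong (x ∷ xs) f≡g = cong₂ _+_ (f≡g x) (∑-cong xs f≡g)

∑-mono : ∀ (xs : List Elem) {f g} → (∀ x → f x ≤ℚ g x) → ∑ xs f ≤ℚ ∑ xs g
∑-mono [] _ = ℚP.≤-refl
∑-mono (x ∷ xs) f≤g = ℚP.+-mono-≤ (f≤g x) (∑-mono xs f≤g)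

∑-0 : ∀ (xs : List Elem) → ∑ xs (λ _ → 0ℚ) ≡ 0ℚ
∑-0 [] = refl
∑-0 (x ∷ xs) = trans (ℚP.+-identityˡ _) (∑-0 xs)

0≤∑ : ∀ (xs : List Elem) {f} → (∀ x → 0ℚ ≤ℚ f x) → 0ℚ ≤ℚ ∑ xs f
0≤∑ xs {f} 0≤f = subst (_≤ℚ ∑ xs f) (∑-0 xs) (∑-mono xs 0≤f)

∑-+ : ∀ (xs : List Elem) f g → ∑ xs (λ x → f x + g x) ≡ ∑ xs f + ∑ xs g
∑-+ [] f g = refl
∑-+ (x ∷ xs) f g = trans (cong ((f x + g x) +_) (∑-+ xs f g))
  (solve 4 (λ a b c d → (a :+ b) :+ (c :+ d) := (a :+ c) :+ (b :+ d)) refl (f x) (g x) (∑ xs f) (∑ xs g))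

∑-*ˡ : ∀ (xs : List Elem) c f → ∑ xs (λ x → c * f x) ≡ c * ∑ xs f
∑-*ˡ [] c f = sym (ℚP.*-zeroʳ c)
∑-*ˡ (x ∷ xs) c f = trans (cong (c * f x +_) (∑-*ˡ xs c f)) (sym (ℚP.*-distribˡ-+ c _ _))

∑-swap : ∀ (xs : List Elem) (ys : List Elem′) (f : Elem → Elem′ → ℚ) → ∑ xs (λ x → ∑ ys (f x)) ≡ ∑ ys (λ y → ∑ xs (λ x → f x y))
∑-swap [] ys f = sym (∑-0 ys)
∑-swap (x ∷ xs) ys f = trans (cong (∑ ys (f x) +_) (∑-swap xs ys f)) (sym (∑-+ ys (f x) (λ y → ∑ xs (λ x → f x y))))

∑-++ : ∀ (xs ys : List Elem) f → ∑ (xs ++ ys) f ≡ ∑ xs f + ∑ ys f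
∑-++ [] ys f = sym (ℚP.+-identityˡ _)
∑-++ (x ∷ xs) ys f = trans (cong (f x +_) (∑-++ xs ys f)) (sym (ℚP.+-assoc (f x) _ _))

∑-map : ∀ (h : Elem′ → Elem) (xs : List Elem′) (f : Elem → ℚ) → ∑ (map h xs) f ≡ ∑ xs (λ x → f (h x))
∑-map h [] f = refl
∑-map h (x ∷ xs) f = cong (f (h x) +_) (∑-map h xs f)

≤∑ : ∀ (xs : List Elem) {f} → (∀ x → 0ℚ ≤ℚ f x) → ∀ {x} → x ∈ₗ xs → f x ≤ℚ ∑ xs f
≤∑ (x ∷ xs) 0≤f (LAny.here refl) = ≤-+ʳ (0≤∑ xs 0≤f)
≤∑ (y ∷ xs) 0≤f (LAny.there x∈xs) = ℚP.≤-trans (≤∑ xs 0≤f x∈xs) (≤-+ˡ (0≤f y))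

count-∑ : ∀ (p : Elem → Bool) xs → κ (count p xs) ≡ ∑ xs (λ x → ι (p x))
count-∑ p [] = κ-0
count-∑ p (x ∷ xs) with p x
... | true = trans (κ-+ 1 (count p xs)) (cong₂ _+_ κ-1 (count-∑ p xs))
... | false = trans (count-∑ p xs) (sym (ℚP.+-identityˡ _))

sumL-∑ : ∀ (f : Elem → ℕ) xs → κ (sumL (map f xs)) ≡ ∑ xs (λ x → κ (f x))
sumL-∑ f [] = κ-0
sumL-∑ f (x ∷ xs) = trans (κ-+ (f x) _) (cong (κ (f x) +_) (sumL-∑ f xs))

maxL-≥ : ∀ (f : Elem → ℕ) {x xs} → x ∈ₗ xs → f x ≤ maxL (map f xs)
maxL-≥ f {xs = x ∷ xs} (LAny.here refl) = ℕP.m≤m⊔n (f x) _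
maxL-≥ f {xs = y ∷ xs} (LAny.there x∈xs) = ℕP.≤-trans (maxL-≥ f x∈xs) (ℕP.m≤n⊔m (f y) _)

maxL-mono : ∀ (f g : Elem → ℕ) xs → (∀ x → f x ≤ g x) → maxL (map f xs) ≤ maxL (map g xs)
maxL-mono f g [] _ = z≤n
maxL-mono f g (x ∷ xs) f≤g = ℕP.⊔-mono-≤ (f≤g x) (maxL-mono f g xs f≤g)

floor≤ : ∀ q → (floor q ℚ./ 1) ≤ℚ q
floor≤ q@(ℚ.mkℚ n d-1 _) = ℚP.toℚᵘ-cancel-≤ (ℚᵘP.≤-trans (ℚᵘP.≤-reflexive (ℚP.toℚᵘ-fromℚᵘ (ℚᵘ.mkℚᵘ (floor q) 0)))
  (ℚᵘ.*≤* (subst (floor q ℤ.* ℤ.+ suc d-1 ℤ.≤_) (sym (ℤP.*-identityʳ n)) (ℤDM.[n/d]*d≤n n (ℤ.+ suc d-1)))))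

-- Final segments of a set.

∣b∷p∣≤ : ∀ b (p : Subset n) → ∣ b ∷ p ∣ ≤ suc ∣ p ∣
∣b∷p∣≤ true p = ℕP.≤-refl
∣b∷p∣≤ false p = ℕP.n≤1+n _

-- The last s elements of g.
tail : ℕ → Subset n → Subset n
tail s [] = []
tail s (b ∷ g) with ∣ b ∷ g ∣ ℕ.≤? s
... | yes _ = b ∷ g
... | no _ = outside ∷ tail s g

-- The index of the element that tail (suc s) g has in addition to tail s g;
-- meaningful only when s < ∣ g ∣.
pos : ℕ → Subset n → ℕ
pos s [] = 0
pos s (b ∷ g) with ∣ g ∣ ℕ.≤? s
... | yes _ = 0
... | no _ = suc (pos s g)

tail-⊆ : ∀ s (g : Subset n) → tail s g ⊆ g
tail-⊆ s (b ∷ g) w∈ with ∣ b ∷ g ∣ ℕ.≤? s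
... | yes _ = w∈
tail-⊆ s (b ∷ g) (there w∈) | no _ = there (tail-⊆ s g w∈)

tail-all : ∀ s (g : Subset n) → ∣ g ∣ ≤ s → tail s g ≡ g
tail-all s [] _ = refl
tail-all s (b ∷ g) g≤s with ∣ b ∷ g ∣ ℕ.≤? s
... | yes _ = refl
... | no g≰s = ⊥-elim (g≰s g≤s)

∣tail∣ : ∀ s (g : Subset n) → s ≤ ∣ g ∣ → ∣ tail s g ∣ ≡ s
∣tail∣ s [] z≤n = refl
∣tail∣ s (b ∷ g) s≤g with ∣ b ∷ g ∣ ℕ.≤? s
... | yes g≤s = ℕP.≤-antisym g≤s s≤g
... | no g≰s = ∣tail∣ s g (ℕP.≤-pred (ℕP.≤-trans (ℕP.≰⇒> g≰s) (∣b∷p∣≤ b g)))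

tail-suc-⊆ : ∀ s (g : Subset n) → tail s g ⊆ tail (suc s) g
tail-suc-⊆ s (b ∷ g) w∈ with ∣ b ∷ g ∣ ℕ.≤? s | ∣ b ∷ g ∣ ℕ.≤? suc s
... | yes _ | yes _ = w∈
... | yes g≤s | no g≰1+s = ⊥-elim (g≰1+s (ℕP.m≤n⇒m≤1+n g≤s))
tail-suc-⊆ s (b ∷ g) (there w∈) | no _ | yes _ = there (tail-⊆ s g w∈)
tail-suc-⊆ s (b ∷ g) (there w∈) | no _ | no _ = there (tail-suc-⊆ s g w∈)

pos<tail : ∀ s (g : Subset n) {w} → s ℕ.< ∣ g ∣ → w ∈ tail s g → pos s g ℕ.< toℕ w
pos<tail s (b ∷ g) s<g w∈ with ∣ b ∷ g ∣ ℕ.≤? s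
... | yes g≤s = ⊥-elim (ℕP.<⇒≱ s<g g≤s)
pos<tail s (b ∷ g) s<g (there w∈) | no _ with ∣ g ∣ ℕ.≤? s
... | yes _ = s≤s z≤n
... | no g≰s = s≤s (pos<tail s g (ℕP.≰⇒> g≰s) w∈)

tail-suc : ∀ s (g : Subset n) {w} → s ℕ.< ∣ g ∣ → w ∈ tail (suc s) g → w ∈ tail s g ⊎ toℕ w ≡ pos s g
tail-suc s (b ∷ g) s<g w∈ with ∣ b ∷ g ∣ ℕ.≤? s | ∣ b ∷ g ∣ ℕ.≤? suc s | ∣ g ∣ ℕ.≤? s
tail-suc s (b ∷ g) s<g w∈ | yes g≤s | _ | _ = ⊥-elim (ℕP.<⇒≱ s<g g≤s)
tail-suc s (b ∷ g) s<g here | no _ | yes _ | yes _ = inj₂ refl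
tail-suc s (b ∷ g) s<g (there w∈) | no _ | yes _ | yes g≤s rewrite tail-all s g g≤s = inj₁ (there w∈)
tail-suc s (true ∷ g) s<g w∈ | no _ | yes 1+g≤1+s | no g≰s = ⊥-elim (g≰s (ℕP.≤-pred 1+g≤1+s))
tail-suc s (false ∷ g) s<g (there w∈) | no _ | yes g≤1+s | no g≰s
  with tail-suc s g (ℕP.≰⇒> g≰s) (subst (_ ∈_) (sym (tail-all (suc s) g g≤1+s)) w∈)
... | inj₁ w∈′ = inj₁ (there w∈′)
... | inj₂ eq = inj₂ (cong suc eq)
tail-suc s (b ∷ g) s<g w∈ | no _ | no g≰1+s | yes g≤s = ⊥-elim (g≰1+s (ℕP.≤-trans (∣b∷p∣≤ b g) (s≤s g≤s)))
tail-suc s (b ∷ g) s<g (there w∈) | no _ | no _ | no g≰s with tail-suc s g (ℕP.≰⇒> g≰s) w∈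
... | inj₁ w∈′ = inj₁ (there w∈′)
... | inj₂ eq = inj₂ (cong suc eq)

pos-vertex : ∀ s (g : Subset n) → s ℕ.< ∣ g ∣ → Σ (Fin n) λ v → toℕ v ≡ pos s g × v ∈ tail (suc s) g
pos-vertex s (b ∷ g) s<g with ∣ b ∷ g ∣ ℕ.≤? suc s | ∣ g ∣ ℕ.≤? s
pos-vertex s (true ∷ g) s<g | yes _ | yes _ = zero , refl , here
pos-vertex s (true ∷ g) s<g | no g≰1+s | yes g≤s = ⊥-elim (g≰1+s (s≤s g≤s))
pos-vertex s (false ∷ g) s<g | _ | yes g≤s = ⊥-elim (ℕP.<⇒≱ s<g g≤s)
... | yes g≤1+s | no g≰s with pos-vertex s g (ℕP.≰⇒> g≰s)
...   | v , eq , v∈ = suc v , cong suc eq , there (tail-⊆ (suc s) g v∈)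
pos-vertex s (b ∷ g) s<g | no _ | no g≰s with pos-vertex s g (ℕP.≰⇒> g≰s)
... | v , eq , v∈ = suc v , cong suc eq , there v∈

-- Levels are reached from the top down: the vertex that takes g to level `suc s` is read before the
-- one that takes it to level s.
pos-suc< : ∀ s (g : Subset n) → suc s ℕ.< ∣ g ∣ → pos (suc s) g ℕ.< pos s g
pos-suc< s g 1+s<g with pos-vertex s g (ℕP.<-trans (ℕP.n<1+n s) 1+s<g)
... | v , eq , v∈ = subst (pos (suc s) g ℕ.<_) eq (pos<tail (suc s) g 1+s<g v∈)

-- Sums over vertices and over subsets.

∈-allSubsets : ∀ (σ : Subset n) → σ ∈ₗ allSubsets n
∈-allSubsets [] = LAny.here refl
∈-allSubsets (false ∷ σ) = MP.∈-++⁺ˡ (MP.∈-map⁺ (outside ∷_) (∈-allSubsets σ))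
∈-allSubsets (true ∷ σ) = MP.∈-++⁺ʳ _ (MP.∈-map⁺ (inside ∷_) (∈-allSubsets σ))

infix 8 _∈ᵇ_ _⊆ᵇ_

_∈ᵇ_ : Fin n → Subset n → Bool
v ∈ᵇ S = does (v ∈? S)

_⊆ᵇ_ : Subset n → Subset n → Bool
σ ⊆ᵇ S = does (σ ⊆? S)

∑ᵥ : (Fin n → ℚ) → ℚ
∑ᵥ f = ∑ (allFin _) f

∑ₛ : (Subset n → ℚ) → ℚ
∑ₛ f = ∑ (allSubsets _) f

≤∑ᵥ : ∀ {f : Fin n → ℚ} → (∀ v → 0ℚ ≤ℚ f v) → ∀ v → f v ≤ℚ ∑ᵥ f
≤∑ᵥ 0≤f v = ≤∑ (allFin _) 0≤f (MP.∈-allFin v)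

≤∑ₛ : ∀ {f : Subset n → ℚ} → (∀ σ → 0ℚ ≤ℚ f σ) → ∀ σ → f σ ≤ℚ ∑ₛ f
≤∑ₛ 0≤f σ = ≤∑ (allSubsets _) 0≤f (∈-allSubsets σ)

∑ᵥ-suc : ∀ (f : Fin (suc n) → ℚ) → ∑ᵥ f ≡ f zero + ∑ᵥ (λ v → f (suc v))
∑ᵥ-suc {n} f = cong (f zero +_) (trans (cong (λ xs → ∑ xs f) (sym (LP.map-tabulate {n = n} (λ v → v) suc))) (∑-map suc (allFin n) f))

∑-card : ∀ (S : Subset n) → ∑ᵥ (λ v → ι (v ∈ᵇ S)) ≡ κ ∣ S ∣
∑-card [] = sym κ-0
∑-card (b ∷ S) = trans (∑ᵥ-suc (λ v → ι (v ∈ᵇ (b ∷ S)))) (trans (cong (ι (zero ∈ᵇ (b ∷ S)) +_) (trans (∑-cong (allFin _) tl) (∑-card S))) (hd b))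
  where
  tl : ∀ v → ι (suc v ∈ᵇ (b ∷ S)) ≡ ι (v ∈ᵇ S)
  tl v = cong ι (iff-≡ (λ h → true-dec (v ∈? S) (SP.drop-there (dec-true (suc v ∈? (b ∷ S)) h)))
                       (λ h → true-dec (suc v ∈? (b ∷ S)) (there (dec-true (v ∈? S) h))))
  hd : ∀ b → ι (zero ∈ᵇ (b ∷ S)) + κ ∣ S ∣ ≡ κ ∣ b ∷ S ∣
  hd true = trans (cong (_+ κ ∣ S ∣) (sym κ-1)) (sym (κ-+ 1 ∣ S ∣))
  hd false = ℚP.+-identityˡ _

⊆ᵇ-mono : ∀ {σ A : Subset n} b {c} → (b ∷ σ) ⊆ᵇ (c ∷ A) ≡ true → σ ⊆ᵇ A ≡ true
⊆ᵇ-mono {σ = σ} {A} b {c} h = true-dec (σ ⊆? A) (SP.drop-∷-⊆ (dec-true ((b ∷ σ) ⊆? (c ∷ A)) h))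

∑-powerset : ∀ (A : Subset n) → ∑ₛ (λ σ → ι (σ ⊆ᵇ A)) ≤ℚ κ (2 ℕ.^ ∣ A ∣)
∑-powerset [] = ℚP.≤-reflexive (sym κ-1)
∑-powerset {suc n} (b ∷ A) = ℚP.≤-trans (ℚP.≤-reflexive (trans (∑-++ (map (outside ∷_) (allSubsets _)) _ f)
    (cong₂ _+_ (∑-map (outside ∷_) (allSubsets _) f) (∑-map (inside ∷_) (allSubsets _) f))))
    (bound b)
  where
  f = λ σ → ι (σ ⊆ᵇ (b ∷ A))
  mono : ∀ b c → ∑ₛ (λ σ → ι ((c ∷ σ) ⊆ᵇ (b ∷ A))) ≤ℚ κ (2 ℕ.^ ∣ A ∣)
  mono b c = ℚP.≤-trans (∑-mono (allSubsets _) (λ σ → ι-mono {(c ∷ σ) ⊆ᵇ (b ∷ A)} (⊆ᵇ-mono c))) (∑-powerset A)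
  zeros : ∑ₛ (λ σ → ι ((inside ∷ σ) ⊆ᵇ (outside ∷ A))) ≡ 0ℚ
  zeros = trans (∑-cong (allSubsets _) (λ σ → cong ι (false-dec ((inside ∷ σ) ⊆? (outside ∷ A)) (λ sub → ⊥-elim (no-in (sub here))))))
    (∑-0 (allSubsets n))
    where
    no-in : ¬ (zero ∈ outside ∷ A)
    no-in ()
  bound : ∀ b → ∑ₛ (λ σ → ι ((outside ∷ σ) ⊆ᵇ (b ∷ A))) + ∑ₛ (λ σ → ι ((inside ∷ σ) ⊆ᵇ (b ∷ A))) ≤ℚ κ (2 ℕ.^ ∣ b ∷ A ∣)
  bound true = ℚP.≤-trans (ℚP.+-mono-≤ (mono true false) (mono true true))
    (ℚP.≤-reflexive (trans (sym (κ-+ (2 ℕ.^ ∣ A ∣) _)) (cong (λ z → κ (2 ℕ.^ ∣ A ∣ ℕ.+ z)) (sym (ℕP.+-identityʳ _)))))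
  bound false = ℚP.≤-trans (ℚP.+-mono-≤ (mono false false) (ℚP.≤-reflexive zeros)) (ℚP.≤-reflexive (ℚP.+-identityʳ _))

⁅⁆⊆ : ∀ {u : Fin n} {S} → u ∈ S → ⁅ u ⁆ ⊆ S
⁅⁆⊆ {u = u} u∈S w∈ with SP.x∈⁅y⁆⇒x≡y u w∈
... | refl = u∈S

⁅⁆⊆ᵇ : ∀ (u : Fin n) S → ⁅ u ⁆ ⊆ᵇ S ≡ u ∈ᵇ S
⁅⁆⊆ᵇ u S = iff-≡ (λ h → true-dec (u ∈? S) (dec-true (⁅ u ⁆ ⊆? S) h (SP.x∈⁅x⁆ u)))
                 (λ h → true-dec (⁅ u ⁆ ⊆? S) (⁅⁆⊆ (dec-true (u ∈? S) h)))

∣∪⁅⁆∣ : ∀ (σ : Subset n) v → v ∉ σ → ∣ σ ∪ ⁅ v ⁆ ∣ ≡ suc ∣ σ ∣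
∣∪⁅⁆∣ (true ∷ σ) zero v∉ = ⊥-elim (v∉ here)
∣∪⁅⁆∣ {suc n} (false ∷ σ) zero v∉ = cong (λ p → suc ∣ p ∣) (SP.∪-identityʳ σ)
∣∪⁅⁆∣ (true ∷ σ) (suc v) v∉ = cong suc (∣∪⁅⁆∣ σ v (λ v∈ → v∉ (there v∈)))
∣∪⁅⁆∣ (false ∷ σ) (suc v) v∉ = ∣∪⁅⁆∣ σ v (λ v∈ → v∉ (there v∈))

-- The algorithm, its fingerprints and its containers.

∨-true : ∀ {a b} → a ∨ b ≡ true → a ≡ true ⊎ b ≡ true
∨-true {true} _ = inj₁ refl
∨-true {false} h = inj₂ h

true-∨ˡ : ∀ {a b} → a ≡ true → a ∨ b ≡ true
true-∨ˡ refl = refl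

true-∨ʳ : ∀ {a b} → b ≡ true → a ∨ b ≡ true
true-∨ʳ {true} _ = refl
true-∨ʳ {false} h = h

not-true : ∀ {b} → not b ≡ true → b ≡ false
not-true {false} _ = refl

∈-tabulate⁺ : ∀ {n} {f : Fin n → Bool} {v} → f v ≡ true → v ∈ tabulate f
∈-tabulate⁺ {f = f} {v} h = VP.lookup⇒[]= v (tabulate f) (trans (VP.lookup∘tabulate f v) h)

∈-tabulate⁻ : ∀ {n} {f : Fin n → Bool} {v} → v ∈ tabulate f → f v ≡ true
∈-tabulate⁻ {f = f} {v} v∈ = trans (sym (VP.lookup∘tabulate f v)) (VP.[]=⇒lookup v∈)

-- The degree threshold β stands for ζd.
module Algorithm {r n : ℕ} (G : RGraph r n) (τ ζ β : ℚ) where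

  opaque
    -- The function d^(j), with a set σ in place of the vertex. It is antitone in σ, so the single
    -- sequence `D σ` bounds the co-degrees of all larger sets `σ ∪ ⁅ v ⁆` met in the recursion.
    D : Subset n → ℕ → ℚ
    D σ j = κ (maxL (map (λ σ′ → if σ ⊆ᵇ σ′ ∧ (∣ σ′ ∣ ℕ.≡ᵇ j) then codeg G σ′ else 0) (allSubsets n)))

  -- Unfolds the recursion Bₛ(j) = 2ˢ τ Bₛ₊₁(j) + Bₛ₊₁(j+1), Bᵣ(j) = x j, t = r - s steps deep:
  -- for x = D σ and j = ∣ σ ∣ it bounds the degree of σ in Pₛ.
  lin : ℕ → ℕ → (ℕ → ℚ) → ℚ
  lin zero j x = x j
  lin (suc t) j x = κ (2 ℕ.^ (r ∸ suc t)) * τ * lin t j x + lin t (suc j) x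

  opaque
    -- For a vertex, the degree aimed at. For |σ| ≥ 2, the bound for the degree of σ in Pₛ₊₁ scaled
    -- by τ and by 2^s, the number of subsets of a member of Pₛ.
    θ : ℕ → Subset n → ℚ
    θ s σ with ∣ σ ∣ ℕ.≤? 1
    ... | yes _ = τ ^ℚ (r ∸ s) * κ (codeg G σ)
    ... | no _ = κ (2 ℕ.^ s) * τ * lin (r ∸ suc s) ∣ σ ∣ (D σ)

    θ-vertex : ∀ s u → θ s ⁅ u ⁆ ≡ τ ^ℚ (r ∸ s) * κ (deg G u)
    θ-vertex s u with ∣ ⁅ u ⁆ ∣ ℕ.≤? 1
    ... | yes _ = refl
    ... | no ≰1 = ⊥-elim (≰1 (ℕP.≤-reflexive (SP.∣⁅x⁆∣≡1 u)))

    θ-large : ∀ s {σ} → 2 ≤ ∣ σ ∣ → θ s σ ≡ κ (2 ℕ.^ s) * τ * lin (r ∸ suc s) ∣ σ ∣ (D σ)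
    θ-large s {σ} 2≤ with ∣ σ ∣ ℕ.≤? 1
    ... | yes ≤1 = ⊥-elim (ℕP.<⇒≱ 2≤ ≤1)
    ... | no _ = refl

  -- The members of the multiset Pₛ are represented by the edges they come from:
  -- S s g says that tail s g belongs to Pₛ, and cnt S s is the degree in Pₛ.
  State : Set
  State = ℕ → Subset n → Bool

  cnt : State → ℕ → Subset n → ℚ
  cnt S s σ = ∑ₛ (λ g → ι (S s g ∧ σ ⊆ᵇ tail s g))

  Blocked : State → ℕ → Subset n → Set
  Blocked S s f = ∃ λ σ → Nonempty σ × σ ⊆ f × θ s σ ≤ℚ cnt S s σ

  opaque
    blocked? : ∀ S s f → Dec (Blocked S s f)
    blocked? S s f = anySubset? (λ σ → nonempty? σ ×-dec (σ ⊆? f ×-dec (θ s σ ℚP.≤? cnt S s σ)))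

  -- fsize S s k is ∣Fᵥₛ∣ for the vertex v with index k.
  free : State → ℕ → ℕ → Subset n → Bool
  free S s k g = does (pos s g ℕ.≟ k) ∧ (S (suc s) g ∧ not (does (blocked? S s (tail s g))))

  fsize : State → ℕ → ℕ → ℚ
  fsize S s k = ∑ₛ (λ g → ι (free S s k g))

  -- The disjunction merges no two copies: `free` demands `pos s g` = k, so g can enter level s at
  -- one step only. Multiplicity in Pₛ comes from different edges with the same tail.
  step : ℕ → Bool → State → State
  step k b S s g = S s g ∨ (b ∧ free S s k g)

  init : State
  init s g = does (s ℕ.≟ r) ∧ edge G g

  run : (ℕ → Bool) → ℕ → State
  run b zero = init
  run b (suc k) = step k (b k) (run b k)

  -- The second alternative is the case s = 0, for which the bound carries no factor ζ.
  Selected : State → Fin n → Set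
  Selected S v = β ≤ℚ κ (deg G v)
    × ((∃ λ (s : Fin (r ∸ 1)) → ζ * τ ^ℚ (r ∸ suc (suc (toℕ s))) * κ (deg G v) ≤ℚ fsize S (suc (toℕ s)) (toℕ v))
      ⊎ θ 1 ⁅ v ⁆ ≤ℚ cnt S 1 ⁅ v ⁆)

  opaque
    selected? : ∀ S v → Dec (Selected S v)
    selected? S v = (_ ℚP.≤? _) ×-dec (FP.any? (λ s → _ ℚP.≤? _) ⊎-dec (_ ℚP.≤? _))

  opaque
    at? : ∀ (A : Subset n) k → Dec (∃ λ v → toℕ v ≡ k × v ∈ A)
    at? A k = FP.any? (λ v → (toℕ v ℕ.≟ k) ×-dec (v ∈? A))

  at : Subset n → ℕ → Bool
  at A k = does (at? A k)

  at-∈ : ∀ {A : Subset n} {v} → v ∈ A → at A (toℕ v) ≡ true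
  at-∈ {A} {v} v∈A = true-dec (at? A (toℕ v)) (v , refl , v∈A)

  ∈-at : ∀ {A : Subset n} {v} → at A (toℕ v) ≡ true → v ∈ A
  ∈-at {A} {v} h with dec-true (at? A (toℕ v)) h
  ... | w , eq , w∈A = subst (_∈ A) (FP.toℕ-injective eq) w∈A

  opaque
    choose? : ∀ (I : Subset n) S k → Dec (∃ λ v → toℕ v ≡ k × v ∈ I × Selected S v)
    choose? I S k = FP.any? (λ v → (toℕ v ℕ.≟ k) ×-dec (v ∈? I ×-dec selected? S v))

  choose : Subset n → State → ℕ → Bool
  choose I S k = does (choose? I S k)

  -- The run in which I is known and selection is decided on the way; `run` is told which indices to
  -- accept, which is all that a container may use.
  prune : Subset n → ℕ → State
  prune I zero = init
  prune I (suc k) = step k (choose I (prune I k) k) (prune I k)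

  opaque
    fingerprint : Subset n → Subset n
    fingerprint I = tabulate (λ v → does (v ∈? I ×-dec selected? (prune I (toℕ v)) v))

    container : Subset n → Subset n
    container A = tabulate (λ v → does (v ∈? A ⊎-dec ¬? (selected? (run (at A) (toℕ v)) v)))

    fingerprint⁻ : ∀ {I v} → v ∈ fingerprint I → v ∈ I × Selected (prune I (toℕ v)) v
    fingerprint⁻ {I} {v} v∈ = dec-true (v ∈? I ×-dec selected? (prune I (toℕ v)) v) (∈-tabulate⁻ v∈)

    fingerprint⁺ : ∀ {I v} → v ∈ I → Selected (prune I (toℕ v)) v → v ∈ fingerprint I
    fingerprint⁺ {I} {v} v∈I sel = ∈-tabulate⁺ (true-dec (v ∈? I ×-dec selected? (prune I (toℕ v)) v) (v∈I , sel))

    container⁻ : ∀ {A v} → v ∈ container A → v ∈ A ⊎ ¬ Selected (run (at A) (toℕ v)) v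
    container⁻ {A} {v} v∈ = dec-true (v ∈? A ⊎-dec ¬? (selected? (run (at A) (toℕ v)) v)) (∈-tabulate⁻ v∈)

    container⁺ : ∀ {A v} → v ∈ A ⊎ ¬ Selected (run (at A) (toℕ v)) v → v ∈ container A
    container⁺ {A} {v} h = ∈-tabulate⁺ (true-dec (v ∈? A ⊎-dec ¬? (selected? (run (at A) (toℕ v)) v)) h)

  -- Selection at v reads only the state before v. By induction the selected vertices of I, supplied
  -- from outside, reproduce that state, so the fingerprint encodes the whole run on I.
  run-prune : ∀ I k → run (at (fingerprint I)) k ≡ prune I k
  run-prune I zero = refl
  run-prune I (suc k) = cong₂ (step k) at≡choose (run-prune I k)
    where
    at≡choose : at (fingerprint I) k ≡ choose I (prune I k) k
    at≡choose = iff-≡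
      (λ h → true-dec (choose? I (prune I k) k) (to (dec-true (at? (fingerprint I) k) h)))
      (λ h → true-dec (at? (fingerprint I) k) (from (dec-true (choose? I (prune I k) k) h)))
      where
      to : (∃ λ v → toℕ v ≡ k × v ∈ fingerprint I) → ∃ λ v → toℕ v ≡ k × v ∈ I × Selected (prune I k) v
      to (v , refl , v∈) = v , refl , fingerprint⁻ v∈
      from : (∃ λ v → toℕ v ≡ k × v ∈ I × Selected (prune I k) v) → ∃ λ v → toℕ v ≡ k × v ∈ fingerprint I
      from (v , refl , v∈I , sel) = v , refl , fingerprint⁺ v∈I sel

  run-local : ∀ b b′ k → (∀ j → j ℕ.< k → b j ≡ b′ j) → run b k ≡ run b′ k
  run-local b b′ zero _ = refl
  run-local b b′ (suc k) b≡b′ = cong₂ (step k) (b≡b′ k ℕP.≤-refl) (run-local b b′ k (λ j j<k → b≡b′ j (ℕP.m<n⇒m<1+n j<k)))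

  ⊆-container : ∀ I → I ⊆ container (fingerprint I)
  ⊆-container I {v} v∈I with selected? (prune I (toℕ v)) v
  ... | yes sel = container⁺ (inj₁ (fingerprint⁺ v∈I sel))
  ... | no ¬sel = container⁺ (inj₂ (λ sel → ¬sel (subst (λ S → Selected S v) (run-prune I (toℕ v)) sel)))

  ∈prefix⁺ : ∀ {w} {v : Fin n} → toℕ v ℕ.< w → v ∈ prefix n w
  ∈prefix⁺ {w} {v} v<w = ∈-tabulate⁺ (if-true (ℕP.<⇒<ᵇ v<w))
    where
    if-true : ∀ {b} → T b → (if b then inside else outside) ≡ true
    if-true {true} _ = refl

  ∈prefix⁻ : ∀ {w} {v : Fin n} → v ∈ prefix n w → toℕ v ℕ.< w
  ∈prefix⁻ {w} {v} v∈ = ℕP.<ᵇ⇒< (toℕ v) w (if-T (∈-tabulate⁻ v∈))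
    where
    if-T : ∀ {b} → (if b then inside else outside) ≡ true → T b
    if-T {true} _ = _

  -- Whether v lies in the container depends on A only at v itself and, through the state, at the
  -- vertices before v.
  container-online : ∀ A w → container A ∩ prefix n w ≡ container (A ∩ prefix n w) ∩ prefix n w
  container-online A w = SP.⊆-antisym to from
    where
    A′ = A ∩ prefix n w
    at≡ : ∀ j → j ℕ.< w → at A j ≡ at A′ j
    at≡ j j<w = iff-≡ (λ h → true-dec (at? A′ j) (f (dec-true (at? A j) h)))
                      (λ h → true-dec (at? A j) (f⁻¹ (dec-true (at? A′ j) h)))
      where
      f : (∃ λ v → toℕ v ≡ j × v ∈ A) → ∃ λ v → toℕ v ≡ j × v ∈ A′
      f (v , refl , v∈A) = v , refl , SP.x∈p∩q⁺ (v∈A , ∈prefix⁺ j<w)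
      f⁻¹ : (∃ λ v → toℕ v ≡ j × v ∈ A′) → ∃ λ v → toℕ v ≡ j × v ∈ A
      f⁻¹ (v , refl , v∈A′) = v , refl , proj₁ (SP.x∈p∩q⁻ A _ v∈A′)
    run≡ : ∀ {v : Fin n} → toℕ v ℕ.< w → run (at A) (toℕ v) ≡ run (at A′) (toℕ v)
    run≡ {v} v<w = run-local (at A) (at A′) (toℕ v) (λ j j<v → at≡ j (ℕP.<-trans j<v v<w))
    to : container A ∩ prefix n w ⊆ container A′ ∩ prefix n w
    to {v} v∈ with SP.x∈p∩q⁻ (container A) _ v∈
    ... | v∈C , v∈w with container⁻ v∈C
    ...   | inj₁ v∈A = SP.x∈p∩q⁺ (container⁺ (inj₁ (SP.x∈p∩q⁺ (v∈A , v∈w))) , v∈w)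
    ...   | inj₂ ¬sel = SP.x∈p∩q⁺ (container⁺ (inj₂ (subst (λ S → ¬ Selected S v) (run≡ (∈prefix⁻ v∈w)) ¬sel)) , v∈w)
    from : container A′ ∩ prefix n w ⊆ container A ∩ prefix n w
    from {v} v∈ with SP.x∈p∩q⁻ (container A′) _ v∈
    ... | v∈C , v∈w with container⁻ v∈C
    ...   | inj₁ v∈A′ = SP.x∈p∩q⁺ (container⁺ (inj₁ (proj₁ (SP.x∈p∩q⁻ A _ v∈A′))) , v∈w)
    ...   | inj₂ ¬sel = SP.x∈p∩q⁺ (container⁺ (inj₂ (subst (λ S → ¬ Selected S v) (sym (run≡ (∈prefix⁻ v∈w))) ¬sel)) , v∈w)

  -- Invariants of a run.

  module _ (b : ℕ → Bool) where

    run-edge : ∀ k s {g} → run b k s g ≡ true → edge G g ≡ true × s ≤ r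
    run-edge zero s h with ∧-true {does (s ℕ.≟ r)} h
    ... | s≡r , eg = eg , ℕP.≤-reflexive (dec-true (s ℕ.≟ r) s≡r)
    run-edge (suc k) s {g} h with ∨-true {run b k s g} h
    ... | inj₁ h′ = run-edge k s h′
    ... | inj₂ h′ with run-edge k (suc s) (proj₁ (∧-true (proj₂ (∧-true {does (pos s g ℕ.≟ k)} (proj₂ (∧-true {b k} h′))))))
    ...   | eg , s<r = eg , ℕP.<⇒≤ s<r

    run-card : ∀ k s {g} → run b k s g ≡ true → ∣ g ∣ ≡ r
    run-card k s h = uniform G _ (proj₁ (run-edge k s h))

    run-mono : ∀ {j k} s {g} → j ≤ k → run b j s g ≡ true → run b k s g ≡ true
    run-mono s {g} j≤k h = go (ℕP.≤⇒≤′ j≤k)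
      where
      go : ∀ {k} → _ ℕ.≤′ k → run b k s g ≡ true
      go ℕ.≤′-refl = h
      go (ℕ.≤′-step j≤k) = true-∨ˡ (go j≤k)

    run-top : ∀ k {g} → edge G g ≡ true → run b k r g ≡ true
    run-top k eg = run-mono {0} {k} r z≤n (true-∧ (true-dec (r ℕ.≟ r) refl) eg)

    run-origin : ∀ k s {g} → s ℕ.< r → run b k s g ≡ true →
      pos s g ℕ.< k × b (pos s g) ≡ true × free (run b (pos s g)) s (pos s g) g ≡ true
    run-origin zero s s<r h = ⊥-elim (ℕP.<⇒≢ s<r (dec-true (s ℕ.≟ r) (proj₁ (∧-true {does (s ℕ.≟ r)} h))))
    run-origin (suc k) s {g} s<r h with ∨-true {run b k s g} h
    ... | inj₁ h′ with run-origin k s s<r h′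
    ...   | p<k , rest = ℕP.m<n⇒m<1+n p<k , rest
    run-origin (suc k) s {g} s<r h | inj₂ h′ with ∧-true {b k} h′
    ...   | bk , fr = subst (λ p → p ℕ.< suc k × b p ≡ true × free (run b p) s p g ≡ true)
                        (sym (dec-true (pos s g ℕ.≟ k) (proj₁ (∧-true {does (pos s g ℕ.≟ k)} fr)))) (ℕP.≤-refl , bk , fr)

    -- Membership in level `suc s` is final when the least vertex of `tail (suc s) g` is read: the
    -- top level is fixed from the start, and any other entry happens at the smaller index
    -- `pos (suc s) g`.
    run-settled : ∀ k s {g} → s ℕ.< r → run b k (suc s) g ≡ true → run b (pos s g) (suc s) g ≡ true
    run-settled k s {g} s<r h with suc s ℕ.≟ r
    ... | yes refl = run-top (pos s g) (proj₁ (run-edge k (suc s) h))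
    ... | no 1+s≢r with run-origin k (suc s) (ℕP.≤∧≢⇒< s<r 1+s≢r) h
    ...   | _ , bp , fr = run-mono (suc s) (pos-suc< s g (subst (suc s ℕ.<_) (sym (run-card k (suc s) h)) (ℕP.≤∧≢⇒< s<r 1+s≢r)))
                            (true-∨ʳ {run b (pos (suc s) g) (suc s) g} (true-∧ bp fr))

    run-suc⇒ : ∀ k s {g} → s ℕ.< r → run b k s g ≡ true → run b k (suc s) g ≡ true
    run-suc⇒ k s {g} s<r h with run-origin k s s<r h
    ... | p<k , _ , fr = run-mono (suc s) (ℕP.<⇒≤ p<k) (proj₁ (∧-true (proj₂ (∧-true {does (pos s g ℕ.≟ pos s g)} fr))))

    -- Climbing from level s to level r, every vertex stripped from g was accepted by b when g
    -- entered the level below. At s = 1 this turns members of P₁ into edges inside T.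
    run-head : ∀ k s {g v} → run b k s g ≡ true → v ∈ g → v ∈ tail s g ⊎ b (toℕ v) ≡ true
    run-head k s {g} {v} h v∈g = go (r ∸ s) s (ℕP.m+[n∸m]≡n (proj₂ (run-edge k s h))) h
      where
      go : ∀ t s → s ℕ.+ t ≡ r → run b k s g ≡ true → v ∈ tail s g ⊎ b (toℕ v) ≡ true
      go zero s eq h = inj₁ (subst (v ∈_) (sym (tail-all s g (ℕP.≤-reflexive (trans (run-card k s h) (trans (sym eq) (ℕP.+-identityʳ s)))))) v∈g)
      go (suc t) s eq h with ℕP.≤-trans (s≤s (ℕP.m≤m+n s t)) (ℕP.≤-reflexive (trans (sym (ℕP.+-suc s t)) eq))
      ... | s<r with go t (suc s) (trans (sym (ℕP.+-suc s t)) eq) (run-suc⇒ k s s<r h)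
      ...   | inj₂ bv = inj₂ bv
      ...   | inj₁ v∈ with tail-suc s g (subst (s ℕ.<_) (sym (run-card k s h)) s<r) v∈
      ...     | inj₁ v∈′ = inj₁ v∈′
      ...     | inj₂ eq′ = inj₂ (subst (λ p → b p ≡ true) (sym eq′) (proj₁ (proj₂ (run-origin k s s<r h))))

∑≤0 : ∀ {A : Set} (xs : List A) {f : A → ℚ} → (∀ x → f x ≤ℚ 0ℚ) → ∑ xs f ≤ℚ 0ℚ
∑≤0 xs f≤0 = ℚP.≤-trans (∑-mono xs f≤0) (ℚP.≤-reflexive (∑-0 xs))

ι≤0 : ∀ {b} → ¬ (b ≡ true) → ι b ≤ℚ 0ℚ
ι≤0 ¬b = ι-≤ ℚP.≤-refl (λ h → ⊥-elim (¬b h))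

ι-∨ : ∀ {a b c} → (a ≡ true → b ≡ true ⊎ c ≡ true) → ι a ≤ℚ ι b + ι c
ι-∨ {false} {b} {c} h = 0≤+ (0≤ι b) (0≤ι c)
ι-∨ {true} {b} {c} h with h refl
... | inj₁ refl = ≤-+ʳ (0≤ι c)
... | inj₂ refl = ≤-+ˡ (0≤ι b)

-- Upper bounds for the degrees in Pₛ.

module Degrees {r n : ℕ} (G : RGraph r n) (τ ζ β : ℚ) (0<τ : 0ℚ < τ) where
  open Algorithm G τ ζ β

  0≤τ : 0ℚ ≤ℚ τ
  0≤τ = ℚP.<⇒≤ 0<τ

  0≤weight : ∀ s → 0ℚ ≤ℚ κ (2 ℕ.^ s) * τ
  0≤weight s = 0≤* (0≤κ _) 0≤τ

  0≤lin : ∀ t j {x} → (∀ j → 0ℚ ≤ℚ x j) → 0ℚ ≤ℚ lin t j x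
  0≤lin zero j 0≤x = 0≤x j
  0≤lin (suc t) j 0≤x = 0≤+ (0≤* (0≤weight (r ∸ suc t)) (0≤lin t j 0≤x)) (0≤lin t (suc j) 0≤x)

  lin-mono : ∀ t j {x y} → (∀ j → x j ≤ℚ y j) → lin t j x ≤ℚ lin t j y
  lin-mono zero j x≤y = x≤y j
  lin-mono (suc t) j x≤y = ℚP.+-mono-≤ (*-monoˡ (0≤weight (r ∸ suc t)) (lin-mono t j x≤y)) (lin-mono t (suc j) x≤y)

  lin-∑ : ∀ {A : Set} (xs : List A) t j (x : A → ℕ → ℚ) → ∑ xs (λ a → lin t j (x a)) ≡ lin t j (λ j → ∑ xs (λ a → x a j))
  lin-∑ xs zero j x = refl
  lin-∑ xs (suc t) j x = trans (∑-+ xs (λ a → κ (2 ℕ.^ (r ∸ suc t)) * τ * lin t j (x a)) (λ a → lin t (suc j) (x a)))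
    (cong₂ _+_ (trans (∑-*ˡ xs (κ (2 ℕ.^ (r ∸ suc t)) * τ) (λ a → lin t j (x a))) (cong (κ (2 ℕ.^ (r ∸ suc t)) * τ *_) (lin-∑ xs t j x)))
               (lin-∑ xs t (suc j) x))

  opaque
    unfolding D

    0≤D : ∀ σ j → 0ℚ ≤ℚ D σ j
    0≤D σ j = 0≤κ _

    D-antitone : ∀ {σ σ′} → σ ⊆ σ′ → ∀ j → D σ′ j ≤ℚ D σ j
    D-antitone {σ} {σ′} σ⊆σ′ j = κ-mono (maxL-mono _ _ (allSubsets n) (λ ρ → if-mono (∣ ρ ∣ ℕ.≡ᵇ j) (sub ρ)))
      where
      sub : ∀ ρ → σ′ ⊆ᵇ ρ ≡ true → σ ⊆ᵇ ρ ≡ true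
      sub ρ h = true-dec (σ ⊆? ρ) (SP.⊆-trans σ⊆σ′ (dec-true (σ′ ⊆? ρ) h))
      if-mono : ∀ {a b m} c → (a ≡ true → b ≡ true) → (if a ∧ c then m else 0) ≤ (if b ∧ c then m else 0)
      if-mono {false} c h = z≤n
      if-mono {true} c h rewrite h refl = ℕP.≤-refl

    codeg≤D : ∀ σ → κ (codeg G σ) ≤ℚ D σ ∣ σ ∣
    codeg≤D σ = κ-mono (ℕP.≤-trans (ℕP.≤-reflexive (sym (if-true (true-∧ (true-dec (σ ⊆? σ) (SP.⊆-refl)) (≡ᵇ-refl ∣ σ ∣)))))
      (maxL-≥ (λ σ′ → if σ ⊆ᵇ σ′ ∧ (∣ σ′ ∣ ℕ.≡ᵇ ∣ σ ∣) then codeg G σ′ else 0) (∈-allSubsets σ)))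
      where
      ≡ᵇ-refl : ∀ m → (m ℕ.≡ᵇ m) ≡ true
      ≡ᵇ-refl zero = refl
      ≡ᵇ-refl (suc m) = ≡ᵇ-refl m
      if-true : ∀ {b} {m k : ℕ} → b ≡ true → (if b then m else k) ≡ m
      if-true refl = refl

  codeg-∑ : ∀ σ → κ (codeg G σ) ≡ ∑ₛ (λ g → ι (edge G g ∧ σ ⊆ᵇ g))
  codeg-∑ σ = count-∑ _ (allSubsets n)

  0≤cnt : ∀ S s σ → 0ℚ ≤ℚ cnt S s σ
  0≤cnt S s σ = 0≤∑ (allSubsets n) (λ g → 0≤ι (S s g ∧ σ ⊆ᵇ tail s g))

  module _ (b : ℕ → Bool) where

    cnt-mono : ∀ {j k} s σ → j ≤ k → cnt (run b j) s σ ≤ℚ cnt (run b k) s σ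
    cnt-mono {j} {k} s σ j≤k = ∑-mono (allSubsets n) (λ g → ι-mono {run b j s g ∧ σ ⊆ᵇ tail s g}
      (λ h → true-∧ (run-mono b s j≤k (proj₁ (∧-true h))) (proj₂ (∧-true {run b j s g} h))))

    -- Once σ reaches its threshold nothing containing it is accepted, so the count
    -- overshoots by at most the contribution of the one vertex that crossed it.
    cnt≤θ+ : ∀ K s σ U → s ℕ.< r → Nonempty σ → 0ℚ ≤ℚ U → 0ℚ ≤ℚ θ s σ →
      (∀ v → v ∉ σ → cnt (run b K) (suc s) (σ ∪ ⁅ v ⁆) ≤ℚ U) →
      ∀ k → k ≤ K → cnt (run b k) s σ ≤ℚ θ s σ + U
    cnt≤θ+ K s σ U s<r σ≢∅ 0≤U 0≤θ bound zero _ =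
      ℚP.≤-trans (∑≤0 (allSubsets n) (λ g → ι≤0 (λ h →
        ℕP.<⇒≢ s<r (dec-true (s ℕ.≟ r) (proj₁ (∧-true {does (s ℕ.≟ r)} (proj₁ (∧-true {init s g} h)))))))) (0≤+ 0≤θ 0≤U)
    cnt≤θ+ K s σ U s<r σ≢∅ 0≤U 0≤θ bound (suc k) k<K = helper (θ s σ ℚP.≤? cnt (run b k) s σ)
      where
      S = run b k
      accepted : ∀ g → run b (suc k) s g ∧ σ ⊆ᵇ tail s g ≡ true →
        S s g ∧ σ ⊆ᵇ tail s g ≡ true ⊎ free S s k g ∧ σ ⊆ᵇ tail s g ≡ true
      accepted g h with ∧-true {run b (suc k) s g} h
      ... | h₁ , sub with ∨-true {S s g} h₁
      ...   | inj₁ old = inj₁ (true-∧ old sub)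
      ...   | inj₂ new = inj₂ (true-∧ (proj₂ (∧-true {b k} new)) sub)
      unblocked : ∀ g → free S s k g ≡ true → ¬ Blocked S s (tail s g)
      unblocked g fr = dec-false (blocked? S s (tail s g))
        (not-true (proj₂ (∧-true {S (suc s) g} (proj₂ (∧-true {does (pos s g ℕ.≟ k)} fr)))))
      position : ∀ g → free S s k g ≡ true → pos s g ≡ k
      position g fr = dec-true (pos s g ℕ.≟ k) (proj₁ (∧-true fr))
      parent : ∀ g → free S s k g ≡ true → S (suc s) g ≡ true
      parent g fr = proj₁ (∧-true (proj₂ (∧-true {does (pos s g ℕ.≟ k)} fr)))
      s<∣g∣ : ∀ g → free S s k g ≡ true → s ℕ.< ∣ g ∣
      s<∣g∣ g fr = subst (s ℕ.<_) (sym (run-card b k (suc s) (parent g fr))) s<r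
      ⊆-true : ∀ g → free S s k g ∧ σ ⊆ᵇ tail s g ≡ true → free S s k g ≡ true × σ ⊆ tail s g
      ⊆-true g h with ∧-true {free S s k g} h
      ... | fr , sub = fr , dec-true (σ ⊆? tail s g) sub
      new≤U : Dec (∃ λ (v : Fin n) → toℕ v ≡ k × v ∉ σ) → ∑ₛ (λ g → ι (free S s k g ∧ σ ⊆ᵇ tail s g)) ≤ℚ U
      -- If no vertex outside σ has index k, nothing new contains σ: the elements of `tail s g` all
      -- come after `pos s g` = k, so σ cannot contain the vertex of index k.
      new≤U (no ¬v) = ℚP.≤-trans (∑≤0 (allSubsets n) (λ g → ι≤0 (absurd g))) 0≤U
        where
        absurd : ∀ g → ¬ (free S s k g ∧ σ ⊆ᵇ tail s g ≡ true)
        absurd g h with ⊆-true g h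
        ... | fr , sub with pos-vertex s g (s<∣g∣ g fr)
        ...   | v , v≡pos , _ = ¬v (v , trans v≡pos (position g fr) , λ v∈σ →
                  ℕP.<-irrefl (sym v≡pos) (pos<tail s g (s<∣g∣ g fr) (sub v∈σ)))
      -- All new sets are accepted through the same v. Putting v back gives members of level `suc s`
      -- that contain `σ ∪ ⁅ v ⁆`, whose degree at the final time K is at most U.
      new≤U (yes (v , v≡k , v∉σ)) = ℚP.≤-trans (∑-mono (allSubsets n) (λ g → ι-mono {free S s k g ∧ σ ⊆ᵇ tail s g} (counted g))) (bound v v∉σ)
        where
        counted : ∀ g → free S s k g ∧ σ ⊆ᵇ tail s g ≡ true → run b K (suc s) g ∧ (σ ∪ ⁅ v ⁆) ⊆ᵇ tail (suc s) g ≡ true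
        counted g h with ⊆-true g h
        ... | fr , sub with pos-vertex s g (s<∣g∣ g fr)
        ...   | w , w≡pos , w∈ = true-∧ (run-mono b (suc s) (ℕP.<⇒≤ k<K) (parent g fr)) (true-dec ((σ ∪ ⁅ v ⁆) ⊆? tail (suc s) g) incl)
          where
          v∈ : v ∈ tail (suc s) g
          v∈ = subst (_∈ tail (suc s) g) (FP.toℕ-injective (trans w≡pos (trans (position g fr) (sym v≡k)))) w∈
          incl : σ ∪ ⁅ v ⁆ ⊆ tail (suc s) g
          incl x∈ with SP.x∈p∪q⁻ σ ⁅ v ⁆ x∈
          ... | inj₁ x∈σ = tail-suc-⊆ s g (sub x∈σ)
          ... | inj₂ x∈v = ⁅⁆⊆ v∈ x∈v
      helper : Dec (θ s σ ≤ℚ cnt S s σ) → cnt (run b (suc k)) s σ ≤ℚ θ s σ + U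
      helper (yes θ≤) = ℚP.≤-trans (∑-mono (allSubsets n) (λ g → ι-mono {run b (suc k) s g ∧ σ ⊆ᵇ tail s g} (old g)))
          (cnt≤θ+ K s σ U s<r σ≢∅ 0≤U 0≤θ bound k (ℕP.<⇒≤ k<K))
        where
        old : ∀ g → run b (suc k) s g ∧ σ ⊆ᵇ tail s g ≡ true → S s g ∧ σ ⊆ᵇ tail s g ≡ true
        old g h with accepted g h
        ... | inj₁ h′ = h′
        ... | inj₂ h′ with ⊆-true g h′
        ...   | fr , sub = ⊥-elim (unblocked g fr (σ , σ≢∅ , sub , θ≤))
      helper (no θ≰) = ℚP.≤-trans (∑-mono (allSubsets n) split)
          (ℚP.≤-trans (ℚP.≤-reflexive (∑-+ (allSubsets n) (λ g → ι (S s g ∧ σ ⊆ᵇ tail s g)) (λ g → ι (free S s k g ∧ σ ⊆ᵇ tail s g))))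
            (ℚP.+-mono-≤ (ℚP.<⇒≤ (ℚP.≰⇒> θ≰)) (new≤U (FP.any? (λ v → (toℕ v ℕ.≟ k) ×-dec ¬? (v ∈? σ))))))
        where
        split : ∀ g → ι (run b (suc k) s g ∧ σ ⊆ᵇ tail s g) ≤ℚ ι (S s g ∧ σ ⊆ᵇ tail s g) + ι (free S s k g ∧ σ ⊆ᵇ tail s g)
        split g = ι-∨ (accepted g)

    cnt-codeg : ∀ k σ → cnt (run b k) r σ ≤ℚ κ (codeg G σ)
    cnt-codeg k σ = ℚP.≤-trans (∑-mono (allSubsets n) (λ g → ι-mono {run b k r g ∧ σ ⊆ᵇ tail r g} (f g))) (ℚP.≤-reflexive (sym (codeg-∑ σ)))
      where
      f : ∀ g → run b k r g ∧ σ ⊆ᵇ tail r g ≡ true → edge G g ∧ σ ⊆ᵇ g ≡ true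
      f g h with ∧-true {run b k r g} h
      ... | h₁ , sub = true-∧ (proj₁ (run-edge b k r h₁)) (true-dec (σ ⊆? g) (SP.⊆-trans (dec-true (σ ⊆? tail r g) sub) (tail-⊆ r g)))

    -- The two terms of the recursion for `lin` are the threshold, proportional to the bound for σ
    -- one level up, and the overshoot, the bound one level up for σ with one more vertex.
    -- `D-antitone` brings the latter back to `D σ`.
    cnt≤lin : ∀ k t s → s ℕ.+ t ≡ r → ∀ σ → 2 ≤ ∣ σ ∣ → cnt (run b k) s σ ≤ℚ lin t ∣ σ ∣ (D σ)
    cnt≤lin k zero s eq σ 2≤σ = ℚP.≤-trans
      (subst (λ s → cnt (run b k) s σ ≤ℚ κ (codeg G σ)) (trans (sym eq) (ℕP.+-identityʳ s)) (cnt-codeg k σ)) (codeg≤D σ)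
    cnt≤lin k (suc t) s eq σ 2≤σ = ℚP.≤-trans
        (cnt≤θ+ k s σ (lin t (suc ∣ σ ∣) (D σ)) s<r σ≢∅ (0≤lin t _ (0≤D σ)) (subst (0ℚ ≤ℚ_) (sym θ≡) (0≤* (0≤weight (r ∸ suc t)) (0≤lin t ∣ σ ∣ (0≤D σ)))) bound k ℕP.≤-refl)
        (ℚP.≤-reflexive (cong (_+ lin t (suc ∣ σ ∣) (D σ)) θ≡))
      where
      eq′ : suc s ℕ.+ t ≡ r
      eq′ = trans (sym (ℕP.+-suc s t)) eq
      s<r : s ℕ.< r
      s<r = ℕP.≤-trans (ℕP.m≤m+n (suc s) t) (ℕP.≤-reflexive eq′)
      σ≢∅ : Nonempty σ
      σ≢∅ with nonempty? σ
      ... | yes ne = ne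
      ... | no em = ⊥-elim (ℕP.<⇒≢ (ℕP.≤-trans (s≤s z≤n) 2≤σ) (sym (trans (cong ∣_∣ (SP.Empty-unique em)) (SP.∣⊥∣≡0 n))))
      θ≡ : θ s σ ≡ κ (2 ℕ.^ (r ∸ suc t)) * τ * lin t ∣ σ ∣ (D σ)
      θ≡ = trans (θ-large s 2≤σ) (cong₂ (λ a c → κ (2 ℕ.^ a) * τ * lin c ∣ σ ∣ (D σ))
        (sym (trans (cong (_∸ suc t) (sym eq)) (ℕP.m+n∸n≡m s (suc t))))
        (trans (cong (_∸ suc s) (sym eq′)) (ℕP.m+n∸m≡n (suc s) t)))
      bound : ∀ v → v ∉ σ → cnt (run b k) (suc s) (σ ∪ ⁅ v ⁆) ≤ℚ lin t (suc ∣ σ ∣) (D σ)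
      bound v v∉σ = ℚP.≤-trans (cnt≤lin k t (suc s) eq′ (σ ∪ ⁅ v ⁆) (subst (2 ≤_) (sym (∣∪⁅⁆∣ σ v v∉σ)) (ℕP.m≤n⇒m≤1+n 2≤σ)))
        (subst (λ j → lin t j (D (σ ∪ ⁅ v ⁆)) ≤ℚ lin t (suc ∣ σ ∣) (D σ)) (sym (∣∪⁅⁆∣ σ v v∉σ)) (lin-mono t _ (D-antitone (SP.p⊆p∪q ⁅ v ⁆))))

  -- The overshoot of a single vertex over its threshold in Pₛ, for t = r - s.
  over : ℕ → Fin n → ℚ
  over zero u = 0ℚ
  over (suc t) u = lin t 2 (D ⁅ u ⁆)

  0≤over : ∀ t u → 0ℚ ≤ℚ over t u
  0≤over zero u = ℚP.≤-refl
  0≤over (suc t) u = 0≤lin t 2 (0≤D ⁅ u ⁆)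

  0≤τ^deg : ∀ t u → 0ℚ ≤ℚ τ ^ℚ t * κ (deg G u)
  0≤τ^deg t u = 0≤* (ℚP.<⇒≤ (^-pos 0<τ t)) (0≤κ _)

  -- The overshoot of u is at most the degree of a pair `⁅ u ⁆ ∪ ⁅ v ⁆` in Pₛ₊₁, hence `lin` at
  -- index 2. There is none at level r, which has no threshold.
  cnt-vertex : ∀ b k t s → s ℕ.+ t ≡ r → ∀ u → cnt (run b k) s ⁅ u ⁆ ≤ℚ τ ^ℚ t * κ (deg G u) + over t u
  cnt-vertex b k zero s eq u = ℚP.≤-trans
    (subst (λ s → cnt (run b k) s ⁅ u ⁆ ≤ℚ κ (deg G u)) (trans (sym eq) (ℕP.+-identityʳ s)) (cnt-codeg b k ⁅ u ⁆))
    (ℚP.≤-reflexive (sym (trans (ℚP.+-identityʳ _) (ℚP.*-identityˡ _))))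
  cnt-vertex b k (suc t) s eq u = ℚP.≤-trans
      (cnt≤θ+ b k s ⁅ u ⁆ (lin t 2 (D ⁅ u ⁆)) s<r (u , SP.x∈⁅x⁆ u) (0≤over (suc t) u) (subst (0ℚ ≤ℚ_) (sym θ≡) (0≤τ^deg (suc t) u)) bound k ℕP.≤-refl)
      (ℚP.≤-reflexive (cong (_+ over (suc t) u) θ≡))
    where
    eq′ : suc s ℕ.+ t ≡ r
    eq′ = trans (sym (ℕP.+-suc s t)) eq
    s<r : s ℕ.< r
    s<r = ℕP.≤-trans (ℕP.m≤m+n (suc s) t) (ℕP.≤-reflexive eq′)
    θ≡ : θ s ⁅ u ⁆ ≡ τ ^ℚ suc t * κ (deg G u)
    θ≡ = trans (θ-vertex s u) (cong (λ a → τ ^ℚ a * κ (deg G u)) (trans (cong (_∸ s) (sym eq)) (ℕP.m+n∸m≡n s (suc t))))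
    bound : ∀ v → v ∉ ⁅ u ⁆ → cnt (run b k) (suc s) (⁅ u ⁆ ∪ ⁅ v ⁆) ≤ℚ lin t 2 (D ⁅ u ⁆)
    bound v v∉ = ℚP.≤-trans (cnt≤lin b k t (suc s) eq′ (⁅ u ⁆ ∪ ⁅ v ⁆) (ℕP.≤-reflexive (sym ≡2)))
      (subst (λ j → lin t j (D (⁅ u ⁆ ∪ ⁅ v ⁆)) ≤ℚ lin t 2 (D ⁅ u ⁆)) (sym ≡2) (lin-mono t 2 (D-antitone (SP.p⊆p∪q ⁅ v ⁆))))
      where
      ≡2 : ∣ ⁅ u ⁆ ∪ ⁅ v ⁆ ∣ ≡ 2
      ≡2 = trans (∣∪⁅⁆∣ ⁅ u ⁆ v v∉) (cong suc (SP.∣⁅x⁆∣≡1 u))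

  opaque
    unfolding D

    D-vertex : ∀ u j → D ⁅ u ⁆ j ≡ κ (degJ G j u)
    D-vertex u j = cong (λ xs → κ (maxL xs)) (LP.map-cong (λ σ → cong (λ c → if c ∧ (∣ σ ∣ ℕ.≡ᵇ j) then codeg G σ else 0) (⁅⁆⊆ᵇ u σ)) (allSubsets n))

  -- Linearity of `lin` moves the sum over u inside, onto the numerators in the definition of δ_j.
  ∑-over : ∀ t → ∑ᵥ (over (suc t)) ≤ℚ lin t 2 (λ j → ∑ᵥ (λ u → κ (degJ G j u)))
  ∑-over t = ℚP.≤-trans (ℚP.≤-reflexive (lin-∑ (allFin n) t 2 (λ u → D ⁅ u ⁆)))
    (lin-mono t 2 (λ j → ℚP.≤-reflexive (∑-cong (allFin n) (λ u → D-vertex u j))))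


-- Comparison of the overshoots with the co-degree function.

tri : ℕ → ℕ
tri zero = 0
tri (suc m) = m ℕ.+ tri m

C2≡tri : ∀ m → m NC.C 2 ≡ tri m
C2≡tri zero = refl
C2≡tri (suc m) = trans (sym (NC.nCk+nC[k+1]≡[n+1]C[k+1] m 1)) (cong₂ ℕ._+_ (NC.nC1≡n m) (C2≡tri m))

sumTo : ℕ → (ℕ → ℚ) → ℚ
sumTo zero f = 0ℚ
sumTo (suc N) f = f 0 + sumTo N (λ i → f (suc i))

sumTo-cong : ∀ N {f g} → (∀ i → f i ≡ g i) → sumTo N f ≡ sumTo N g
sumTo-cong zero _ = refl
sumTo-cong (suc N) f≡g = cong₂ _+_ (f≡g 0) (sumTo-cong N (λ i → f≡g (suc i)))

sumTo-mono : ∀ N {f g} → (∀ i → f i ≤ℚ g i) → sumTo N f ≤ℚ sumTo N g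
sumTo-mono zero _ = ℚP.≤-refl
sumTo-mono (suc N) f≤g = ℚP.+-mono-≤ (f≤g 0) (sumTo-mono N (λ i → f≤g (suc i)))

sumTo-+ : ∀ N f g → sumTo N (λ i → f i + g i) ≡ sumTo N f + sumTo N g
sumTo-+ zero f g = refl
sumTo-+ (suc N) f g = trans (cong (λ z → f 0 + g 0 + z) (sumTo-+ N _ _))
  (solve 4 (λ a b c d → (a :+ b) :+ (c :+ d) := (a :+ c) :+ (b :+ d)) refl (f 0) (g 0) (sumTo N (λ i → f (suc i))) (sumTo N (λ i → g (suc i))))

sumTo-* : ∀ N c f → sumTo N (λ i → c * f i) ≡ c * sumTo N f
sumTo-* zero c f = sym (ℚP.*-zeroʳ c)
sumTo-* (suc N) c f = trans (cong (λ z → c * f 0 + z) (sumTo-* N c _)) (sym (ℚP.*-distribˡ-+ c (f 0) _))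

sumTo-0 : ∀ N → sumTo N (λ _ → 0ℚ) ≡ 0ℚ
sumTo-0 zero = refl
sumTo-0 (suc N) = trans (ℚP.+-identityˡ _) (sumTo-0 N)

foldr-sumTo : ∀ {A B : Set} (g : B → ℚ) (h : A → B) (f : ℕ → A) N →
  foldr _+_ 0ℚ (map g (map h (applyUpTo f N))) ≡ sumTo N (λ i → g (h (f i)))
foldr-sumTo g h f zero = refl
foldr-sumTo g h f (suc N) = cong (g (h (f 0)) +_) (foldr-sumTo g h (λ i → f (suc i)) N)

module Codegrees {r n : ℕ} (G : RGraph r n) (τ ζ β : ℚ) (0<τ : 0ℚ < τ) where
  open Algorithm G τ ζ β
  open Degrees G τ ζ β 0<τ

  -- lin with the powers of τ divided out.
  lc : ℕ → ℕ → (ℕ → ℚ) → ℚ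
  lc zero j x = x j
  lc (suc t) j x = κ (2 ℕ.^ (r ∸ suc t)) * lc t j x + lc t (suc j) x

  0≤lc : ∀ t j {x} → (∀ j → 0ℚ ≤ℚ x j) → 0ℚ ≤ℚ lc t j x
  0≤lc zero j 0≤x = 0≤x j
  0≤lc (suc t) j 0≤x = 0≤+ (0≤* (0≤κ _) (0≤lc t j 0≤x)) (0≤lc t (suc j) 0≤x)

  -- Homogeneity: a step of the recursion either multiplies by τ or raises the index, and a higher
  -- index carries one more factor τ.
  lin-lc : ∀ w (x y : ℕ → ℚ) → (∀ j → y (suc j) ≡ τ ^ℚ j * w * x (suc j)) →
    ∀ t j → lin t (suc j) y ≡ τ ^ℚ (t ℕ.+ j) * w * lc t (suc j) x
  lin-lc w x y h zero j = h j
  lin-lc w x y h (suc t) j = trans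
    (cong₂ (λ a c → κ (2 ℕ.^ (r ∸ suc t)) * τ * a + c) (lin-lc w x y h t j)
      (trans (lin-lc w x y h t (suc j)) (cong (λ m → τ ^ℚ m * w * lc t (suc (suc j)) x) (ℕP.+-suc t j))))
    (solve 6 (λ c T p w a b → (c :* T) :* ((p :* w) :* a) :+ ((T :* p) :* w) :* b := ((T :* p) :* w) :* (c :* a :+ b)) refl
      (κ (2 ℕ.^ (r ∸ suc t))) τ (τ ^ℚ (t ℕ.+ j)) w (lc t (suc j) x) (lc t (suc (suc j)) x))

  -- The coefficient of X^i in the product of the factors 2^(r-k) + X for k from 1 to t.
  coef : ℕ → ℕ → ℕ
  coef zero zero = 1
  coef zero (suc i) = 0
  coef (suc t) zero = 2 ℕ.^ (r ∸ suc t) ℕ.* coef t zero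
  coef (suc t) (suc i) = 2 ℕ.^ (r ∸ suc t) ℕ.* coef t (suc i) ℕ.+ coef t i

  lc-coef : ∀ N t j x → t ≤ N → lc t j x ≡ sumTo (suc N) (λ i → κ (coef t i) * x (i ℕ.+ j))
  lc-coef N zero j x _ = sym (trans (cong₂ _+_ (trans (cong (_* x j) κ-1) (ℚP.*-identityˡ (x j)))
      (trans (sumTo-cong N (λ i → trans (cong (_* x (suc i ℕ.+ j)) κ-0) (ℚP.*-zeroˡ (x (suc i ℕ.+ j))))) (sumTo-0 N)))
    (ℚP.+-identityʳ (x j)))
  lc-coef (suc N) (suc t) j x (s≤s t≤N) = trans
    (cong₂ (λ a c → k * a + c) (lc-coef (suc N) t j x (ℕP.m≤n⇒m≤1+n t≤N)) (lc-coef N t (suc j) x t≤N))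
    (trans (solve 4 (λ k a b c → k :* (a :+ b) :+ c := (k :* a) :+ (k :* b :+ c)) refl k (κ (coef t 0) * x j)
        (sumTo (suc N) (λ i → κ (coef t (suc i)) * x (suc i ℕ.+ j))) (sumTo (suc N) (λ i → κ (coef t i) * x (i ℕ.+ suc j))))
      (cong₂ _+_ (trans (sym (ℚP.*-assoc k (κ (coef t 0)) (x j))) (cong (_* x j) (sym (κ-* (2 ℕ.^ (r ∸ suc t)) (coef t 0)))))
        (trans (cong (_+ sumTo (suc N) (λ i → κ (coef t i) * x (i ℕ.+ suc j))) (sym (sumTo-* (suc N) k (λ i → κ (coef t (suc i)) * x (suc i ℕ.+ j)))))
          (trans (sym (sumTo-+ (suc N) (λ i → k * (κ (coef t (suc i)) * x (suc i ℕ.+ j))) (λ i → κ (coef t i) * x (i ℕ.+ suc j))))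
            (sumTo-cong (suc N) term)))))
    where
    k = κ (2 ℕ.^ (r ∸ suc t))
    term : ∀ i → k * (κ (coef t (suc i)) * x (suc i ℕ.+ j)) + κ (coef t i) * x (i ℕ.+ suc j) ≡ κ (coef (suc t) (suc i)) * x (suc i ℕ.+ j)
    term i = trans (cong (λ m → k * (κ (coef t (suc i)) * x (suc i ℕ.+ j)) + κ (coef t i) * x m) (ℕP.+-suc i j))
      (trans (solve 4 (λ k a b y → k :* (a :* y) :+ b :* y := (k :* a :+ b) :* y) refl k (κ (coef t (suc i))) (κ (coef t i)) (x (suc i ℕ.+ j)))
        (cong (_* x (suc i ℕ.+ j)) (sym (trans (κ-+ (2 ℕ.^ (r ∸ suc t) ℕ.* coef t (suc i)) (coef t i))
          (cong (_+ κ (coef t i)) (κ-* (2 ℕ.^ (r ∸ suc t)) (coef t (suc i))))))))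

  -- Strong enough to be inductive; for s = 1 it is the factor in the definition of δ.
  coef≤ : ∀ t s → s ℕ.+ suc t ≡ r → ∀ i → coef t i ℕ.* 2 ℕ.^ (i ℕ.* s ℕ.+ tri i ℕ.+ tri (suc s)) ≤ 2 ℕ.^ tri r
  coef≤ zero s eq zero = ℕP.≤-reflexive (trans (ℕP.*-identityˡ _) (cong (λ m → 2 ℕ.^ tri m) (trans (ℕP.+-comm 1 s) eq)))
  coef≤ zero s eq (suc i) = z≤n
  coef≤ (suc t) s eq i = go i
    where
    eq′ : suc s ℕ.+ suc t ≡ r
    eq′ = trans (sym (ℕP.+-suc s (suc t))) eq
    r∸ : r ∸ suc t ≡ suc s
    r∸ = trans (cong (_∸ suc t) (sym eq′)) (ℕP.m+n∸n≡m (suc s) (suc t))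
    IH = coef≤ t (suc s) eq′
    shift : ∀ c a b → 2 ℕ.^ a ℕ.* c ℕ.* 2 ℕ.^ b ≡ c ℕ.* 2 ℕ.^ (a ℕ.+ b)
    shift c a b = trans (cong (ℕ._* 2 ℕ.^ b) (ℕP.*-comm (2 ℕ.^ a) c)) (trans (ℕP.*-assoc c (2 ℕ.^ a) (2 ℕ.^ b)) (cong (c ℕ.*_) (sym (ℕP.^-distribˡ-+-* 2 a b))))
    go : ∀ i → coef (suc t) i ℕ.* 2 ℕ.^ (i ℕ.* s ℕ.+ tri i ℕ.+ tri (suc s)) ≤ 2 ℕ.^ tri r
    go zero = subst (λ a → 2 ℕ.^ a ℕ.* coef t 0 ℕ.* 2 ℕ.^ tri (suc s) ≤ 2 ℕ.^ tri r) (sym r∸)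
      (ℕP.≤-trans (ℕP.≤-reflexive (shift (coef t 0) (suc s) (tri (suc s)))) (IH 0))
    -- Each of the two summands is at most half of the bound, so after doubling they are treated
    -- separately. The first has i to spare in the exponent, the second nothing.
    go (suc i) = ℕP.*-cancelˡ-≤ 2 (subst (λ a → 2 ℕ.* ((2 ℕ.^ a ℕ.* coef t (suc i) ℕ.+ coef t i) ℕ.* 2 ℕ.^ E) ≤ 2 ℕ.* 2 ℕ.^ tri r) (sym r∸)
      (ℕP.≤-trans (ℕP.≤-reflexive (ℕR.solve 4 (λ c p d q → ℕR.con 2 ℕR.:* ((p ℕR.:* c ℕR.:+ d) ℕR.:* q) ℕR.:= ((ℕR.con 2 ℕR.:* p) ℕR.:* c) ℕR.:* q ℕR.:+ d ℕR.:* (ℕR.con 2 ℕR.:* q)) refl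
          (coef t (suc i)) (2 ℕ.^ suc s) (coef t i) (2 ℕ.^ E)))
        (ℕP.≤-trans (ℕP.+-mono-≤ first second) (ℕP.≤-reflexive (cong (2 ℕ.^ tri r ℕ.+_) (sym (ℕP.+-identityʳ _)))))))
      where
      E = suc i ℕ.* s ℕ.+ tri (suc i) ℕ.+ tri (suc s)
      first : 2 ℕ.* 2 ℕ.^ suc s ℕ.* coef t (suc i) ℕ.* 2 ℕ.^ E ≤ 2 ℕ.^ tri r
      first = ℕP.≤-trans (ℕP.≤-reflexive (shift (coef t (suc i)) (suc (suc s)) E))
        (ℕP.≤-trans (ℕP.*-monoʳ-≤ (coef t (suc i)) (ℕP.^-monoʳ-≤ 2 (ℕP.≤-trans (ℕP.m≤m+n _ i) (ℕP.≤-reflexive exps)))) (IH (suc i)))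
        where
        exps : suc (suc s) ℕ.+ E ℕ.+ i ≡ suc i ℕ.* suc s ℕ.+ tri (suc i) ℕ.+ tri (suc (suc s))
        exps = ℕR.solve 4 (λ i s a b → (ℕR.con 2 ℕR.:+ s ℕR.:+ ((ℕR.con 1 ℕR.:+ i) ℕR.:* s ℕR.:+ a ℕR.:+ b)) ℕR.:+ i
          ℕR.:= (ℕR.con 1 ℕR.:+ i) ℕR.:* (ℕR.con 1 ℕR.:+ s) ℕR.:+ a ℕR.:+ ((ℕR.con 1 ℕR.:+ s) ℕR.:+ b)) refl i s (tri (suc i)) (tri (suc s))
      second : coef t i ℕ.* (2 ℕ.* 2 ℕ.^ E) ≤ 2 ℕ.^ tri r
      second = ℕP.≤-trans (ℕP.≤-reflexive (cong (λ m → coef t i ℕ.* 2 ℕ.^ m) exps)) (IH i)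
        where
        exps : suc E ≡ i ℕ.* suc s ℕ.+ tri i ℕ.+ tri (suc (suc s))
        exps = ℕR.solve 4 (λ i s a b → ℕR.con 1 ℕR.:+ ((ℕR.con 1 ℕR.:+ i) ℕR.:* s ℕR.:+ (i ℕR.:+ a) ℕR.:+ b)
          ℕR.:= i ℕR.:* (ℕR.con 1 ℕR.:+ s) ℕR.:+ a ℕR.:+ ((ℕR.con 1 ℕR.:+ s) ℕR.:+ b)) refl i s (tri i) (tri (suc s))

  1≤2^ : ∀ m → 1 ≤ 2 ℕ.^ m
  1≤2^ m = ℕP.^-monoʳ-≤ 2 (z≤n {m})

  lc-mono : ∀ t j {x} → (∀ j → 0ℚ ≤ℚ x j) → lc t j x ≤ℚ lc (suc t) j x
  lc-mono t j {x} 0≤x = ℚP.≤-trans (ℚP.≤-trans (ℚP.≤-reflexive (sym (trans (cong (_* lc t j x) κ-1) (ℚP.*-identityˡ _))))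
    (*-monoʳ (0≤lc t j 0≤x) (κ-mono (1≤2^ (r ∸ suc t))))) (≤-+ʳ (0≤lc t (suc j) 0≤x))

  -- The outermost factor is at least 2. Hence the overshoots at the levels s ≥ 2 cost only ζ/2,
  -- which leads to the coefficient 3 of ζW.
  lc-double : ∀ t j {x} → (∀ j → 0ℚ ≤ℚ x j) → suc t ℕ.< r → κ 2 * lc t j x ≤ℚ lc (suc t) j x
  lc-double t j {x} 0≤x 1+t<r = ℚP.≤-trans (*-monoʳ (0≤lc t j 0≤x) (κ-mono (ℕP.^-monoʳ-≤ 2 (ℕP.m<n⇒0<n∸m 1+t<r)))) (≤-+ʳ (0≤lc t (suc j) 0≤x))

  module Bound (2≤r : 2 ≤ r) (0<d : 0ℚ < avgDeg G) (1≤n : 1 ≤ n) (δ≤ζ : δ G τ ≤ℚ ζ) where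

    0<nd : 0ℚ < ℕ→ℚ n * avgDeg G
    0<nd = 0<* (subst (0ℚ <_) (sym (κ-ℕ→ℚ n)) (0<κ 1≤n)) 0<d

    W : ℚ
    W = ℕ→ℚ n * avgDeg G

    X : ℕ → ℚ
    X j = ∑ᵥ (λ u → κ (degJ G j u))

    0<τW : ∀ j → 0ℚ < τ ^ℚ j * ℕ→ℚ n * avgDeg G
    0<τW j = subst (0ℚ <_) (sym (ℚP.*-assoc (τ ^ℚ j) (ℕ→ℚ n) (avgDeg G))) (0<* (^-pos 0<τ j) 0<nd)

    Δ : ℕ → ℚ
    Δ = δj G τ

    0≤Δ : ∀ j → 0ℚ ≤ℚ Δ j
    0≤Δ j = 0≤÷' (subst (0ℚ ≤ℚ_) (sym (κ-ℕ→ℚ (sumL (map (degJ G j) (allFin n))))) (0≤κ _)) (ℚP.<⇒≤ (0<τW (j ∸ 1)))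

    X-Δ : ∀ j → X (suc j) ≡ τ ^ℚ j * W * Δ (suc j)
    X-Δ j = trans (sym (sumL-∑ (degJ G (suc j)) (allFin n))) (trans (sym (κ-ℕ→ℚ _)) (trans (sym (÷'-* _ (0<τW j)))
      (solve 4 (λ a b c d → d :* ((a :* b) :* c) := (a :* (b :* c)) :* d) refl (τ ^ℚ j) (ℕ→ℚ n) (avgDeg G) (Δ (suc j)))))

    -- Depth r - 2 is the overshoot at level 1. For s = 1 and j = i + 2 the exponent in `coef≤` is
    -- C(j-1,2) + 1, and the extra 1 becomes the -1 in C(r,2) - 1.
    lc-δ : ∀ t → suc (suc t) ≡ r → lc t 2 Δ ≤ℚ δ G τ
    lc-δ t eq = ℚP.≤-trans (ℚP.≤-reflexive (lc-coef t t 2 Δ ℕP.≤-refl))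
      (ℚP.≤-trans (sumTo-mono (suc t) term) (ℚP.≤-reflexive (trans (sumTo-* (suc t) P Q)
        (cong (P *_) (trans (cong (λ m → sumTo m Q) (cong (_∸ 1) eq))
          (sym (foldr-sumTo (λ j → δj G τ j ÷' ℕ→ℚ (2 ℕ.^ ((j ∸ 1) NC.C 2))) (ℕ._+ 2) (λ i → i) (r ∸ 1))))))))
      where
      P = ℕ→ℚ (2 ℕ.^ ((r NC.C 2) ∸ 1))
      Q = λ i → Δ (i ℕ.+ 2) ÷' ℕ→ℚ (2 ℕ.^ ((i ℕ.+ 2 ∸ 1) NC.C 2))
      1≤tri : 1 ≤ tri r
      1≤tri = subst (λ m → 1 ≤ tri m) eq (ℕP.≤-trans (s≤s z≤n) (ℕP.m≤m+n (suc t) (tri (suc t))))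
      coefs : ∀ i → coef t i ℕ.* 2 ℕ.^ ((i ℕ.+ 2 ∸ 1) NC.C 2) ≤ 2 ℕ.^ ((r NC.C 2) ∸ 1)
      coefs i = ℕP.*-cancelˡ-≤ 2 (ℕP.≤-trans (ℕP.≤-reflexive lhs) (ℕP.≤-trans (coef≤ t 1 eq i) (ℕP.≤-reflexive rhs)))
        where
        index : (i ℕ.+ 2 ∸ 1) NC.C 2 ≡ i ℕ.+ tri i
        index = trans (cong (λ m → (m ∸ 1) NC.C 2) (ℕP.+-comm i 2)) (C2≡tri (suc i))
        lhs : 2 ℕ.* (coef t i ℕ.* 2 ℕ.^ ((i ℕ.+ 2 ∸ 1) NC.C 2)) ≡ coef t i ℕ.* 2 ℕ.^ (i ℕ.* 1 ℕ.+ tri i ℕ.+ 1)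
        lhs = trans (cong (λ m → 2 ℕ.* (coef t i ℕ.* 2 ℕ.^ m)) index)
          (trans (ℕR.solve 2 (λ c p → ℕR.con 2 ℕR.:* (c ℕR.:* p) ℕR.:= c ℕR.:* (ℕR.con 2 ℕR.:* p)) refl (coef t i) (2 ℕ.^ (i ℕ.+ tri i)))
            (cong (λ m → coef t i ℕ.* 2 ℕ.^ m) (ℕR.solve 2 (λ i a → ℕR.con 1 ℕR.:+ (i ℕR.:+ a) ℕR.:= i ℕR.:* ℕR.con 1 ℕR.:+ a ℕR.:+ ℕR.con 1) refl i (tri i))))
        rhs : 2 ℕ.^ tri r ≡ 2 ℕ.* 2 ℕ.^ ((r NC.C 2) ∸ 1)
        rhs = cong (2 ℕ.^_) (sym (trans (cong (λ m → suc (m ∸ 1)) (C2≡tri r)) (ℕP.m+[n∸m]≡n 1≤tri)))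
      term : ∀ i → κ (coef t i) * Δ (i ℕ.+ 2) ≤ℚ P * Q i
      term i = ℚP.≤-trans (ℚP.≤-reflexive (cong (κ (coef t i) *_) (sym (÷'-* (Δ (i ℕ.+ 2)) 0<p))))
        (ℚP.≤-trans (ℚP.≤-reflexive (solve 3 (λ c q p → c :* (q :* p) := (c :* p) :* q) refl (κ (coef t i)) (Q i) p))
          (*-monoʳ (0≤÷' (0≤Δ (i ℕ.+ 2)) (ℚP.<⇒≤ 0<p))
            (ℚP.≤-trans (ℚP.≤-reflexive (trans (cong (κ (coef t i) *_) (κ-ℕ→ℚ _)) (sym (κ-* (coef t i) _))))
              (ℚP.≤-trans (κ-mono (coefs i)) (ℚP.≤-reflexive (sym (κ-ℕ→ℚ _)))))))
        where
        p = ℕ→ℚ (2 ℕ.^ ((i ℕ.+ 2 ∸ 1) NC.C 2))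
        0<p : 0ℚ < p
        0<p = subst (0ℚ <_) (sym (κ-ℕ→ℚ _)) (0<κ (1≤2^ ((i ℕ.+ 2 ∸ 1) NC.C 2)))

    -- `lc` grows with the depth, so all levels inherit the bound for the deepest; d is the number
    -- of missing steps.
    lc≤ζ : ∀ d t → d ℕ.+ suc (suc t) ≡ r → lc t 2 Δ ≤ℚ ζ
    lc≤ζ zero t eq = ℚP.≤-trans (lc-δ t eq) δ≤ζ
    lc≤ζ (suc d) t eq = ℚP.≤-trans (lc-mono t 2 0≤Δ) (lc≤ζ d (suc t) (trans (ℕP.+-suc d _) eq))

    ∑over-lc : ∀ t → ∑ᵥ (over (suc t)) ≤ℚ τ ^ℚ (suc t) * W * lc t 2 Δ
    ∑over-lc t = ℚP.≤-trans (∑-over t) (ℚP.≤-reflexive (trans (lin-lc W Δ X X-Δ t 1)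
      (cong (λ m → τ ^ℚ m * W * lc t 2 Δ) (ℕP.+-comm t 1))))

    0<τ^W : ∀ t → 0ℚ < τ ^ℚ t * W
    0<τ^W t = 0<* (^-pos 0<τ t) 0<nd

    ∑over≤ζ : 0ℚ ≤ℚ ζ → ∀ s t → suc s ℕ.+ t ≡ r → ∑ᵥ (over t) ≤ℚ τ ^ℚ t * W * ζ
    ∑over≤ζ 0≤ζ s zero eq = ℚP.≤-trans (ℚP.≤-reflexive (∑-0 (allFin n))) (0≤* (ℚP.<⇒≤ (0<τ^W 0)) 0≤ζ)
    ∑over≤ζ 0≤ζ s (suc t) eq = ℚP.≤-trans (∑over-lc t) (*-monoˡ (ℚP.<⇒≤ (0<τ^W (suc t)))
      (lc≤ζ s t (trans (ℕP.+-suc s (suc t)) eq)))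

    2∑over≤ζ : 0ℚ ≤ℚ ζ → ∀ s t → suc (suc s) ℕ.+ t ≡ r → κ 2 * ∑ᵥ (over t) ≤ℚ τ ^ℚ t * W * ζ
    2∑over≤ζ 0≤ζ s zero eq = ℚP.≤-trans (ℚP.≤-reflexive (trans (cong (κ 2 *_) (∑-0 (allFin n))) (ℚP.*-zeroʳ (κ 2)))) (0≤* (ℚP.<⇒≤ (0<τ^W 0)) 0≤ζ)
    2∑over≤ζ 0≤ζ s (suc t) eq = ℚP.≤-trans (*-monoˡ (0≤κ 2) (∑over-lc t))
      (ℚP.≤-trans (ℚP.≤-reflexive (solve 3 (λ a b c → a :* (b :* c) := b :* (a :* c)) refl (κ 2) (τ ^ℚ (suc t) * W) (lc t 2 Δ)))
        (*-monoˡ (ℚP.<⇒≤ (0<τ^W (suc t))) (ℚP.≤-trans (lc-double t 2 0≤Δ 1+t<r) (lc≤ζ s (suc t) eq′))))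
      where
      eq′ : s ℕ.+ suc (suc (suc t)) ≡ r
      eq′ = trans (trans (ℕP.+-suc s _) (cong suc (ℕP.+-suc s _))) eq
      1+t<r : suc t ℕ.< r
      1+t<r = ℕP.≤-trans (ℕP.n≤1+n (suc (suc t))) (ℕP.≤-trans (ℕP.m≤n+m (suc (suc (suc t))) s) (ℕP.≤-reflexive eq′))

-- Degree sums, and edges of degenerate hypergraphs.

∑ᵥ-const : ∀ m c → ∑ᵥ {m} (λ _ → c) ≡ κ m * c
∑ᵥ-const zero c = sym (trans (cong (_* c) κ-0) (ℚP.*-zeroˡ c))
∑ᵥ-const (suc m) c = trans (∑ᵥ-suc {m} (λ _ → c)) (trans (cong (c +_) (∑ᵥ-const m c))
  (trans (solve 2 (λ c m → c :+ m :* c := (con 1ℚ :+ m) :* c) refl c (κ m)) (cong (_* c) (sym (trans (κ-+ 1 m) (cong (_+ κ m) κ-1))))))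

∑ᵥ-unique : ∀ (f : Fin n → Bool) {b} → (∀ v → f v ≡ true → b ≡ true) → (∀ u v → f u ≡ true → f v ≡ true → u ≡ v) →
  ∑ᵥ (λ v → ι (f v)) ≤ℚ ι b
∑ᵥ-unique {n} f {b} f⇒b unique = go (FP.any? (λ v → f v 𝔹P.≟ true))
  where
  go : Dec (∃ λ v → f v ≡ true) → ∑ᵥ (λ v → ι (f v)) ≤ℚ ι b
  go (no ¬f) = ℚP.≤-trans (∑≤0 (allFin n) (λ v → ι≤0 (λ h → ¬f (v , h)))) (0≤ι b)
  go (yes (v , fv)) = ℚP.≤-trans (∑-mono (allFin n) (λ u → ι-mono {f u} {u ∈ᵇ ⁅ v ⁆}
      (λ fu → true-dec (u ∈? ⁅ v ⁆) (subst (_∈ ⁅ v ⁆) (unique v u fv fu) (SP.x∈⁅x⁆ v)))))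
    (ℚP.≤-reflexive (trans (∑-card ⁅ v ⁆) (trans (cong κ (SP.∣⁅x⁆∣≡1 v)) (trans κ-1 (cong ι (sym (f⇒b v fv)))))))

singleton-unique : ∀ {p : Subset n} {u v} → ∣ p ∣ ≡ 1 → u ∈ p → v ∈ p → u ≡ v
singleton-unique {p = p} {u} {v} ∣p∣≡1 u∈p v∈p with u FP.≟ v
... | yes u≡v = u≡v
... | no u≢v = ⊥-elim (ℕP.<-irrefl (trans (SP.∣⁅x⁆∣≡1 u) (sym ∣p∣≡1))
  (SP.p⊂q⇒∣p∣<∣q∣ (⁅⁆⊆ u∈p , v , v∈p , λ v∈ → u≢v (sym (SP.x∈⁅y⁆⇒x≡y u v∈)))))

wt : ∀ {r} → RGraph r n → Subset n → ℚ
wt G S = ∑ᵥ (λ v → ι (v ∈ᵇ S) * κ (deg G v))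

module _ {r n : ℕ} (G : RGraph r n) where

  handshake : ∑ᵥ (λ v → κ (deg G v)) ≡ κ r * κ (e G)
  handshake = trans (∑-cong (allFin n) (λ v → count-∑ _ (allSubsets n)))
    (trans (∑-swap (allFin n) (allSubsets n) (λ v g → ι (edge G g ∧ ⁅ v ⁆ ⊆ᵇ g)))
      (trans (∑-cong (allSubsets n) term) (trans (∑-*ˡ (allSubsets n) (κ r) (λ g → ι (edge G g))) (cong (κ r *_) (sym (count-∑ (edge G) (allSubsets n)))))))
    where
    times : ∀ g b → edge G g ≡ b → ι b * κ ∣ g ∣ ≡ κ r * ι b
    times g true eg = trans (cong (λ m → 1ℚ * κ m) (uniform G g eg)) (ℚP.*-comm 1ℚ (κ r))
    times g false _ = trans (ℚP.*-zeroˡ (κ ∣ g ∣)) (sym (ℚP.*-zeroʳ (κ r)))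
    term : ∀ g → ∑ᵥ (λ v → ι (edge G g ∧ ⁅ v ⁆ ⊆ᵇ g)) ≡ κ r * ι (edge G g)
    term g = trans (∑-cong (allFin n) (λ v → trans (cong (λ c → ι (edge G g ∧ c)) (⁅⁆⊆ᵇ v g)) (ι-∧ (edge G g) (v ∈ᵇ g))))
      (trans (∑-*ˡ (allFin n) (ι (edge G g)) (λ v → ι (v ∈ᵇ g))) (trans (cong (ι (edge G g) *_) (∑-card g)) (times g (edge G g) refl)))

  eInduced-mono : ∀ {A B} → A ⊆ B → κ (eInduced G A) ≤ℚ κ (eInduced G B)
  eInduced-mono {A} {B} A⊆B = ℚP.≤-trans (ℚP.≤-reflexive (count-∑ _ (allSubsets n)))
    (ℚP.≤-trans (∑-mono (allSubsets n) (λ f → ι-mono {edge G f ∧ f ⊆ᵇ A} {edge G f ∧ f ⊆ᵇ B} (λ h → true-∧ (proj₁ (∧-true {edge G f} h))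
        (true-dec (f ⊆? B) (SP.⊆-trans (dec-true (f ⊆? A) (proj₂ (∧-true {edge G f} h))) A⊆B)))))
      (ℚP.≤-reflexive (sym (count-∑ _ (allSubsets n)))))

  -- Vertices are peeled off one by one, each at a loss of at most b edges. The empty set spans no
  -- edge because edges have r ≥ 1 vertices.
  degenerate-edges : 1 ≤ r → ∀ {I b} → InducedDegenerate G I b → ∀ {V} → V ⊆ I → κ (eInduced G V) ≤ℚ (b ℚ./ 1) * κ ∣ V ∣
  degenerate-edges 1≤r {I} {b} dg {V} V⊆I = go ∣ V ∣ V V⊆I ℕP.≤-refl
    where
    go : ∀ m V → V ⊆ I → ∣ V ∣ ≤ m → κ (eInduced G V) ≤ℚ (b ℚ./ 1) * κ ∣ V ∣
    peel : ∀ m V → V ⊆ I → ∣ V ∣ ≤ m → Dec (Nonempty V) → κ (eInduced G V) ≤ℚ (b ℚ./ 1) * κ ∣ V ∣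
    go m V V⊆I ≤m = peel m V V⊆I ≤m (nonempty? V)
    peel m V V⊆I ≤m (no empty) = ℚP.≤-trans (ℚP.≤-reflexive (count-∑ _ (allSubsets n)))
      (ℚP.≤-trans (∑≤0 (allSubsets n) (λ f → ι≤0 (λ h → none f (∧-true h))))
        (ℚP.≤-reflexive (sym (trans (cong ((b ℚ./ 1) *_) (trans (cong κ ∣V∣≡0) κ-0)) (ℚP.*-zeroʳ (b ℚ./ 1))))))
      where
      ∣V∣≡0 : ∣ V ∣ ≡ 0
      ∣V∣≡0 = trans (cong ∣_∣ (SP.Empty-unique empty)) (SP.∣⊥∣≡0 n)
      none : ∀ f → ¬ (edge G f ≡ true × f ⊆ᵇ V ≡ true)
      none f (ef , sub) = ℕP.<⇒≱ 1≤r (subst₂ _≤_ (uniform G f ef) ∣V∣≡0 (SP.p⊆q⇒∣p∣≤∣q∣ (dec-true (f ⊆? V) sub)))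
    peel zero V V⊆I ≤0 (yes (v , v∈V)) = ⊥-elim (ℕP.<⇒≱ (ℕP.≤-trans (s≤s z≤n) (SP.x∈p⇒∣p-x∣<∣p∣ v∈V)) ≤0)
    peel (suc m) V V⊆I ≤m (yes ne) with dg V (λ f → edge G f ∧ f ⊆ᵇ V) V⊆I ne
        (λ f h → proj₁ (∧-true h) , λ {x} → dec-true (f ⊆? V) (proj₂ (∧-true {edge G f} h)) {x})
    ... | v , v∈V , deg≤b = ℚP.≤-trans (ℚP.≤-reflexive (count-∑ _ (allSubsets n)))
        (ℚP.≤-trans (∑-mono (allSubsets n) (λ f → ι-∨ {edge G f ∧ f ⊆ᵇ V} (split f)))
          (ℚP.≤-trans (ℚP.≤-reflexive (∑-+ (allSubsets n) (λ f → ι (edge G f ∧ f ⊆ᵇ V′)) (λ f → ι ((edge G f ∧ f ⊆ᵇ V) ∧ v ∈ᵇ f))))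
            (ℚP.≤-trans (ℚP.+-mono-≤
                (ℚP.≤-trans (ℚP.≤-reflexive (sym (count-∑ _ (allSubsets n)))) (go m V′ (SP.⊆-trans V′⊆V V⊆I) (ℕP.≤-pred (ℕP.≤-trans ∣V′∣<∣V∣ ≤m))))
                (ℚP.≤-trans (ℚP.≤-reflexive (trans (sym (count-∑ _ (allSubsets n))) (sym (κ-ℕ→ℚ _)))) deg≤b′))
              (ℚP.≤-trans (ℚP.≤-reflexive (trans (solve 2 (λ b m → b :* m :+ b := b :* (con 1ℚ :+ m)) refl (b ℚ./ 1) (κ ∣ V′ ∣))
                  (cong ((b ℚ./ 1) *_) (sym (trans (κ-+ 1 ∣ V′ ∣) (cong (_+ κ ∣ V′ ∣) κ-1))))))
                (*-monoˡ 0≤b (κ-mono ∣V′∣<∣V∣))))))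
      where
      V′ = V ∖ v
      V′⊆V : V′ ⊆ V
      V′⊆V = SP.p─q⊆p V ⁅ v ⁆
      ∣V′∣<∣V∣ = SP.x∈p⇒∣p-x∣<∣p∣ v∈V
      c = count (λ f → (edge G f ∧ f ⊆ᵇ V) ∧ v ∈ᵇ f) (allSubsets n)
      deg≤b′ : ℕ→ℚ c ≤ℚ (b ℚ./ 1)
      deg≤b′ = ℤ/1-mono deg≤b
      -- The integer b is nonnegative once there is a vertex, as it bounds a degree.
      0≤b : 0ℚ ≤ℚ (b ℚ./ 1)
      0≤b = ℚP.≤-trans (subst (0ℚ ≤ℚ_) (sym (κ-ℕ→ℚ c)) (0≤κ c)) deg≤b′
      split : ∀ f → edge G f ∧ f ⊆ᵇ V ≡ true → edge G f ∧ f ⊆ᵇ V′ ≡ true ⊎ (edge G f ∧ f ⊆ᵇ V) ∧ v ∈ᵇ f ≡ true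
      split f h = case (v ∈? f)
        where
        case : Dec (v ∈ f) → edge G f ∧ f ⊆ᵇ V′ ≡ true ⊎ (edge G f ∧ f ⊆ᵇ V) ∧ v ∈ᵇ f ≡ true
        case (yes v∈f) = inj₂ (true-∧ h (true-dec (v ∈? f) v∈f))
        case (no v∉f) = inj₁ (true-∧ (proj₁ (∧-true h)) (true-dec (f ⊆? V′) (λ {x} x∈f →
          SP.x∈p∧x≢y⇒x∈p-y (dec-true (f ⊆? V) (proj₂ (∧-true {edge G f} h)) x∈f) (λ x≡v → v∉f (subst (_∈ f) x≡v x∈f)))))

-- The weight and the size of the fingerprint.

module Weights {r n : ℕ} (G : RGraph r n) (τ ζ β W : ℚ) (0<τ : 0ℚ < τ) (0<ζ : 0ℚ < ζ) (ζ≤1 : ζ ≤ℚ 1ℚ) (2≤r : 2 ≤ r)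
    (0<W : 0ℚ < W) (W≡∑ : W ≡ ∑ᵥ (λ v → κ (deg G v)))
    (∑over≤ζ : ∀ s t → suc s ℕ.+ t ≡ r → ∑ᵥ (Degrees.over G τ ζ β 0<τ t) ≤ℚ τ ^ℚ t * W * ζ)
    (2∑over≤ζ : ∀ s t → suc (suc s) ℕ.+ t ≡ r → κ 2 * ∑ᵥ (Degrees.over G τ ζ β 0<τ t) ≤ℚ τ ^ℚ t * W * ζ) where

  open Algorithm G τ ζ β public
  open Degrees G τ ζ β 0<τ public

  w : Fin n → ℚ
  w v = κ (deg G v)

  0≤w : ∀ v → 0ℚ ≤ℚ w v
  0≤w v = 0≤κ _

  0≤ζ : 0ℚ ≤ℚ ζ
  0≤ζ = ℚP.<⇒≤ 0<ζ

  0≤W : 0ℚ ≤ℚ W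
  0≤W = ℚP.<⇒≤ 0<W

  W≡re : W ≡ κ r * κ (e G)
  W≡re = trans W≡∑ (handshake G)

  0≤τ^ : ∀ t → 0ℚ ≤ℚ τ ^ℚ t
  0≤τ^ t = ℚP.<⇒≤ (^-pos 0<τ t)

  ∑cnt≤ : ∀ b k s t → s ℕ.+ t ≡ r → ∑ᵥ (λ u → cnt (run b k) s ⁅ u ⁆) ≤ℚ τ ^ℚ t * W + ∑ᵥ (over t)
  ∑cnt≤ b k s t eq = ℚP.≤-trans (∑-mono (allFin n) (cnt-vertex b k t s eq))
    (ℚP.≤-reflexive (trans (∑-+ (allFin n) (λ u → τ ^ℚ t * w u) (over t))
      (cong (_+ ∑ᵥ (over t)) (trans (∑-*ˡ (allFin n) (τ ^ℚ t) w) (cong (τ ^ℚ t *_) (sym W≡∑))))))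

  module Run (A : Subset n) where

    R : ℕ → State
    R = run (at A)

    size≤∑cnt : ∀ s → ∑ₛ (λ g → ι (R n (suc s) g)) ≤ℚ ∑ᵥ (λ u → cnt (R n) (suc s) ⁅ u ⁆)
    size≤∑cnt s = ℚP.≤-trans (∑-mono (allSubsets n) vertex)
      (ℚP.≤-reflexive (∑-swap (allSubsets n) (allFin n) (λ g u → ι (R n (suc s) g ∧ ⁅ u ⁆ ⊆ᵇ tail (suc s) g))))
      where
      vertex : ∀ g → ι (R n (suc s) g) ≤ℚ ∑ᵥ (λ u → ι (R n (suc s) g ∧ ⁅ u ⁆ ⊆ᵇ tail (suc s) g))
      vertex g = ι-≤ (0≤∑ (allFin n) (λ u → 0≤ι (R n (suc s) g ∧ ⁅ u ⁆ ⊆ᵇ tail (suc s) g))) λ h →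
        let u , _ , u∈ = pos-vertex s g (ℕP.≤-trans (proj₂ (run-edge (at A) n (suc s) h)) (ℕP.≤-reflexive (sym (run-card (at A) n (suc s) h))))
        in ℚP.≤-trans (ℚP.≤-reflexive (cong ι (sym (true-∧ h (true-dec (⁅ u ⁆ ⊆? tail (suc s) g) (⁅⁆⊆ u∈))))))
             (≤∑ᵥ {f = λ u → ι (R n (suc s) g ∧ ⁅ u ⁆ ⊆ᵇ tail (suc s) g)} (λ u → 0≤ι (R n (suc s) g ∧ ⁅ u ⁆ ⊆ᵇ tail (suc s) g)) u)

    -- The 2 is a bound for 1 + ζ: the overshoots add at most the fraction ζ of the main term.
    size≤ : ∀ s t → suc s ℕ.+ t ≡ r → ∑ₛ (λ g → ι (R n (suc s) g)) ≤ℚ κ 2 * (τ ^ℚ t * W)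
    size≤ s t eq = ℚP.≤-trans (size≤∑cnt s) (ℚP.≤-trans (∑cnt≤ (at A) n (suc s) t eq)
      (ℚP.≤-trans (ℚP.+-monoʳ-≤ (τ ^ℚ t * W) (ℚP.≤-trans (∑over≤ζ s t eq) (*-monoˡ (0≤* (0≤τ^ t) 0≤W) ζ≤1)))
        (ℚP.≤-reflexive (trans (solve 1 (λ x → x :+ x :* con 1ℚ := (con 1ℚ :+ con 1ℚ) :* x) refl (τ ^ℚ t * W)) (cong (_* (τ ^ℚ t * W)) (sym κ2))))))
      where
      κ2 : κ 2 ≡ 1ℚ + 1ℚ
      κ2 = trans (κ-+ 1 1) (cong₂ _+_ κ-1 κ-1)

    -- When v in A is read, the whole of Fᵥₛ enters Pₛ, and `pos s g` recovers v from g, so no edge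
    -- is counted twice.
    ∑fsize≤size : ∀ s → s ℕ.< r → ∑ᵥ (λ v → ι (v ∈ᵇ A) * fsize (R (toℕ v)) s (toℕ v)) ≤ℚ ∑ₛ (λ g → ι (R n s g))
    ∑fsize≤size s s<r = ℚP.≤-trans (ℚP.≤-reflexive
        (trans (∑-cong (allFin n) (λ v → trans (sym (∑-*ˡ (allSubsets n) (ι (v ∈ᵇ A)) (λ g → ι (free (R (toℕ v)) s (toℕ v) g))))
            (∑-cong (allSubsets n) (λ g → sym (ι-∧ (v ∈ᵇ A) (free (R (toℕ v)) s (toℕ v) g))))))
          (∑-swap (allFin n) (allSubsets n) (λ v g → ι (v ∈ᵇ A ∧ free (R (toℕ v)) s (toℕ v) g)))))
      (∑-mono (allSubsets n) (λ g → ∑ᵥ-unique (λ v → v ∈ᵇ A ∧ free (R (toℕ v)) s (toℕ v) g) (accept g) (unique g)))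
      where
      accept : ∀ g v → v ∈ᵇ A ∧ free (R (toℕ v)) s (toℕ v) g ≡ true → R n s g ≡ true
      accept g v h with ∧-true {v ∈ᵇ A} h
      ... | v∈A , fr = run-mono (at A) s (FP.toℕ<n v) (true-∨ʳ {R (toℕ v) s g} (true-∧ (at-∈ (dec-true (v ∈? A) v∈A)) fr))
      unique : ∀ g u v → u ∈ᵇ A ∧ free (R (toℕ u)) s (toℕ u) g ≡ true → v ∈ᵇ A ∧ free (R (toℕ v)) s (toℕ v) g ≡ true → u ≡ v
      unique g u v hu hv = FP.toℕ-injective (trans (sym (at-pos u hu)) (at-pos v hv))
        where
        at-pos : ∀ u → u ∈ᵇ A ∧ free (R (toℕ u)) s (toℕ u) g ≡ true → pos s g ≡ toℕ u
        at-pos u h = dec-true (pos s g ℕ.≟ toℕ u) (proj₁ (∧-true (proj₂ (∧-true {u ∈ᵇ A} h))))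

    large? : ∀ s v → Dec (ζ * τ ^ℚ (r ∸ suc (suc s)) * w v ≤ℚ fsize (R (toℕ v)) (suc s) (toℕ v))
    large? s v = _ ℚP.≤? _

    heavy? : ∀ v → Dec (θ 1 ⁅ v ⁆ ≤ℚ cnt (R (toℕ v)) 1 ⁅ v ⁆)
    heavy? v = _ ℚP.≤? _

    opaque
      largeSum : ℕ → ℚ
      largeSum s = ∑ᵥ (λ v → ι (v ∈ᵇ A ∧ does (large? s v)) * w v)

      heavySum : ℚ
      heavySum = ∑ᵥ (λ v → ι (v ∈ᵇ A ∧ does (heavy? v)) * w v)

      ι-dec-*-mono : ∀ {a} {X : Set} (d : Dec X) {x y} → 0ℚ ≤ℚ y → (X → x ≤ℚ y) → ι (a ∧ does d) * x ≤ℚ ι a * y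
      ι-dec-*-mono {false} d {x} {y} _ _ = ℚP.≤-reflexive (trans (ℚP.*-zeroˡ x) (sym (ℚP.*-zeroˡ y)))
      ι-dec-*-mono {true} (yes p) _ h = *-monoˡ 0≤1 (h p)
      ι-dec-*-mono {true} (no _) {x} 0≤y _ = ℚP.≤-trans (ℚP.≤-reflexive (ℚP.*-zeroˡ x)) (0≤* 0≤1 0≤y)

      largeSum≤ : ∀ s → suc s ℕ.< r → ζ * largeSum s ≤ℚ κ 2 * (τ * W)
      largeSum≤ s 1+s<r = *-cancelˡ (^-pos 0<τ t) (ℚP.≤-trans (ℚP.≤-reflexive regroup)
        (ℚP.≤-trans (∑-mono (allFin n) (λ v → ι-dec-*-mono {v ∈ᵇ A} (large? s v) (0≤∑ (allSubsets n) (λ g → 0≤ι (free (R (toℕ v)) (suc s) (toℕ v) g))) (λ h → h)))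
          (ℚP.≤-trans (∑fsize≤size (suc s) 1+s<r) (ℚP.≤-trans (size≤ s (suc t) eq)
            (ℚP.≤-reflexive (solve 4 (λ a T p W → a :* ((T :* p) :* W) := p :* (a :* (T :* W))) refl (κ 2) τ (τ ^ℚ t) W))))))
        where
        t : ℕ
        t = r ∸ suc (suc s)
        eq : suc s ℕ.+ suc t ≡ r
        eq = trans (ℕP.+-suc (suc s) t) (ℕP.m+[n∸m]≡n 1+s<r)
        regroup : τ ^ℚ t * (ζ * ∑ᵥ (λ v → ι (v ∈ᵇ A ∧ does (large? s v)) * w v)) ≡ ∑ᵥ (λ v → ι (v ∈ᵇ A ∧ does (large? s v)) * (ζ * τ ^ℚ t * w v))
        regroup = trans (sym (ℚP.*-assoc (τ ^ℚ t) ζ _)) (trans (sym (∑-*ˡ (allFin n) (τ ^ℚ t * ζ) (λ v → ι (v ∈ᵇ A ∧ does (large? s v)) * w v)))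
          (∑-cong (allFin n) (λ v → solve 4 (λ p z i w → (p :* z) :* (i :* w) := i :* ((z :* p) :* w)) refl (τ ^ℚ t) ζ (ι (v ∈ᵇ A ∧ does (large? s v))) (w v))))

      -- A member {v} of P₁ comes from an edge whose other vertices were accepted, so for v in A the
      -- edge lies in G[A]. As v is the last vertex of the edge, different v give different edges.
      heavySum≤ : τ ^ℚ (r ∸ 1) * heavySum ≤ℚ κ (eInduced G A)
      heavySum≤ = ℚP.≤-trans (ℚP.≤-reflexive regroup)
        (ℚP.≤-trans (∑-mono (allFin n) (λ v → ι-dec-*-mono {v ∈ᵇ A} (heavy? v) (0≤cnt (R (toℕ v)) 1 ⁅ v ⁆) (subst (_≤ℚ cnt (R (toℕ v)) 1 ⁅ v ⁆) (θ-vertex 1 v))))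
          (ℚP.≤-trans (ℚP.≤-reflexive (trans (∑-cong (allFin n) (λ v → trans
                (sym (∑-*ˡ (allSubsets n) (ι (v ∈ᵇ A)) (λ g → ι (R (toℕ v) 1 g ∧ ⁅ v ⁆ ⊆ᵇ tail 1 g))))
                (∑-cong (allSubsets n) (λ g → sym (ι-∧ (v ∈ᵇ A) (R (toℕ v) 1 g ∧ ⁅ v ⁆ ⊆ᵇ tail 1 g))))))
              (∑-swap (allFin n) (allSubsets n) (λ v g → ι (v ∈ᵇ A ∧ (R (toℕ v) 1 g ∧ ⁅ v ⁆ ⊆ᵇ tail 1 g))))))
            (ℚP.≤-trans (∑-mono (allSubsets n) (λ g → ∑ᵥ-unique (λ v → v ∈ᵇ A ∧ (R (toℕ v) 1 g ∧ ⁅ v ⁆ ⊆ᵇ tail 1 g)) (inside-A g) (unique g)))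
              (ℚP.≤-reflexive (sym (count-∑ _ (allSubsets n)))))))
        where
        regroup : τ ^ℚ (r ∸ 1) * ∑ᵥ (λ v → ι (v ∈ᵇ A ∧ does (heavy? v)) * w v) ≡ ∑ᵥ (λ v → ι (v ∈ᵇ A ∧ does (heavy? v)) * (τ ^ℚ (r ∸ 1) * w v))
        regroup = trans (sym (∑-*ˡ (allFin n) (τ ^ℚ (r ∸ 1)) (λ v → ι (v ∈ᵇ A ∧ does (heavy? v)) * w v)))
          (∑-cong (allFin n) (λ v → solve 3 (λ p i w → p :* (i :* w) := i :* (p :* w)) refl (τ ^ℚ (r ∸ 1)) (ι (v ∈ᵇ A ∧ does (heavy? v))) (w v)))
        parts : ∀ g v → v ∈ᵇ A ∧ (R (toℕ v) 1 g ∧ ⁅ v ⁆ ⊆ᵇ tail 1 g) ≡ true → v ∈ A × R (toℕ v) 1 g ≡ true × v ∈ tail 1 g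
        parts g v h with ∧-true {v ∈ᵇ A} h
        ... | v∈A , h′ with ∧-true {R (toℕ v) 1 g} h′
        ...   | Rg , sub = dec-true (v ∈? A) v∈A , Rg , dec-true (⁅ v ⁆ ⊆? tail 1 g) sub (SP.x∈⁅x⁆ v)
        ∣tail1∣ : ∀ g k → R k 1 g ≡ true → ∣ tail 1 g ∣ ≡ 1
        ∣tail1∣ g k Rg = ∣tail∣ 1 g (ℕP.≤-trans (proj₂ (run-edge (at A) k 1 Rg)) (ℕP.≤-reflexive (sym (run-card (at A) k 1 Rg))))
        inside-A : ∀ g v → v ∈ᵇ A ∧ (R (toℕ v) 1 g ∧ ⁅ v ⁆ ⊆ᵇ tail 1 g) ≡ true → edge G g ∧ g ⊆ᵇ A ≡ true
        inside-A g v h with parts g v h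
        ... | v∈A , Rg , v∈ = true-∧ (proj₁ (run-edge (at A) (toℕ v) 1 Rg)) (true-dec (g ⊆? A) g⊆A)
          where
          g⊆A : g ⊆ A
          g⊆A u∈g with run-head (at A) (toℕ v) 1 Rg u∈g
          ... | inj₁ u∈ = subst (_∈ A) (singleton-unique (∣tail1∣ g (toℕ v) Rg) v∈ u∈) v∈A
          ... | inj₂ at-u = ∈-at at-u
        unique : ∀ g u v → u ∈ᵇ A ∧ (R (toℕ u) 1 g ∧ ⁅ u ⁆ ⊆ᵇ tail 1 g) ≡ true → v ∈ᵇ A ∧ (R (toℕ v) 1 g ∧ ⁅ v ⁆ ⊆ᵇ tail 1 g) ≡ true → u ≡ v
        unique g u v hu hv with parts g u hu | parts g v hv
        ... | _ , Rg , u∈ | _ , _ , v∈ = singleton-unique (∣tail1∣ g (toℕ u) Rg) u∈ v∈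

    module _ (selected : ∀ {v} → v ∈ A → Selected (R (toℕ v)) v) where

      opaque
        unfolding heavySum

        wt≤sums : wt G A ≤ℚ heavySum + ∑ᵥ {r ∸ 1} (λ s → largeSum (toℕ s))
        wt≤sums = ℚP.≤-trans (∑-mono (allFin n) term) (ℚP.≤-reflexive (trans (∑-+ (allFin n) h₀ (λ v → ∑ᵥ {r ∸ 1} (λ s → h₁ v s)))
            (cong (∑ᵥ h₀ +_) (∑-swap (allFin n) (allFin (r ∸ 1)) h₁))))
          where
          h₀ : Fin n → ℚ
          h₀ v = ι (v ∈ᵇ A ∧ does (heavy? v)) * w v
          h₁ : Fin n → Fin (r ∸ 1) → ℚ
          h₁ v s = ι (v ∈ᵇ A ∧ does (large? (toℕ s) v)) * w v
          0≤h₀ : ∀ v → 0ℚ ≤ℚ h₀ v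
          0≤h₀ v = 0≤* (0≤ι (v ∈ᵇ A ∧ does (heavy? v))) (0≤w v)
          0≤h₁ : ∀ v s → 0ℚ ≤ℚ h₁ v s
          0≤h₁ v s = 0≤* (0≤ι (v ∈ᵇ A ∧ does (large? (toℕ s) v))) (0≤w v)
          term : ∀ v → ι (v ∈ᵇ A) * w v ≤ℚ h₀ v + ∑ᵥ (h₁ v)
          term v = go (v ∈? A)
            where
            bool : ∀ {b} → v ∈ A → b ≡ true → ι (v ∈ᵇ A) * w v ≤ℚ ι (v ∈ᵇ A ∧ b) * w v
            bool v∈A refl = ℚP.≤-reflexive (cong (λ c → ι c * w v) (trans (true-dec (v ∈? A) v∈A) (sym (true-∧ (true-dec (v ∈? A) v∈A) refl))))
            go : Dec (v ∈ A) → ι (v ∈ᵇ A) * w v ≤ℚ h₀ v + ∑ᵥ (h₁ v)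
            go (no v∉A) = ℚP.≤-trans (ℚP.≤-reflexive (trans (cong (λ c → ι c * w v) (false-dec (v ∈? A) v∉A)) (ℚP.*-zeroˡ (w v))))
              (0≤+ (0≤h₀ v) (0≤∑ (allFin (r ∸ 1)) (0≤h₁ v)))
            go (yes v∈A) with proj₂ (selected v∈A)
            ... | inj₁ (s , big) = ℚP.≤-trans (bool v∈A (true-dec (large? (toℕ s) v) big)) (ℚP.≤-trans (≤∑ᵥ {f = h₁ v} (0≤h₁ v) s) (≤-+ˡ (0≤h₀ v)))
            ... | inj₂ hv = ℚP.≤-trans (bool v∈A (true-dec (heavy? v) hv)) (≤-+ʳ (0≤∑ (allFin (r ∸ 1)) (0≤h₁ v)))

      ∑largeSum≤ : ζ * ∑ᵥ {r ∸ 1} (λ s → largeSum (toℕ s)) ≤ℚ κ (r ∸ 1) * (κ 2 * (τ * W))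
      ∑largeSum≤ = ℚP.≤-trans (ℚP.≤-reflexive (sym (∑-*ˡ (allFin (r ∸ 1)) ζ (λ s → largeSum (toℕ s)))))
        (ℚP.≤-trans (∑-mono (allFin (r ∸ 1)) (λ s → largeSum≤ (toℕ s) (ℕP.≤-trans (s≤s (FP.toℕ<n s)) (ℕP.≤-reflexive (ℕP.m+[n∸m]≡n (ℕP.<⇒≤ 2≤r))))))
          (ℚP.≤-reflexive (∑ᵥ-const (r ∸ 1) (κ 2 * (τ * W)))))

      β∣A∣≤wt : β * κ ∣ A ∣ ≤ℚ wt G A
      β∣A∣≤wt = ℚP.≤-trans (ℚP.≤-reflexive (trans (cong (β *_) (sym (∑-card A))) (sym (∑-*ˡ (allFin n) β (λ v → ι (v ∈ᵇ A))))))
        (∑-mono (allFin n) term)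
        where
        term : ∀ v → β * ι (v ∈ᵇ A) ≤ℚ ι (v ∈ᵇ A) * w v
        term v = ℚP.≤-trans (ℚP.≤-reflexive (ℚP.*-comm β (ι (v ∈ᵇ A)))) (go (v ∈? A))
          where
          go : (d : Dec (v ∈ A)) → ι (does d) * β ≤ℚ ι (does d) * w v
          go (yes v∈A) = *-monoˡ 0≤1 (proj₁ (selected v∈A))
          go (no _) = ℚP.≤-reflexive (trans (ℚP.*-zeroˡ β) (sym (ℚP.*-zeroˡ (w v))))

      heavy-sparse : κ (eInduced G A) * ζ ≤ℚ κ 2 * (τ ^ℚ r * W) → ζ * heavySum ≤ℚ κ 2 * (τ * W)
      heavy-sparse few = *-cancelˡ (^-pos 0<τ (r ∸ 1)) (ℚP.≤-trans
        (ℚP.≤-reflexive (solve 3 (λ p z h → p :* (z :* h) := (p :* h) :* z) refl (τ ^ℚ (r ∸ 1)) ζ heavySum))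
        (ℚP.≤-trans (*-monoʳ 0≤ζ heavySum≤) (ℚP.≤-trans few (ℚP.≤-reflexive (trans
          (cong (λ m → κ 2 * (τ ^ℚ m * W)) (sym (ℕP.m+[n∸m]≡n (ℕP.<⇒≤ 2≤r))))
          (solve 4 (λ a T p W → a :* ((T :* p) :* W) := p :* (a :* (T :* W))) refl (κ 2) τ (τ ^ℚ (r ∸ 1)) W))))))

      κr : κ r ≡ 1ℚ + κ (r ∸ 1)
      κr = trans (cong κ (sym (ℕP.m+[n∸m]≡n (ℕP.<⇒≤ 2≤r)))) (trans (κ-+ 1 (r ∸ 1)) (cong (_+ κ (r ∸ 1)) κ-1))

      -- The hypothesis is relative to the weight of A and closes up on itself: it yields r heavySum
      -- ≤ heavySum + L, so (r - 1) heavySum ≤ L. Since ζL is at most r - 1 times 2τW, the vertices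
      -- saturated in P₁ weigh no more than the bound for a single level.
      heavy-degenerate : κ r * κ (eInduced G A) ≤ℚ τ ^ℚ (r ∸ 1) * wt G A → ζ * heavySum ≤ℚ κ 2 * (τ * W)
      heavy-degenerate few = *-cancelˡ (0<κ (ℕP.∸-monoˡ-≤ 1 2≤r))
        (ℚP.≤-trans (ℚP.≤-reflexive (solve 3 (λ m z h → m :* (z :* h) := z :* (m :* h)) refl (κ (r ∸ 1)) ζ heavySum))
          (ℚP.≤-trans (*-monoˡ 0≤ζ cancelled) ∑largeSum≤))
        where
        L : ℚ
        L = ∑ᵥ {r ∸ 1} (λ s → largeSum (toℕ s))
        scaled : τ ^ℚ (r ∸ 1) * (κ r * heavySum) ≤ℚ τ ^ℚ (r ∸ 1) * (heavySum + L)
        scaled = ℚP.≤-trans (ℚP.≤-reflexive (solve 3 (λ p m h → p :* (m :* h) := m :* (p :* h)) refl (τ ^ℚ (r ∸ 1)) (κ r) heavySum))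
          (ℚP.≤-trans (*-monoˡ (0≤κ r) heavySum≤) (ℚP.≤-trans few (*-monoˡ (0≤τ^ (r ∸ 1)) wt≤sums)))
        cancelled : κ (r ∸ 1) * heavySum ≤ℚ L
        cancelled = +-cancelˡ heavySum (ℚP.≤-trans (ℚP.≤-reflexive (trans (solve 2 (λ h m → h :+ m :* h := (con 1ℚ :+ m) :* h) refl heavySum (κ (r ∸ 1))) (cong (_* heavySum) (sym κr))))
          (*-cancelˡ (^-pos 0<τ (r ∸ 1)) scaled))

      wt≤ : ζ * heavySum ≤ℚ κ 2 * (τ * W) → ζ * wt G A ≤ℚ κ 2 * κ r * (τ * W)
      wt≤ heavy≤ = ℚP.≤-trans (*-monoˡ 0≤ζ wt≤sums) (ℚP.≤-trans (ℚP.≤-reflexive (ℚP.*-distribˡ-+ ζ heavySum _))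
        (ℚP.≤-trans (ℚP.+-mono-≤ heavy≤ ∑largeSum≤) (ℚP.≤-reflexive (trans
          (solve 3 (λ a m x → a :* x :+ m :* (a :* x) := (a :* (con 1ℚ :+ m)) :* x) refl (κ 2) (κ (r ∸ 1)) (τ * W))
          (cong (λ m → κ 2 * m * (τ * W)) (sym κr))))))

-- Unselected vertices and the charging of refused sets.

module Sparse {r n : ℕ} (G : RGraph r n) (τ ζ β W : ℚ) (0<τ : 0ℚ < τ) (0<ζ : 0ℚ < ζ) (ζ≤1 : ζ ≤ℚ 1ℚ) (2≤r : 2 ≤ r)
    (0<W : 0ℚ < W) (W≡∑ : W ≡ ∑ᵥ (λ v → κ (deg G v)))
    (∑over≤ζ : ∀ s t → suc s ℕ.+ t ≡ r → ∑ᵥ (Degrees.over G τ ζ β 0<τ t) ≤ℚ τ ^ℚ t * W * ζ)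
    (2∑over≤ζ : ∀ s t → suc (suc s) ℕ.+ t ≡ r → κ 2 * ∑ᵥ (Degrees.over G τ ζ β 0<τ t) ≤ℚ τ ^ℚ t * W * ζ)
    (b : ℕ → Bool) (U : Subset n) where

  open Weights G τ ζ β W 0<τ 0<ζ ζ≤1 2≤r 0<W W≡∑ ∑over≤ζ 2∑over≤ζ hiding (module Run)

  R : ℕ → State
  R = run b

  Q : State
  Q = R n

  inner : ℕ → ℚ
  inner s = ∑ₛ (λ g → ι (Q s g ∧ tail s g ⊆ᵇ U))

  outer : ℕ → ℚ
  outer s = ∑ₛ (λ g → ι (Q s g ∧ not (tail s g ⊆ᵇ U)))

  ε : ℚ
  ε = ∑ᵥ (λ v → ι (not (v ∈ᵇ U)) * w v)

  over-in over-out : ℕ → ℚ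
  over-in t = ∑ᵥ (λ v → ι (v ∈ᵇ U) * over t v)
  over-out t = ∑ᵥ (λ v → ι (not (v ∈ᵇ U)) * over t v)

  -- The total degree in Pₛ, for t = r - s, that `cnt-vertex` allows to the vertices outside U.
  bound-out : ℕ → ℚ
  bound-out t = τ ^ℚ t * ε + over-out t

  ι-not : ∀ c → ι c + ι (not c) ≡ 1ℚ
  ι-not true = ℚP.+-identityʳ 1ℚ
  ι-not false = ℚP.+-identityˡ 1ℚ

  over-in+out : ∀ t → over-in t + over-out t ≡ ∑ᵥ (over t)
  over-in+out t = trans (sym (∑-+ (allFin n) (λ v → ι (v ∈ᵇ U) * over t v) (λ v → ι (not (v ∈ᵇ U)) * over t v)))
    (∑-cong (allFin n) (λ v → trans (sym (ℚP.*-distribʳ-+ (over t v) (ι (v ∈ᵇ U)) (ι (not (v ∈ᵇ U)))))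
      (trans (cong (_* over t v) (ι-not (v ∈ᵇ U))) (ℚP.*-identityˡ (over t v)))))

  outside-vertex : ∀ {f : Subset n} → ¬ (f ⊆ U) → ∃ λ v → v ∈ f × v ∉ U
  outside-vertex {f} f⊈U with FP.any? (λ v → (v ∈? f) ×-dec ¬? (v ∈? U))
  ... | yes found = found
  ... | no none = ⊥-elim (f⊈U (λ {x} x∈f → inU x x∈f (x ∈? U)))
    where
    inU : ∀ x → x ∈ f → Dec (x ∈ U) → x ∈ U
    inU x x∈f (yes x∈U) = x∈U
    inU x x∈f (no x∉U) = ⊥-elim (none (x , x∈f , x∉U))

  cnt-swap : ∀ {X : Set} (xs : List X) (p : X → Bool) (h : X → Subset n) s →
    ∑ xs (λ x → ι (p x) * cnt Q s (h x)) ≡ ∑ₛ (λ g → ∑ xs (λ x → ι (p x ∧ (Q s g ∧ h x ⊆ᵇ tail s g))))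
  cnt-swap xs p h s = trans (∑-cong xs (λ x → trans (sym (∑-*ˡ (allSubsets n) (ι (p x)) (λ g → ι (Q s g ∧ h x ⊆ᵇ tail s g))))
      (∑-cong (allSubsets n) (λ g → sym (ι-∧ (p x) (Q s g ∧ h x ⊆ᵇ tail s g))))))
    (∑-swap xs (allSubsets n) (λ x g → ι (p x ∧ (Q s g ∧ h x ⊆ᵇ tail s g))))

  outer≤ : ∀ s t → s ℕ.+ t ≡ r → outer s ≤ℚ bound-out t
  outer≤ s t eq = ℚP.≤-trans (∑-mono (allSubsets n) vertex)
    (ℚP.≤-trans (ℚP.≤-reflexive (sym (cnt-swap (allFin n) (λ v → not (v ∈ᵇ U)) (λ v → ⁅ v ⁆) s)))
      (ℚP.≤-trans (∑-mono (allFin n) (λ v → *-monoˡ (0≤ι (not (v ∈ᵇ U))) (cnt-vertex b n t s eq v))) (ℚP.≤-reflexive regroup)))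
    where
    vertex : ∀ g → ι (Q s g ∧ not (tail s g ⊆ᵇ U)) ≤ℚ ∑ᵥ (λ v → ι (not (v ∈ᵇ U) ∧ (Q s g ∧ ⁅ v ⁆ ⊆ᵇ tail s g)))
    vertex g = ι-≤ (0≤∑ (allFin n) (λ v → 0≤ι (not (v ∈ᵇ U) ∧ (Q s g ∧ ⁅ v ⁆ ⊆ᵇ tail s g)))) λ h →
      let Qg , out = ∧-true {Q s g} h
          v , v∈ , v∉U = outside-vertex (dec-false (tail s g ⊆? U) (not-true out))
      in ℚP.≤-trans (ℚP.≤-reflexive (cong ι (sym (true-∧ (cong not (false-dec (v ∈? U) v∉U)) (true-∧ Qg (true-dec (⁅ v ⁆ ⊆? tail s g) (⁅⁆⊆ v∈)))))))
           (≤∑ᵥ {f = λ v → ι (not (v ∈ᵇ U) ∧ (Q s g ∧ ⁅ v ⁆ ⊆ᵇ tail s g))} (λ v → 0≤ι (not (v ∈ᵇ U) ∧ (Q s g ∧ ⁅ v ⁆ ⊆ᵇ tail s g))) v)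
    regroup : ∑ᵥ (λ v → ι (not (v ∈ᵇ U)) * (τ ^ℚ t * w v + over t v)) ≡ bound-out t
    regroup = trans (∑-cong (allFin n) (λ v → solve 4 (λ i p w o → i :* (p :* w :+ o) := p :* (i :* w) :+ i :* o) refl (ι (not (v ∈ᵇ U))) (τ ^ℚ t) (w v) (over t v)))
      (trans (∑-+ (allFin n) (λ v → τ ^ℚ t * (ι (not (v ∈ᵇ U)) * w v)) (λ v → ι (not (v ∈ᵇ U)) * over t v))
        (cong (_+ over-out t) (∑-*ˡ (allFin n) (τ ^ℚ t) (λ v → ι (not (v ∈ᵇ U)) * w v))))

  -- Saturation is judged in the state in which the least vertex of `tail (suc s) g` is read, the
  -- moment at which the algorithm itself decides.
  bad : ℕ → Subset n → Bool
  bad s g = (Q (suc s) g ∧ tail (suc s) g ⊆ᵇ U) ∧ does (blocked? (R (pos s g)) s (tail s g))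

  badSum : ℕ → ℚ
  badSum s = ∑ₛ (λ g → ι (bad s g))

  s<card : ∀ {s} g → Q (suc s) g ≡ true → s ℕ.< ∣ g ∣
  s<card {s} g Rg = ℕP.≤-trans (proj₂ (run-edge b n (suc s) Rg)) (ℕP.≤-reflexive (sym (run-card b n (suc s) Rg)))

  -- The least vertex v of `tail (suc s) g` lies in U. By `run-settled` the set is already present
  -- when v is read, so the rest of it is either blocked or counted in Fᵥₛ, whether or not b accepts
  -- v.
  inner-split : ∀ s → s ℕ.< r → inner (suc s) ≤ℚ ∑ᵥ (λ v → ι (v ∈ᵇ U) * fsize (R (toℕ v)) s (toℕ v)) + badSum s
  inner-split s s<r = ℚP.≤-trans (∑-mono (allSubsets n) split)
    (ℚP.≤-reflexive (trans (∑-+ (allSubsets n) (λ g → ∑ᵥ (λ v → ι (v ∈ᵇ U ∧ free (R (toℕ v)) s (toℕ v) g))) (λ g → ι (bad s g)))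
      (cong (_+ badSum s) (sym (trans (∑-cong (allFin n) (λ v → trans (sym (∑-*ˡ (allSubsets n) (ι (v ∈ᵇ U)) (λ g → ι (free (R (toℕ v)) s (toℕ v) g))))
          (∑-cong (allSubsets n) (λ g → sym (ι-∧ (v ∈ᵇ U) (free (R (toℕ v)) s (toℕ v) g))))))
        (∑-swap (allFin n) (allSubsets n) (λ v g → ι (v ∈ᵇ U ∧ free (R (toℕ v)) s (toℕ v) g))))))))
    where
    split : ∀ g → ι (Q (suc s) g ∧ tail (suc s) g ⊆ᵇ U) ≤ℚ ∑ᵥ (λ v → ι (v ∈ᵇ U ∧ free (R (toℕ v)) s (toℕ v) g)) + ι (bad s g)
    split g = ι-≤ (0≤+ 0≤sum (0≤ι (bad s g))) (λ h → go h (blocked? (R (pos s g)) s (tail s g)))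
      where
      0≤term : ∀ v → 0ℚ ≤ℚ ι (v ∈ᵇ U ∧ free (R (toℕ v)) s (toℕ v) g)
      0≤term v = 0≤ι (v ∈ᵇ U ∧ free (R (toℕ v)) s (toℕ v) g)
      0≤sum = 0≤∑ (allFin n) 0≤term
      go : Q (suc s) g ∧ tail (suc s) g ⊆ᵇ U ≡ true → Dec (Blocked (R (pos s g)) s (tail s g)) →
        1ℚ ≤ℚ ∑ᵥ (λ v → ι (v ∈ᵇ U ∧ free (R (toℕ v)) s (toℕ v) g)) + ι (bad s g)
      go h (yes bl) = ℚP.≤-trans (ℚP.≤-reflexive (cong ι (sym (true-∧ h (true-dec (blocked? (R (pos s g)) s (tail s g)) bl))))) (≤-+ˡ 0≤sum)
      go h (no ¬bl) with ∧-true {Q (suc s) g} h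
      ... | Qg , sub with pos-vertex s g (s<card g Qg)
      ...   | v , v≡pos , v∈ = ℚP.≤-trans (ℚP.≤-trans
          (ℚP.≤-reflexive (cong ι (sym (true-∧ (true-dec (v ∈? U) (dec-true (tail (suc s) g ⊆? U) sub v∈)) freed))))
          (≤∑ᵥ {f = λ v → ι (v ∈ᵇ U ∧ free (R (toℕ v)) s (toℕ v) g)} 0≤term v)) (≤-+ʳ (0≤ι (bad s g)))
        where
        freed : free (R (toℕ v)) s (toℕ v) g ≡ true
        freed = subst (λ p → free (R p) s p g ≡ true) (sym v≡pos)
          (true-∧ (true-dec (pos s g ℕ.≟ pos s g) refl) (true-∧ (run-settled b n s s<r Qg)
            (cong not (false-dec (blocked? (R (pos s g)) s (tail s g)) ¬bl))))

  module Charge (s t : ℕ) (eq : s ℕ.+ suc t ≡ r) (1≤s : 1 ≤ s) where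

    eq′ : suc s ℕ.+ t ≡ r
    eq′ = trans (sym (ℕP.+-suc s t)) eq

    s≤r : s ≤ r
    s≤r = ℕP.≤-trans (ℕP.m≤m+n s (suc t)) (ℕP.≤-reflexive eq)

    full? : ∀ v → Dec (θ s ⁅ v ⁆ ≤ℚ cnt Q s ⁅ v ⁆)
    full? v = _ ℚP.≤? _

    opaque
      -- The vertices of U that are saturated in Pₛ, and the others.
      P N : Subset n
      P = tabulate (λ v → v ∈ᵇ U ∧ does (full? v))
      N = tabulate (λ v → v ∈ᵇ U ∧ not (does (full? v)))

      P⁻ : ∀ {v} → v ∈ P → v ∈ U × θ s ⁅ v ⁆ ≤ℚ cnt Q s ⁅ v ⁆
      P⁻ {v} v∈ with ∧-true {v ∈ᵇ U} (∈-tabulate⁻ v∈)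
      ... | v∈U , fl = dec-true (v ∈? U) v∈U , dec-true (full? v) fl

      P⁺ : ∀ {v} → v ∈ U → θ s ⁅ v ⁆ ≤ℚ cnt Q s ⁅ v ⁆ → v ∈ P
      P⁺ {v} v∈U fl = ∈-tabulate⁺ (true-∧ (true-dec (v ∈? U) v∈U) (true-dec (full? v) fl))

      N⁻ : ∀ {v} → v ∈ N → v ∈ U × ¬ (θ s ⁅ v ⁆ ≤ℚ cnt Q s ⁅ v ⁆)
      N⁻ {v} v∈ with ∧-true {v ∈ᵇ U} (∈-tabulate⁻ v∈)
      ... | v∈U , fl = dec-true (v ∈? U) v∈U , dec-false (full? v) (not-true fl)

      N⁺ : ∀ {v} → v ∈ U → ¬ (θ s ⁅ v ⁆ ≤ℚ cnt Q s ⁅ v ⁆) → v ∈ N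
      N⁺ {v} v∈U fl = ∈-tabulate⁺ (true-∧ (true-dec (v ∈? U) v∈U) (cong not (false-dec (full? v) fl)))

    -- Saturated sets without saturated vertices; the others are paid for through P.
    Large : Subset n → Set
    Large σ = 2 ≤ ∣ σ ∣ × θ s σ ≤ℚ cnt Q s σ × σ ⊆ N

    opaque
      large?′ : ∀ σ → Dec (Large σ)
      large?′ σ = (2 ℕ.≤? ∣ σ ∣) ×-dec ((θ s σ ℚP.≤? cnt Q s σ) ×-dec (σ ⊆? N))

    large : Subset n → Bool
    large σ = does (large?′ σ)

    -- Degrees in Pₛ only grow, so the blocking σ is still saturated at the end. If none of its
    -- vertices is saturated, then σ is not a singleton, and it lies in N since the whole tail lies
    -- in U.
    bad≤ : badSum s ≤ℚ ∑ᵥ (λ v → ι (v ∈ᵇ P) * cnt Q (suc s) ⁅ v ⁆) + ∑ₛ (λ σ → ι (large σ) * cnt Q (suc s) σ)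
    bad≤ = ℚP.≤-trans (∑-mono (allSubsets n) witness)
      (ℚP.≤-reflexive (trans (∑-+ (allSubsets n) (λ g → ∑ᵥ (λ v → vtx g v)) (λ g → ∑ₛ (λ σ → lrg g σ)))
        (cong₂ _+_ (sym (cnt-swap (allFin n) (λ v → v ∈ᵇ P) (λ v → ⁅ v ⁆) (suc s))) (sym (cnt-swap (allSubsets n) large (λ σ → σ) (suc s))))))
      where
      vtx : Subset n → Fin n → ℚ
      vtx g v = ι (v ∈ᵇ P ∧ (Q (suc s) g ∧ ⁅ v ⁆ ⊆ᵇ tail (suc s) g))
      lrg : Subset n → Subset n → ℚ
      lrg g σ = ι (large σ ∧ (Q (suc s) g ∧ σ ⊆ᵇ tail (suc s) g))
      0≤vtx : ∀ g v → 0ℚ ≤ℚ vtx g v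
      0≤vtx g v = 0≤ι (v ∈ᵇ P ∧ (Q (suc s) g ∧ ⁅ v ⁆ ⊆ᵇ tail (suc s) g))
      0≤lrg : ∀ g σ → 0ℚ ≤ℚ lrg g σ
      0≤lrg g σ = 0≤ι (large σ ∧ (Q (suc s) g ∧ σ ⊆ᵇ tail (suc s) g))
      witness : ∀ g → ι (bad s g) ≤ℚ ∑ᵥ (vtx g) + ∑ₛ (lrg g)
      witness g = ι-≤ (0≤+ (0≤∑ (allFin n) (0≤vtx g)) (0≤∑ (allSubsets n) (0≤lrg g))) λ h →
        let h₁ , bl = ∧-true {Q (suc s) g ∧ tail (suc s) g ⊆ᵇ U} h
            Qg , sub = ∧-true {Q (suc s) g} h₁
        in found Qg (dec-true (tail (suc s) g ⊆? U) sub) (dec-true (blocked? (R (pos s g)) s (tail s g)) bl)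
        where
        found : Q (suc s) g ≡ true → tail (suc s) g ⊆ U → Blocked (R (pos s g)) s (tail s g) → 1ℚ ≤ℚ ∑ᵥ (vtx g) + ∑ₛ (lrg g)
        found Qg tail⊆U (σ , (u₀ , u₀∈σ) , σ⊆ , θ≤) = cases (FP.any? (λ u → (u ∈? σ) ×-dec full? u))
          where
          σ⊆′ : σ ⊆ tail (suc s) g
          σ⊆′ x∈σ = tail-suc-⊆ s g (σ⊆ x∈σ)
          pos<n : pos s g ≤ n
          pos<n with pos-vertex s g (s<card g Qg)
          ... | v , v≡pos , _ = subst (_≤ n) v≡pos (ℕP.<⇒≤ (FP.toℕ<n v))
          θ≤Q : θ s σ ≤ℚ cnt Q s σ
          θ≤Q = ℚP.≤-trans θ≤ (cnt-mono b s σ pos<n)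
          two : ¬ (∃ λ u → u ∈ σ × θ s ⁅ u ⁆ ≤ℚ cnt Q s ⁅ u ⁆) → 2 ≤ ∣ σ ∣
          two none with 2 ℕ.≤? ∣ σ ∣
          ... | yes 2≤ = 2≤
          ... | no 2≰ = ⊥-elim (none (u₀ , u₀∈σ , subst (λ σ → θ s σ ≤ℚ cnt Q s σ) σ≡ θ≤Q))
            where
            ∣σ∣≡1 : ∣ σ ∣ ≡ 1
            ∣σ∣≡1 = ℕP.≤-antisym (ℕP.≤-pred (ℕP.≰⇒> 2≰)) (ℕP.≤-trans (ℕP.≤-reflexive (sym (SP.∣⁅x⁆∣≡1 u₀))) (SP.p⊆q⇒∣p∣≤∣q∣ (⁅⁆⊆ u₀∈σ)))
            σ≡ : σ ≡ ⁅ u₀ ⁆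
            σ≡ = SP.⊆-antisym (λ x∈σ → subst (_∈ ⁅ u₀ ⁆) (singleton-unique ∣σ∣≡1 u₀∈σ x∈σ) (SP.x∈⁅x⁆ u₀)) (⁅⁆⊆ u₀∈σ)
          cases : Dec (∃ λ u → u ∈ σ × θ s ⁅ u ⁆ ≤ℚ cnt Q s ⁅ u ⁆) → 1ℚ ≤ℚ ∑ᵥ (vtx g) + ∑ₛ (lrg g)
          cases (yes (u , u∈σ , fl)) = ℚP.≤-trans (ℚP.≤-trans
            (ℚP.≤-reflexive (cong ι (sym (true-∧ (true-dec (u ∈? P) (P⁺ (tail⊆U (σ⊆′ u∈σ)) fl)) (true-∧ Qg (true-dec (⁅ u ⁆ ⊆? tail (suc s) g) (⁅⁆⊆ (σ⊆′ u∈σ))))))))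
            (≤∑ᵥ {f = vtx g} (0≤vtx g) u)) (≤-+ʳ (0≤∑ (allSubsets n) (0≤lrg g)))
          cases (no none) = ℚP.≤-trans (ℚP.≤-trans
            (ℚP.≤-reflexive (cong ι (sym (true-∧ (true-dec (large?′ σ) (two none , θ≤Q , λ x∈σ → N⁺ (tail⊆U (σ⊆′ x∈σ)) (λ fl → none (_ , x∈σ , fl))))
              (true-∧ Qg (true-dec (σ ⊆? tail (suc s) g) σ⊆′))))))
            (≤∑ₛ {f = lrg g} (0≤lrg g) σ)) (≤-+ˡ (0≤∑ (allFin n) (0≤vtx g)))

    onTail : Subset n → Subset n → ℚ
    onTail S g = ∑ᵥ (λ v → ι (v ∈ᵇ S ∧ v ∈ᵇ tail s g))

    -- A saturated v has degree at least τ^(r-s) d(v) in Pₛ, and τ times its degree in Pₛ₊₁ exceeds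
    -- this by at most τ times the overshoot.
    vertices≤ : τ * ∑ᵥ (λ v → ι (v ∈ᵇ P) * cnt Q (suc s) ⁅ v ⁆) ≤ℚ ∑ₛ (λ g → ι (Q s g) * onTail P g) + τ * over-in t
    vertices≤ = ℚP.≤-trans (ℚP.≤-reflexive (sym (∑-*ˡ (allFin n) τ (λ v → ι (v ∈ᵇ P) * cnt Q (suc s) ⁅ v ⁆))))
      (ℚP.≤-trans (∑-mono (allFin n) term) (ℚP.≤-reflexive (trans
        (∑-+ (allFin n) (λ v → ι (v ∈ᵇ P) * cnt Q s ⁅ v ⁆) (λ v → τ * (ι (v ∈ᵇ U) * over t v)))
        (cong₂ _+_ (trans (cnt-swap (allFin n) (λ v → v ∈ᵇ P) (λ v → ⁅ v ⁆) s) (∑-cong (allSubsets n) pull))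
                   (∑-*ˡ (allFin n) τ (λ v → ι (v ∈ᵇ U) * over t v))))))
      where
      pull : ∀ g → ∑ᵥ (λ v → ι (v ∈ᵇ P ∧ (Q s g ∧ ⁅ v ⁆ ⊆ᵇ tail s g))) ≡ ι (Q s g) * onTail P g
      pull g = trans (∑-cong (allFin n) (λ v → trans (cong (λ c → ι (v ∈ᵇ P ∧ (Q s g ∧ c))) (⁅⁆⊆ᵇ v (tail s g)))
          (trans (ι-∧ (v ∈ᵇ P) (Q s g ∧ v ∈ᵇ tail s g)) (trans (cong (ι (v ∈ᵇ P) *_) (ι-∧ (Q s g) (v ∈ᵇ tail s g)))
            (trans (solve 3 (λ p q i → p :* (q :* i) := q :* (p :* i)) refl (ι (v ∈ᵇ P)) (ι (Q s g)) (ι (v ∈ᵇ tail s g)))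
              (cong (ι (Q s g) *_) (sym (ι-∧ (v ∈ᵇ P) (v ∈ᵇ tail s g)))))))))
        (∑-*ˡ (allFin n) (ι (Q s g)) (λ v → ι (v ∈ᵇ P ∧ v ∈ᵇ tail s g)))
      term : ∀ v → τ * (ι (v ∈ᵇ P) * cnt Q (suc s) ⁅ v ⁆) ≤ℚ ι (v ∈ᵇ P) * cnt Q s ⁅ v ⁆ + τ * (ι (v ∈ᵇ U) * over t v)
      term v = go (v ∈? P)
        where
        go : (d : Dec (v ∈ P)) → τ * (ι (does d) * cnt Q (suc s) ⁅ v ⁆) ≤ℚ ι (does d) * cnt Q s ⁅ v ⁆ + τ * (ι (v ∈ᵇ U) * over t v)
        go (no _) = ℚP.≤-trans (ℚP.≤-reflexive (solve 2 (λ a c → a :* (con 0ℚ :* c) := con 0ℚ) refl τ (cnt Q (suc s) ⁅ v ⁆)))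
          (0≤+ (0≤* ℚP.≤-refl (0≤cnt Q s ⁅ v ⁆)) (0≤* 0≤τ (0≤* (0≤ι (v ∈ᵇ U)) (0≤over t v))))
        go (yes v∈P) with P⁻ v∈P
        ... | v∈U , fl = ℚP.≤-trans (*-monoˡ 0≤τ (*-monoˡ 0≤1 (cnt-vertex b n t (suc s) eq′ v)))
          (ℚP.≤-trans (ℚP.≤-reflexive (solve 4 (λ T p w o → T :* (con 1ℚ :* (p :* w :+ o)) := con 1ℚ :* ((T :* p) :* w) :+ T :* (con 1ℚ :* o)) refl τ (τ ^ℚ t) (w v) (over t v)))
            (ℚP.+-mono-≤ (*-monoˡ 0≤1 (ℚP.≤-trans (ℚP.≤-reflexive (sym θ≡)) fl))
              (ℚP.≤-reflexive (cong (λ c → τ * (ι c * over t v)) (sym (true-dec (v ∈? U) v∈U))))))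
          where
          θ≡ : θ s ⁅ v ⁆ ≡ τ * τ ^ℚ t * w v
          θ≡ = trans (θ-vertex s v) (cong (λ a → τ ^ℚ a * w v) (trans (cong (_∸ s) (sym eq)) (ℕP.m+n∸m≡n s (suc t))))

    ∣tail∣≡s : ∀ {g} → Q s g ≡ true → ∣ tail s g ∣ ≡ s
    ∣tail∣≡s {g} Qg = ∣tail∣ s g (ℕP.≤-trans s≤r (ℕP.≤-reflexive (sym (run-card b n s Qg))))

    onTail-card : ∀ S g → onTail S g ≡ κ ∣ S ∩ tail s g ∣
    onTail-card S g = trans (∑-cong (allFin n) (λ v → cong ι (iff-≡
        (λ h → true-dec (v ∈? S ∩ tail s g) (SP.x∈p∩q⁺ (dec-true (v ∈? S) (proj₁ (∧-true h)) , dec-true (v ∈? tail s g) (proj₂ (∧-true {v ∈ᵇ S} h)))))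
        (λ h → let v∈S , v∈ = SP.x∈p∩q⁻ S (tail s g) (dec-true (v ∈? S ∩ tail s g) h) in true-∧ (true-dec (v ∈? S) v∈S) (true-dec (v ∈? tail s g) v∈)))))
      (∑-card (S ∩ tail s g))

    -- At most 2^s large sets lie in a tail, and none unless the tail meets N.
    large-on-tail : ∀ g → ∑ₛ (λ σ → ι (large σ ∧ (Q s g ∧ σ ⊆ᵇ tail s g))) ≤ℚ ι (Q s g) * (κ (2 ℕ.^ s) * onTail N g)
    large-on-tail g = subst (λ x → ∑ₛ (λ σ → ι (large σ ∧ (Q s g ∧ σ ⊆ᵇ tail s g))) ≤ℚ ι (Q s g) * (κ (2 ℕ.^ s) * x)) (sym (onTail-card N g)) (go (Q s g) refl)
      where
      M = N ∩ tail s g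
      sub : ∀ {q} σ → large σ ∧ (q ∧ σ ⊆ᵇ tail s g) ≡ true → 2 ≤ ∣ σ ∣ × σ ⊆ M
      sub {q} σ h with ∧-true {large σ} h
      ... | lg , h′ with dec-true (large?′ σ) lg | dec-true (σ ⊆? tail s g) (proj₂ (∧-true {q} h′))
      ...   | 2≤ , _ , σ⊆N | σ⊆tail = 2≤ , λ x∈σ → SP.x∈p∩q⁺ (σ⊆N x∈σ , σ⊆tail x∈σ)
      size : ∀ m → ∣ M ∣ ≡ m → m ≤ s → ∑ₛ (λ σ → ι (large σ ∧ (true ∧ σ ⊆ᵇ tail s g))) ≤ℚ κ (2 ℕ.^ s) * κ m
      size zero ∣M∣≡0 _ = ℚP.≤-trans (∑≤0 (allSubsets n) (λ σ → ι≤0 (λ h → let 2≤ , σ⊆M = sub {true} σ h in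
          ℕP.<⇒≱ (ℕP.≤-trans (s≤s z≤n) 2≤) (ℕP.≤-trans (SP.p⊆q⇒∣p∣≤∣q∣ σ⊆M) (ℕP.≤-reflexive ∣M∣≡0))))) (0≤* (0≤κ (2 ℕ.^ s)) (0≤κ 0))
      size (suc m) ∣M∣≡ m≤s = ℚP.≤-trans (∑-mono (allSubsets n) (λ σ → ι-mono {large σ ∧ (true ∧ σ ⊆ᵇ tail s g)} (λ h → true-dec (σ ⊆? M) (proj₂ (sub {true} σ h)))))
        (ℚP.≤-trans (∑-powerset M) (ℚP.≤-trans (κ-mono (ℕP.≤-trans (ℕP.≤-reflexive (cong (2 ℕ.^_) ∣M∣≡)) (ℕP.≤-trans (ℕP.^-monoʳ-≤ 2 m≤s) (ℕP.m≤m*n (2 ℕ.^ s) (suc m)))))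
          (ℚP.≤-reflexive (κ-* (2 ℕ.^ s) (suc m)))))
      go : ∀ q → Q s g ≡ q → ∑ₛ (λ σ → ι (large σ ∧ (q ∧ σ ⊆ᵇ tail s g))) ≤ℚ ι q * (κ (2 ℕ.^ s) * κ ∣ M ∣)
      go true Qg = ℚP.≤-trans (size ∣ M ∣ refl (ℕP.≤-trans (SP.∣p∩q∣≤∣q∣ N (tail s g)) (ℕP.≤-reflexive (∣tail∣≡s Qg)))) (ℚP.≤-reflexive (sym (ℚP.*-identityˡ _)))
      go false _ = ℚP.≤-trans (∑≤0 (allSubsets n) (λ σ → ι≤0 (λ h → absurd (proj₂ (∧-true {large σ} h))))) (ℚP.≤-reflexive (sym (ℚP.*-zeroˡ (κ (2 ℕ.^ s) * κ ∣ M ∣))))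
        where
        absurd : ¬ (false ≡ true)
        absurd ()

    0<2^s : 0ℚ < κ (2 ℕ.^ s)
    0<2^s = 0<κ (1≤2^ s)
      where open Codegrees G τ ζ β 0<τ using (1≤2^)

    -- By the choice of `θ`, a saturated σ has degree in Pₛ at least 2^s τ times its degree in Pₛ₊₁.
    -- Summed over σ, a member of Pₛ is counted at most 2^s times the number of its vertices in N,
    -- and 2^s cancels.
    larges≤ : τ * ∑ₛ (λ σ → ι (large σ) * cnt Q (suc s) σ) ≤ℚ ∑ₛ (λ g → ι (Q s g) * onTail N g)
    larges≤ = *-cancelˡ 0<2^s (ℚP.≤-trans (ℚP.≤-reflexive (trans (sym (ℚP.*-assoc (κ (2 ℕ.^ s)) τ _))
        (sym (∑-*ˡ (allSubsets n) (κ (2 ℕ.^ s) * τ) (λ σ → ι (large σ) * cnt Q (suc s) σ)))))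
      (ℚP.≤-trans (∑-mono (allSubsets n) term) (ℚP.≤-trans (ℚP.≤-reflexive (cnt-swap (allSubsets n) large (λ σ → σ) s))
        (ℚP.≤-trans (∑-mono (allSubsets n) large-on-tail) (ℚP.≤-reflexive (trans
          (∑-cong (allSubsets n) (λ g → solve 3 (λ q k o → q :* (k :* o) := k :* (q :* o)) refl (ι (Q s g)) (κ (2 ℕ.^ s)) (onTail N g)))
          (∑-*ˡ (allSubsets n) (κ (2 ℕ.^ s)) (λ g → ι (Q s g) * onTail N g))))))))
      where
      term : ∀ σ → κ (2 ℕ.^ s) * τ * (ι (large σ) * cnt Q (suc s) σ) ≤ℚ ι (large σ) * cnt Q s σ
      term σ = go (large?′ σ)
        where
        go : (d : Dec (Large σ)) → κ (2 ℕ.^ s) * τ * (ι (does d) * cnt Q (suc s) σ) ≤ℚ ι (does d) * cnt Q s σ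
        go (no _) = ℚP.≤-reflexive (solve 3 (λ k c e → k :* (con 0ℚ :* c) := con 0ℚ :* e) refl (κ (2 ℕ.^ s) * τ) (cnt Q (suc s) σ) (cnt Q s σ))
        go (yes (2≤ , θ≤ , _)) = ℚP.≤-trans (ℚP.≤-reflexive (solve 2 (λ k c → k :* (con 1ℚ :* c) := con 1ℚ :* (k :* c)) refl (κ (2 ℕ.^ s) * τ) (cnt Q (suc s) σ)))
          (*-monoˡ 0≤1 (ℚP.≤-trans (*-monoˡ (0≤weight s) (cnt≤lin b n t (suc s) eq′ σ 2≤))
            (ℚP.≤-trans (ℚP.≤-reflexive (sym (trans (θ-large s 2≤) (cong (λ a → κ (2 ℕ.^ s) * τ * lin a ∣ σ ∣ (D σ)) (trans (cong (_∸ suc s) (sym eq′)) (ℕP.m+n∸m≡n (suc s) t)))))) θ≤)))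

    -- onTail P g + onTail N g is what the member tail s g of Pₛ pays.
    charge : ∀ g → ι (Q s g) * onTail P g + ι (Q s g) * onTail N g ≤ℚ κ s * ι (Q s g ∧ tail s g ⊆ᵇ U) + κ (s ∸ 1) * ι (Q s g ∧ not (tail s g ⊆ᵇ U))
    charge g = ℚP.≤-trans (ℚP.≤-reflexive (sym (ℚP.*-distribˡ-+ (ι (Q s g)) (onTail P g) (onTail N g))))
      (ℚP.≤-trans (*-monoˡ (0≤ι (Q s g)) both≤) (go (Q s g) refl (tail s g ⊆? U)))
      where
      0≤RHS : ∀ x y → 0ℚ ≤ℚ κ s * ι x + κ (s ∸ 1) * ι y
      0≤RHS x y = 0≤+ (0≤* (0≤κ s) (0≤ι x)) (0≤* (0≤κ (s ∸ 1)) (0≤ι y))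
      both≤ : onTail P g + onTail N g ≤ℚ κ ∣ U ∩ tail s g ∣
      both≤ = ℚP.≤-trans (ℚP.≤-reflexive (sym (∑-+ (allFin n) (λ v → ι (v ∈ᵇ P ∧ v ∈ᵇ tail s g)) (λ v → ι (v ∈ᵇ N ∧ v ∈ᵇ tail s g)))))
          (ℚP.≤-trans (∑-mono (allFin n) term) (ℚP.≤-reflexive (onTail-card U g)))
        where
        term : ∀ v → ι (v ∈ᵇ P ∧ v ∈ᵇ tail s g) + ι (v ∈ᵇ N ∧ v ∈ᵇ tail s g) ≤ℚ ι (v ∈ᵇ U ∧ v ∈ᵇ tail s g)
        term v = cases (v ∈? P) (v ∈? N)
          where
          within : ∀ c → v ∈ U → ι c ≤ℚ ι (v ∈ᵇ U ∧ c)
          within c v∈U = ι-mono {c} (true-∧ (true-dec (v ∈? U) v∈U))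
          cases : (p : Dec (v ∈ P)) (q : Dec (v ∈ N)) → ι (does p ∧ v ∈ᵇ tail s g) + ι (does q ∧ v ∈ᵇ tail s g) ≤ℚ ι (v ∈ᵇ U ∧ v ∈ᵇ tail s g)
          cases (yes v∈P) (yes v∈N) = ⊥-elim (proj₂ (N⁻ v∈N) (proj₂ (P⁻ v∈P)))
          cases (yes v∈P) (no _) = ℚP.≤-trans (ℚP.≤-reflexive (ℚP.+-identityʳ _)) (within _ (proj₁ (P⁻ v∈P)))
          cases (no _) (yes v∈N) = ℚP.≤-trans (ℚP.≤-reflexive (ℚP.+-identityˡ _)) (within _ (proj₁ (N⁻ v∈N)))
          cases (no _) (no _) = ℚP.≤-trans (ℚP.≤-reflexive (ℚP.+-identityˡ 0ℚ)) (0≤ι (v ∈ᵇ U ∧ v ∈ᵇ tail s g))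
      go : ∀ q → Q s g ≡ q → (d : Dec (tail s g ⊆ U)) → ι q * κ ∣ U ∩ tail s g ∣ ≤ℚ κ s * ι (q ∧ does d) + κ (s ∸ 1) * ι (q ∧ not (does d))
      go false _ d = ℚP.≤-trans (ℚP.≤-reflexive (ℚP.*-zeroˡ (κ ∣ U ∩ tail s g ∣))) (0≤RHS false false)
      go true Qg (yes _) = ℚP.≤-trans (*-monoˡ 0≤1 (κ-mono (ℕP.≤-trans (SP.∣p∩q∣≤∣q∣ U (tail s g)) (ℕP.≤-reflexive (∣tail∣≡s Qg)))))
        (ℚP.≤-reflexive (solve 2 (λ s z → con 1ℚ :* s := s :* con 1ℚ :+ z :* con 0ℚ) refl (κ s) (κ (s ∸ 1))))
      go true Qg (no tail⊈U) with outside-vertex tail⊈U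
      ... | v , v∈ , v∉U = ℚP.≤-trans (*-monoˡ 0≤1 (κ-mono (ℕP.<⇒≤pred (ℕP.≤-trans (SP.p⊂q⇒∣p∣<∣q∣ (SP.p∩q⊆q U (tail s g) , v , v∈ , λ v∈∩ → v∉U (proj₁ (SP.x∈p∩q⁻ U (tail s g) v∈∩)))) (ℕP.≤-reflexive (∣tail∣≡s Qg))))))
        (ℚP.≤-reflexive (solve 2 (λ s z → con 1ℚ :* z := s :* con 0ℚ :+ z :* con 1ℚ) refl (κ s) (κ (s ∸ 1))))

    badSum≤ : τ * badSum s ≤ℚ κ s * inner s + κ (s ∸ 1) * outer s + τ * over-in t
    badSum≤ = ℚP.≤-trans (*-monoˡ 0≤τ bad≤) (ℚP.≤-trans (ℚP.≤-reflexive (ℚP.*-distribˡ-+ τ _ _))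
      (ℚP.≤-trans (ℚP.+-mono-≤ vertices≤ larges≤) (ℚP.≤-trans (ℚP.≤-reflexive
          (trans (solve 3 (λ a o c → (a :+ o) :+ c := (a :+ c) :+ o) refl (∑ₛ (λ g → ι (Q s g) * onTail P g)) (τ * over-in t) (∑ₛ (λ g → ι (Q s g) * onTail N g)))
            (cong (_+ τ * over-in t) (sym (∑-+ (allSubsets n) (λ g → ι (Q s g) * onTail P g) (λ g → ι (Q s g) * onTail N g))))))
        (ℚP.+-monoˡ-≤ (τ * over-in t) (ℚP.≤-trans (∑-mono (allSubsets n) charge) (ℚP.≤-reflexive
          (trans (∑-+ (allSubsets n) (λ g → κ s * ι (Q s g ∧ tail s g ⊆ᵇ U)) (λ g → κ (s ∸ 1) * ι (Q s g ∧ not (tail s g ⊆ᵇ U))))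
            (cong₂ _+_ (∑-*ˡ (allSubsets n) (κ s) (λ g → ι (Q s g ∧ tail s g ⊆ᵇ U))) (∑-*ˡ (allSubsets n) (κ (s ∸ 1)) (λ g → ι (Q s g ∧ not (tail s g ⊆ᵇ U))))))))))))

  2ℚ 3ℚ : ℚ
  2ℚ = 1ℚ + 1ℚ
  3ℚ = 2ℚ + 1ℚ

  κ2 : κ 2 ≡ 2ℚ
  κ2 = trans (κ-+ 1 1) (cong₂ _+_ κ-1 κ-1)

  0≤2 : 0ℚ ≤ℚ 2ℚ
  0≤2 = 0≤+ 0≤1 0≤1

  0≤3 : 0ℚ ≤ℚ 3ℚ
  0≤3 = 0≤+ 0≤2 0≤1

  0≤over-out : ∀ t → 0ℚ ≤ℚ over-out t
  0≤over-out t = 0≤∑ (allFin n) (λ v → 0≤* (0≤ι (not (v ∈ᵇ U))) (0≤over t v))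

  0≤over-in : ∀ t → 0ℚ ≤ℚ over-in t
  0≤over-in t = 0≤∑ (allFin n) (λ v → 0≤* (0≤ι (v ∈ᵇ U)) (0≤over t v))

  -- The recursion over the levels.

  module Recursion
    (small : ∀ {v} → v ∈ U → ∀ s → suc s ℕ.< r → fsize (R (toℕ v)) (suc s) (toℕ v) ≤ℚ ζ * τ ^ℚ (r ∸ suc (suc s)) * w v)
    (light : ∀ {v} → v ∈ U → ¬ (θ 1 ⁅ v ⁆ ≤ℚ cnt (R (toℕ v)) 1 ⁅ v ⁆)) where

    freeSum≤ : ∀ s t → suc s ℕ.+ suc t ≡ r → ∑ᵥ (λ v → ι (v ∈ᵇ U) * fsize (R (toℕ v)) (suc s) (toℕ v)) ≤ℚ ζ * (τ ^ℚ t * W)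
    freeSum≤ s t eq = ℚP.≤-trans (∑-mono (allFin n) term) (ℚP.≤-reflexive
        (trans (∑-*ˡ (allFin n) (ζ * τ ^ℚ t) w) (trans (cong (ζ * τ ^ℚ t *_) (sym W≡∑)) (ℚP.*-assoc ζ (τ ^ℚ t) W))))
      where
      1+s<r : suc s ℕ.< r
      1+s<r = ℕP.≤-trans (ℕP.m<m+n (suc s) (s≤s z≤n)) (ℕP.≤-reflexive eq)
      t≡ : r ∸ suc (suc s) ≡ t
      t≡ = trans (cong (_∸ suc (suc s)) (sym (trans (sym (ℕP.+-suc (suc s) t)) eq))) (ℕP.m+n∸m≡n (suc (suc s)) t)
      term : ∀ v → ι (v ∈ᵇ U) * fsize (R (toℕ v)) (suc s) (toℕ v) ≤ℚ ζ * τ ^ℚ t * w v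
      term v = go (v ∈? U)
        where
        go : (d : Dec (v ∈ U)) → ι (does d) * fsize (R (toℕ v)) (suc s) (toℕ v) ≤ℚ ζ * τ ^ℚ t * w v
        go (no _) = ℚP.≤-trans (ℚP.≤-reflexive (ℚP.*-zeroˡ (fsize (R (toℕ v)) (suc s) (toℕ v)))) (0≤* (0≤* 0≤ζ (0≤τ^ t)) (0≤w v))
        go (yes v∈U) = ℚP.≤-trans (ℚP.≤-reflexive (ℚP.*-identityˡ (fsize (R (toℕ v)) (suc s) (toℕ v))))
          (ℚP.≤-trans (small v∈U s 1+s<r) (ℚP.≤-reflexive (cong (λ m → ζ * τ ^ℚ m * w v) t≡)))

    -- At level 1 the tail is a single vertex u, later than `pos 1 g`. If it was blocked, then u was
    -- saturated in P₁ when it was read, against `light`.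
    badSum₁≤0 : badSum 1 ≤ℚ 0ℚ
    badSum₁≤0 = ∑≤0 (allSubsets n) (λ g → ι≤0 (none g))
      where
      none : ∀ g → ¬ (bad 1 g ≡ true)
      none g h with ∧-true {Q 2 g ∧ tail 2 g ⊆ᵇ U} h
      ... | h₁ , bl with ∧-true {Q 2 g} h₁ | dec-true (blocked? (R (pos 1 g)) 1 (tail 1 g)) bl
      ...   | Qg , sub | σ , (u , u∈σ) , σ⊆ , θ≤ = light (dec-true (tail 2 g ⊆? U) sub (tail-suc-⊆ 1 g (σ⊆ u∈σ)))
          (ℚP.≤-trans (subst (λ σ → θ 1 σ ≤ℚ cnt (R (pos 1 g)) 1 σ) σ≡ θ≤)
            (cnt-mono b 1 ⁅ u ⁆ (ℕP.<⇒≤ (pos<tail 1 g (s<card g Qg) (σ⊆ u∈σ)))))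
        where
        ∣tail∣≡1 : ∣ tail 1 g ∣ ≡ 1
        ∣tail∣≡1 = ∣tail∣ 1 g (ℕP.<⇒≤ (s<card g Qg))
        σ≡ : σ ≡ ⁅ u ⁆
        σ≡ = SP.⊆-antisym (λ x∈σ → subst (_∈ ⁅ u ⁆) (singleton-unique ∣tail∣≡1 (σ⊆ u∈σ) (σ⊆ x∈σ)) (SP.x∈⁅x⁆ u)) (⁅⁆⊆ u∈σ)

    2∑over≤ : ∀ s t → suc (suc s) ℕ.+ t ≡ r → 2ℚ * (over-in t + over-out t) ≤ℚ ζ * (τ ^ℚ t * W)
    2∑over≤ s t eq = ℚP.≤-trans (ℚP.≤-reflexive (cong₂ _*_ (sym κ2) (over-in+out t)))
      (ℚP.≤-trans (2∑over≤ζ s t eq) (ℚP.≤-reflexive (ℚP.*-comm (τ ^ℚ t * W) ζ)))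

    -- The affine correction 3ζτᵗW turns the recursion into pure multiplication by s.
    level-bound : ∀ m t → suc (suc m) ℕ.+ t ≡ r →
      2ℚ * (inner (suc (suc m)) + bound-out t) + 3ℚ * (ζ * (τ ^ℚ t * W)) ≤ℚ 2ℚ * κ (suc m !) * (τ ^ℚ t * (ε + 3ℚ * (ζ * W)))
    -- The multiples of Z are 2 from `inner 2`, 1 from the doubled overshoots and 3 from the
    -- correction: 6 = 2 · 3, which fixes the 3 on the right.
    level-bound zero t eq = ℚP.≤-trans
        (ℚP.+-monoˡ-≤ (3ℚ * Z) (*-monoˡ 0≤2 (ℚP.+-monoˡ-≤ (bound-out t) inner₂≤)))
        (ℚP.≤-trans (ℚP.≤-reflexive (solve 4 (λ Z p e o → con 2ℚ :* (Z :+ (p :* e :+ o)) :+ con 3ℚ :* Z := con 2ℚ :* (p :* e) :+ con 2ℚ :* o :+ (con 2ℚ :+ con 3ℚ) :* Z) refl Z (τ ^ℚ t) ε (over-out t)))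
          (ℚP.≤-trans (ℚP.+-monoˡ-≤ ((2ℚ + 3ℚ) * Z) (ℚP.+-monoʳ-≤ (2ℚ * (τ ^ℚ t * ε)) (ℚP.≤-trans (*-monoˡ 0≤2 (≤-+ˡ (0≤over-in t))) (2∑over≤ 0 t eq))))
            (ℚP.≤-reflexive (trans (solve 4 (λ z p e W → con 2ℚ :* (p :* e) :+ z :* (p :* W) :+ (con 2ℚ :+ con 3ℚ) :* (z :* (p :* W)) := (con 2ℚ :* con 1ℚ) :* (p :* (e :+ con 3ℚ :* (z :* W)))) refl ζ (τ ^ℚ t) ε W)
              (cong (λ k → 2ℚ * k * (τ ^ℚ t * (ε + 3ℚ * (ζ * W)))) (sym κ-1))))))
      where
      Z : ℚ
      Z = ζ * (τ ^ℚ t * W)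
      inner₂≤ : inner 2 ≤ℚ Z
      inner₂≤ = ℚP.≤-trans (inner-split 1 2≤r) (ℚP.≤-trans (ℚP.+-mono-≤ (freeSum≤ 0 t eq) badSum₁≤0) (ℚP.≤-reflexive (ℚP.+-identityʳ Z)))
    level-bound (suc m) t eq = *-cancelˡ 0<τ (ℚP.≤-trans (ℚP.≤-reflexive
        (solve 4 (λ T i B Z → T :* (con 2ℚ :* (i :+ B) :+ con 3ℚ :* Z) := con 2ℚ :* (T :* i) :+ (con 2ℚ :* (T :* B) :+ con 3ℚ :* (T :* Z))) refl τ i′ (bound-out t) Z))
      (ℚP.≤-trans (ℚP.+-monoˡ-≤ rest (*-monoˡ 0≤2 τi′≤))
      (ℚP.≤-trans (ℚP.≤-reflexive regroup)
      (ℚP.≤-trans (ℚP.+-mono-≤ (*-monoˡ (0≤* 0≤2 (0≤κ (suc m))) (outer≤ s (suc t) eq″)) (ℚP.+-mono-≤ (*-monoˡ 0≤τ (2∑over≤ (suc m) t eq)) (ℚP.≤-refl {2ℚ * (k * i) + (2ℚ * (τ * (p * ε)) + (2ℚ + 3ℚ) * (τ * Z))})))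
      (ℚP.≤-trans collect
      (ℚP.≤-trans (*-monoˡ (0≤κ s) (level-bound m (suc t) eq″)) (ℚP.≤-reflexive final)))))))
      where
      s = suc (suc m)
      k k₁ p Z i i′ B′ rest : ℚ
      k = κ s
      k₁ = κ (suc m)
      p = τ ^ℚ t
      Z = ζ * (p * W)
      i = inner s
      i′ = inner (suc s)
      B′ = bound-out (suc t)
      rest = 2ℚ * (τ * bound-out t) + 3ℚ * (τ * Z)
      eq″ : s ℕ.+ suc t ≡ r
      eq″ = trans (ℕP.+-suc s t) eq
      s<r : s ℕ.< r
      s<r = ℕP.≤-trans (ℕP.m<m+n s (s≤s z≤n)) (ℕP.≤-reflexive eq″)
      k≡ : k ≡ 1ℚ + k₁
      k≡ = trans (κ-+ 1 (suc m)) (cong (_+ k₁) κ-1)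
      2≤k : 2ℚ ≤ℚ k
      2≤k = ℚP.≤-trans (ℚP.≤-reflexive (sym κ2)) (κ-mono (s≤s (s≤s z≤n)))
      open Charge s t eq″ (s≤s z≤n) using (badSum≤)
      τi′≤ : τ * i′ ≤ℚ τ * Z + (k * i + k₁ * outer s + τ * over-in t)
      τi′≤ = ℚP.≤-trans (*-monoˡ 0≤τ (ℚP.≤-trans (inner-split s s<r) (ℚP.+-monoˡ-≤ (badSum s) (freeSum≤ (suc m) t eq″))))
        (ℚP.≤-trans (ℚP.≤-reflexive (ℚP.*-distribˡ-+ τ Z (badSum s))) (ℚP.+-monoʳ-≤ (τ * Z) badSum≤))
      regroup : 2ℚ * (τ * Z + (k * i + k₁ * outer s + τ * over-in t)) + rest
        ≡ 2ℚ * k₁ * outer s + (τ * (2ℚ * (over-in t + over-out t)) + (2ℚ * (k * i) + (2ℚ * (τ * (p * ε)) + (2ℚ + 3ℚ) * (τ * Z))))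
      regroup = solve 8 (λ T Z ki k₁ o oi pe oo → con 2ℚ :* (T :* Z :+ (ki :+ k₁ :* o :+ T :* oi)) :+ (con 2ℚ :* (T :* (pe :+ oo)) :+ con 3ℚ :* (T :* Z))
        := (con 2ℚ :* k₁) :* o :+ (T :* (con 2ℚ :* (oi :+ oo)) :+ (con 2ℚ :* ki :+ (con 2ℚ :* (T :* pe) :+ (con 2ℚ :+ con 3ℚ) :* (T :* Z))))) refl
        τ Z (k * i) k₁ (outer s) (over-in t) (p * ε) (over-out t)
      -- The s - 1 copies of `B′` from the charges and one more that absorbs τ p ε make s copies.
      -- The constant 6 τZ is at most s · 3 τZ because s ≥ 2.
      collect : 2ℚ * k₁ * B′ + (τ * Z + (2ℚ * (k * i) + (2ℚ * (τ * (p * ε)) + (2ℚ + 3ℚ) * (τ * Z))))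
        ≤ℚ k * (2ℚ * (i + B′) + 3ℚ * (ζ * (τ * p * W)))
      collect = ℚP.≤-trans (ℚP.≤-reflexive (solve 5 (λ kB Z ki T pe → (kB :+ (T :* Z :+ (con 2ℚ :* ki :+ (con 2ℚ :* (T :* pe) :+ (con 2ℚ :+ con 3ℚ) :* (T :* Z)))))
            := con 2ℚ :* (T :* pe) :+ (kB :+ con 2ℚ :* ki :+ con 2ℚ :* (con 3ℚ :* (T :* Z)))) refl (2ℚ * k₁ * B′) Z (k * i) τ (p * ε)))
        (ℚP.≤-trans (ℚP.+-mono-≤ (*-monoˡ 0≤2 (ℚP.≤-trans (ℚP.≤-reflexive (sym (ℚP.*-assoc τ p ε))) (≤-+ʳ (0≤over-out (suc t)))))
            (ℚP.+-monoʳ-≤ (2ℚ * k₁ * B′ + 2ℚ * (k * i)) (*-monoʳ (0≤* 0≤3 (0≤* 0≤τ (0≤* 0≤ζ (0≤* (0≤τ^ t) 0≤W)))) 2≤k)))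
          (ℚP.≤-reflexive (trans (cong (λ x → 2ℚ * B′ + (2ℚ * k₁ * B′ + 2ℚ * (x * i) + x * (3ℚ * (τ * Z)))) k≡)
            (trans (solve 7 (λ B k₁ i T z p W → con 2ℚ :* B :+ ((con 2ℚ :* k₁) :* B :+ con 2ℚ :* ((con 1ℚ :+ k₁) :* i) :+ (con 1ℚ :+ k₁) :* (con 3ℚ :* (T :* (z :* (p :* W)))))
                := (con 1ℚ :+ k₁) :* (con 2ℚ :* (i :+ B) :+ con 3ℚ :* (z :* ((T :* p) :* W)))) refl B′ k₁ i τ ζ p W)
              (cong (_* (2ℚ * (i + B′) + 3ℚ * (ζ * (τ * p * W)))) (sym k≡))))))
      final : k * (2ℚ * κ (suc m !) * (τ * p * (ε + 3ℚ * (ζ * W)))) ≡ τ * (2ℚ * κ (s !) * (p * (ε + 3ℚ * (ζ * W))))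
      final = trans (solve 5 (λ k f T p x → k :* ((con 2ℚ :* f) :* ((T :* p) :* x)) := T :* ((con 2ℚ :* (k :* f)) :* (p :* x))) refl k (κ (suc m !)) τ p (ε + 3ℚ * (ζ * W)))
        (cong (λ f → τ * (2ℚ * f * (p * (ε + 3ℚ * (ζ * W))))) (sym (κ-* s (suc m !))))

    e≤ : κ (e G) ≤ℚ inner r + bound-out 0
    e≤ = ℚP.≤-trans (ℚP.≤-reflexive (count-∑ (edge G) (allSubsets n))) (ℚP.≤-trans (∑-mono (allSubsets n) term)
      (ℚP.≤-trans (ℚP.≤-reflexive (∑-+ (allSubsets n) (λ g → ι (Q r g ∧ tail r g ⊆ᵇ U)) (λ g → ι (Q r g ∧ not (tail r g ⊆ᵇ U)))))
        (ℚP.+-monoʳ-≤ (inner r) (outer≤ r 0 (ℕP.+-identityʳ r)))))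
      where
      term : ∀ g → ι (edge G g) ≤ℚ ι (Q r g ∧ tail r g ⊆ᵇ U) + ι (Q r g ∧ not (tail r g ⊆ᵇ U))
      term g = ι-∨ {edge G g} (λ eg → go (tail r g ⊆? U) (run-top b n eg))
        where
        go : (d : Dec (tail r g ⊆ U)) → Q r g ≡ true → Q r g ∧ does d ≡ true ⊎ Q r g ∧ not (does d) ≡ true
        go (yes _) Qg = inj₁ (true-∧ Qg refl)
        go (no _) Qg = inj₂ (true-∧ Qg refl)

    W≤ : W ≤ℚ κ (r !) * (ε + 3ℚ * (ζ * W))
    W≤ = go (r ∸ 2) (ℕP.m+[n∸m]≡n 2≤r)
      where
      Y : ℚ
      Y = ε + 3ℚ * (ζ * W)
      go : ∀ m → suc (suc m) ≡ r → W ≤ℚ κ (r !) * Y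
      go m eq = ℚP.≤-trans (ℚP.≤-reflexive W≡re) (ℚP.≤-trans (*-monoˡ (0≤κ r) e≤Y) (ℚP.≤-reflexive
          (trans (sym (ℚP.*-assoc (κ r) (κ (suc m !)) Y)) (cong (_* Y) (trans (sym (κ-* r (suc m !))) (cong κ fact))))))
        where
        fact : r ℕ.* suc m ! ≡ r !
        fact = subst (λ r → r ℕ.* suc m ! ≡ r !) eq refl
        0<2 : 0ℚ < 2ℚ
        0<2 = subst (0ℚ <_) κ2 (0<κ (s≤s z≤n))
        e≤Y : κ (e G) ≤ℚ κ (suc m !) * Y
        e≤Y = *-cancelˡ 0<2 (ℚP.≤-trans (*-monoˡ 0≤2 e≤) (ℚP.≤-trans (≤-+ʳ (0≤* 0≤3 (0≤* 0≤ζ (0≤* (0≤τ^ 0) 0≤W))))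
          (ℚP.≤-trans (subst (λ s → 2ℚ * (inner s + bound-out 0) + 3ℚ * (ζ * (τ ^ℚ 0 * W)) ≤ℚ 2ℚ * κ (suc m !) * (τ ^ℚ 0 * Y)) eq
              (level-bound m 0 (trans (ℕP.+-identityʳ (suc (suc m))) eq)))
            (ℚP.≤-reflexive (solve 2 (λ f y → (con 2ℚ :* f) :* (con 1ℚ :* y) := con 2ℚ :* (f :* y)) refl (κ (suc m !)) Y)))))

-- The containers and their measure.

-- For n = 0 the average degree takes the default value 0 of the division.
avgDeg>0⇒1≤n : ∀ {r n} (G : RGraph r n) → 0ℚ < avgDeg G → 1 ≤ n
avgDeg>0⇒1≤n {n = zero} G 0<d = ⊥-elim (ℚP.<-irrefl refl 0<d)
avgDeg>0⇒1≤n {n = suc n} G 0<d = s≤s z≤n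

module Containers {r n : ℕ} (2≤r : 2 ≤ r) (G : RGraph r n) (0<d : 0ℚ < avgDeg G) (τ ζ : ℚ)
    (0<τ : 0ℚ < τ) (0<ζ : 0ℚ < ζ) (δ≤ζ : δ G τ ≤ℚ ζ) where

  N avg β W K ρ : ℚ
  N = ℕ→ℚ n
  avg = avgDeg G
  β = ζ * avg
  W = N * avg
  K = ℕ→ℚ (2 ℕ.* r) * τ ÷' ζ
  ρ = 1ℚ ÷' ℕ→ℚ (r !)

  0≤ζ : 0ℚ ≤ℚ ζ
  0≤ζ = ℚP.<⇒≤ 0<ζ

  0<N : 0ℚ < N
  0<N = subst (0ℚ <_) (sym (κ-ℕ→ℚ n)) (0<κ (avgDeg>0⇒1≤n G 0<d))

  0<W : 0ℚ < W
  0<W = 0<* 0<N 0<d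

  W≡∑ : W ≡ ∑ᵥ (λ v → κ (deg G v))
  W≡∑ = trans (ℚP.*-comm N avg) (trans (÷'-* (ℕ→ℚ (totalDeg G)) 0<N) (trans (κ-ℕ→ℚ (totalDeg G)) (sumL-∑ (deg G) (allFin n))))

  K*ζ : K * ζ ≡ κ 2 * κ r * τ
  K*ζ = trans (÷'-* (ℕ→ℚ (2 ℕ.* r) * τ) 0<ζ) (cong (_* τ) (trans (κ-ℕ→ℚ (2 ℕ.* r)) (κ-* 2 r)))

  0≤K : 0ℚ ≤ℚ K
  0≤K = 0≤÷' (0≤* (subst (0ℚ ≤ℚ_) (sym (κ-ℕ→ℚ (2 ℕ.* r))) (0≤κ (2 ℕ.* r))) (ℚP.<⇒≤ 0<τ)) 0≤ζ

  1≤r! : 1 ≤ r !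
  1≤r! = ℕP.1≤n! r

  0<r! : 0ℚ < ℕ→ℚ (r !)
  0<r! = subst (0ℚ <_) (sym (κ-ℕ→ℚ (r !))) (0<κ 1≤r!)

  0≤ρ : 0ℚ ≤ℚ ρ
  0≤ρ = 0≤÷' 0≤1 (ℚP.<⇒≤ 0<r!)

  ρ≤1 : ρ ≤ℚ 1ℚ
  ρ≤1 = ÷'≤ 0<r! (subst₂ _≤ℚ_ κ-1 (trans (sym (κ-ℕ→ℚ (r !))) (sym (ℚP.*-identityˡ (ℕ→ℚ (r !))))) (κ-mono 1≤r!))

  μ≤ : ∀ {S x} → wt G S ≤ℚ x * W → μ G S ≤ℚ x
  μ≤ {S} {x} wt≤ = ÷'≤ 0<W (ℚP.≤-trans (ℚP.≤-reflexive (trans (κ-ℕ→ℚ _)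
      (trans (sumL-∑ (λ u → if u ∈ᵇ S then deg G u else 0) (allFin n)) (∑-cong (allFin n) (λ u → weight (u ∈ᵇ S) (deg G u)))))) wt≤)
    where
    weight : ∀ c m → κ (if c then m else 0) ≡ ι c * κ m
    weight true m = sym (ℚP.*-identityˡ (κ m))
    weight false m = trans κ-0 (sym (ℚP.*-zeroˡ (κ m)))

  bound : ℚ
  bound = 1ℚ - ρ + ℕ→ℚ 4 * ζ + K

  wt≤W : ∀ S → wt G S ≤ℚ W
  wt≤W S = ℚP.≤-trans (∑-mono (allFin n) (λ v → ℚP.≤-trans (*-monoʳ (0≤κ (deg G v)) (ι≤1 (v ∈ᵇ S))) (ℚP.≤-reflexive (ℚP.*-identityˡ (κ (deg G v))))))
    (ℚP.≤-reflexive (sym W≡∑))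

  Good : (Subset n → Subset n) → Subset n → Set
  Good C I = Σ (Subset n) λ A → A ⊆ I × I ⊆ C A × μ G A ≤ℚ K
    × ℕ→ℚ ∣ A ∣ ≤ℚ ℕ→ℚ (2 ℕ.* r) * τ * ℕ→ℚ n ÷' (ζ * ζ) × μ G (C A) ≤ℚ bound

  Thin : Subset n → Set
  Thin I = Independent G I
    ⊎ InducedDegenerate G I (floor ((τ ^ℚ (r ∸ 1)) * ζ * ℕ→ℚ (e G) ÷' ℕ→ℚ n))
    ⊎ ℕ→ℚ (eInduced G I) ≤ℚ ℕ→ℚ (2 ℕ.* r) * (τ ^ℚ r) * ℕ→ℚ (e G) ÷' ζ

  Online : (Subset n → Subset n) → Set
  Online C = (A : Subset n) (w : ℕ) → 1 ≤ w → w ≤ n → C A ∩ prefix n w ≡ C (A ∩ prefix n w) ∩ prefix n w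

  -- For ζ ≥ 1 the bound on the containers exceeds 1 and the whole vertex set will do.
  trivial : 1ℚ ≤ℚ ζ → ∀ I → Good (λ _ → ⊤) I
  trivial 1≤ζ I = ⊥ , SP.⊥⊆ , SP.⊆⊤ , μ≤ {⊥} (ℚP.≤-trans wt⊥≤0 (0≤* 0≤K (ℚP.<⇒≤ 0<W)))
    , ℚP.≤-trans (ℚP.≤-reflexive (trans (κ-ℕ→ℚ ∣ ⊥ {n} ∣) (trans (cong κ (SP.∣⊥∣≡0 n)) κ-0)))
        (0≤÷' (0≤* (0≤* (subst (0ℚ ≤ℚ_) (sym (κ-ℕ→ℚ (2 ℕ.* r))) (0≤κ (2 ℕ.* r))) (ℚP.<⇒≤ 0<τ)) (ℚP.<⇒≤ 0<N)) (0≤* 0≤ζ 0≤ζ))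
    , μ≤ {⊤} (ℚP.≤-trans (wt≤W ⊤) (ℚP.≤-trans (ℚP.≤-reflexive (sym (ℚP.*-identityˡ W))) (*-monoʳ (ℚP.<⇒≤ 0<W) 1≤bound)))
    where
    wt⊥≤0 : wt G ⊥ ≤ℚ 0ℚ
    wt⊥≤0 = ∑≤0 (allFin n) (λ v → ℚP.≤-reflexive (trans (cong (λ c → ι c * κ (deg G v)) (false-dec (v ∈? ⊥) SP.∉⊥)) (ℚP.*-zeroˡ (κ (deg G v)))))
    1≤bound : 1ℚ ≤ℚ bound
    -- One of the four ζ pays for ρ, since ρ ≤ 1 ≤ ζ.
    1≤bound = +-cancelˡ ρ (ℚP.≤-trans (ℚP.+-monoˡ-≤ 1ℚ (ℚP.≤-trans ρ≤1 1≤ζ))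
      (ℚP.≤-trans (≤-+ʳ (0≤+ (0≤* (0≤+ (0≤+ 0≤1 0≤1) 0≤1) 0≤ζ) 0≤K))
        (ℚP.≤-reflexive (solve 3 (λ z K ρ → z :+ con 1ℚ :+ ((con 1ℚ :+ con 1ℚ :+ con 1ℚ) :* z :+ K) := ρ :+ (con 1ℚ :- ρ :+ con (ℕ→ℚ 4) :* z :+ K)) refl ζ K ρ))))

  module Small (ζ≤1 : ζ ≤ℚ 1ℚ) where

    open Codegrees G τ ζ β 0<τ using (module Bound)
    open Bound 2≤r 0<d (avgDeg>0⇒1≤n G 0<d) δ≤ζ using (∑over≤ζ; 2∑over≤ζ)
    open Weights G τ ζ β W 0<τ 0<ζ ζ≤1 2≤r 0<W W≡∑ (∑over≤ζ 0≤ζ) (2∑over≤ζ 0≤ζ) hiding (0≤ζ)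

    module _ (I : Subset n) where

      A : Subset n
      A = fingerprint I

      open Run A

      selected : ∀ {v} → v ∈ A → Selected (R (toℕ v)) v
      selected {v} v∈A = subst (λ S → Selected S v) (sym (run-prune I (toℕ v))) (proj₂ (fingerprint⁻ v∈A))

      A⊆I : A ⊆ I
      A⊆I v∈A = proj₁ (fingerprint⁻ v∈A)

      eA : ℚ
      eA = κ (eInduced G A)

      few-independent : Independent G I → eA * ζ ≤ℚ κ 2 * (τ ^ℚ r * W)
      few-independent ind = ℚP.≤-trans (*-monoʳ 0≤ζ (ℚP.≤-trans (ℚP.≤-reflexive (count-∑ _ (allSubsets n))) (∑≤0 (allSubsets n) (λ f → ι≤0 (none f)))))
        (ℚP.≤-trans (ℚP.≤-reflexive (ℚP.*-zeroˡ ζ)) (0≤* (0≤κ 2) (0≤* (0≤τ^ r) (ℚP.<⇒≤ 0<W))))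
        where
        none : ∀ f → ¬ (edge G f ∧ f ⊆ᵇ A ≡ true)
        none f h = ind f (proj₁ (∧-true h)) (SP.⊆-trans (dec-true (f ⊆? A) (proj₂ (∧-true {edge G f} h))) A⊆I)

      few-sparse : ℕ→ℚ (eInduced G I) ≤ℚ ℕ→ℚ (2 ℕ.* r) * (τ ^ℚ r) * ℕ→ℚ (e G) ÷' ζ → eA * ζ ≤ℚ κ 2 * (τ ^ℚ r * W)
      few-sparse few = ℚP.≤-trans (*-monoʳ 0≤ζ (ℚP.≤-trans (eInduced-mono G A⊆I) (subst (_≤ℚ X ÷' ζ) (κ-ℕ→ℚ (eInduced G I)) few)))
        (ℚP.≤-reflexive (trans (÷'-* X 0<ζ) (trans (cong₂ (λ a c → a * τ ^ℚ r * c) (trans (κ-ℕ→ℚ (2 ℕ.* r)) (κ-* 2 r)) (κ-ℕ→ℚ (e G)))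
          (trans (solve 4 (λ a r p e → (a :* r) :* p :* e := a :* (p :* (r :* e))) refl (κ 2) (κ r) (τ ^ℚ r) (κ (e G))) (cong (λ x → κ 2 * (τ ^ℚ r * x)) (sym W≡re))))))
        where
        X : ℚ
        X = ℕ→ℚ (2 ℕ.* r) * (τ ^ℚ r) * ℕ→ℚ (e G)

      -- The identity r e(G) = nd turns r times τ^(r-1) ζ e(G)|A|/n into τ^(r-1) ζd|A|, and selected
      -- vertices have degree at least ζd.
      few-degenerate : InducedDegenerate G I (floor ((τ ^ℚ (r ∸ 1)) * ζ * ℕ→ℚ (e G) ÷' ℕ→ℚ n)) → κ r * eA ≤ℚ τ ^ℚ (r ∸ 1) * wt G A
      few-degenerate dg = *-cancelˡ 0<N (ℚP.≤-trans (*-monoˡ (ℚP.<⇒≤ 0<N) (*-monoˡ (0≤κ r)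
          (ℚP.≤-trans (degenerate-edges G (ℕP.<⇒≤ 2≤r) dg A⊆I) (*-monoʳ (0≤κ ∣ A ∣) (floor≤ Y)))))
        (ℚP.≤-trans (ℚP.≤-reflexive regroup) (*-monoˡ (ℚP.<⇒≤ 0<N) (*-monoˡ (0≤τ^ (r ∸ 1)) (β∣A∣≤wt selected)))))
        where
        p X Y : ℚ
        p = τ ^ℚ (r ∸ 1)
        X = p * ζ * ℕ→ℚ (e G)
        Y = X ÷' N
        regroup : N * (κ r * (Y * κ ∣ A ∣)) ≡ N * (p * (β * κ ∣ A ∣))
        regroup = trans (solve 4 (λ N r Y a → N :* (r :* (Y :* a)) := r :* (Y :* N) :* a) refl N (κ r) Y (κ ∣ A ∣))
          (trans (cong (λ x → κ r * x * κ ∣ A ∣) (trans (÷'-* X 0<N) (cong (p * ζ *_) (κ-ℕ→ℚ (e G)))))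
            (trans (solve 5 (λ r p z e a → r :* (p :* z :* e) :* a := p :* z :* (r :* e) :* a) refl (κ r) p ζ (κ (e G)) (κ ∣ A ∣))
              (trans (cong (λ x → p * ζ * x * κ ∣ A ∣) (sym W≡re))
                (solve 5 (λ p z N d a → p :* z :* (N :* d) :* a := N :* (p :* (z :* d :* a))) refl p ζ N avg (κ ∣ A ∣)))))

      heavy≤ : Thin I → ζ * heavySum ≤ℚ κ 2 * (τ * W)
      heavy≤ (inj₁ ind) = heavy-sparse selected (few-independent ind)
      heavy≤ (inj₂ (inj₁ dg)) = heavy-degenerate selected (few-degenerate dg)
      heavy≤ (inj₂ (inj₂ few)) = heavy-sparse selected (few-sparse few)

      Dense : Fin n → Set
      Dense v = v ∉ A × β ≤ℚ w v × ¬ Selected (R (toℕ v)) v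

      dense? : ∀ v → Dec (Dense v)
      dense? v = ¬? (v ∈? A) ×-dec ((β ℚP.≤? w v) ×-dec ¬? (selected? (R (toℕ v)) v))

      opaque
        U : Subset n
        U = tabulate (λ v → does (dense? v))

        U⁻ : ∀ {v} → v ∈ U → Dense v
        U⁻ {v} v∈ = dec-true (dense? v) (∈-tabulate⁻ v∈)

        U⁺ : ∀ {v} → Dense v → v ∈ U
        U⁺ {v} d = ∈-tabulate⁺ (true-dec (dense? v) d)

      open Sparse G τ ζ β W 0<τ 0<ζ ζ≤1 2≤r 0<W W≡∑ (∑over≤ζ 0≤ζ) (2∑over≤ζ 0≤ζ) (at A) U using (ε; 3ℚ; module Recursion)

      small : ∀ {v} → v ∈ U → ∀ s → suc s ℕ.< r → fsize (R (toℕ v)) (suc s) (toℕ v) ≤ℚ ζ * τ ^ℚ (r ∸ suc (suc s)) * w v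
      small {v} v∈U s 1+s<r = go (_ ℚP.≤? _)
        where
        s<r-1 : s ℕ.< r ∸ 1
        s<r-1 = ℕP.∸-monoˡ-≤ 1 1+s<r
        go : Dec (ζ * τ ^ℚ (r ∸ suc (suc s)) * w v ≤ℚ fsize (R (toℕ v)) (suc s) (toℕ v)) →
          fsize (R (toℕ v)) (suc s) (toℕ v) ≤ℚ ζ * τ ^ℚ (r ∸ suc (suc s)) * w v
        go (no ≰) = ℚP.<⇒≤ (ℚP.≰⇒> ≰)
        go (yes big) = ⊥-elim (proj₂ (proj₂ (U⁻ v∈U)) (proj₁ (proj₂ (U⁻ v∈U)) , inj₁ (F.fromℕ< s<r-1 ,
          subst (λ s → ζ * τ ^ℚ (r ∸ suc (suc s)) * w v ≤ℚ fsize (R (toℕ v)) (suc s) (toℕ v)) (sym (FP.toℕ-fromℕ< s<r-1)) big)))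

      light : ∀ {v} → v ∈ U → ¬ (θ 1 ⁅ v ⁆ ≤ℚ cnt (R (toℕ v)) 1 ⁅ v ⁆)
      light v∈U hv = proj₂ (proj₂ (U⁻ v∈U)) (proj₁ (proj₂ (U⁻ v∈U)) , inj₂ hv)

      open Recursion small light using (W≤)

      -- A vertex counted both in the container and outside U is in A or has degree at most `β`; the
      -- latter contribute at most nβ = ζW.
      container-weight : wt G (container A) + ε ≤ℚ W + wt G A + ζ * W
      container-weight = ℚP.≤-trans (ℚP.≤-reflexive (sym (∑-+ (allFin n) (λ v → ι (v ∈ᵇ container A) * w v) (λ v → ι (not (v ∈ᵇ U)) * w v))))
        (ℚP.≤-trans (∑-mono (allFin n) term) (ℚP.≤-reflexive (trans (∑-+ (allFin n) (λ v → w v + ι (v ∈ᵇ A) * w v) (λ _ → β))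
          (cong₂ _+_ (trans (∑-+ (allFin n) w (λ v → ι (v ∈ᵇ A) * w v)) (cong (_+ wt G A) (sym W≡∑)))
            (trans (∑ᵥ-const n β) (trans (cong (_* β) (sym (κ-ℕ→ℚ n))) (solve 3 (λ N z d → N :* (z :* d) := z :* (N :* d)) refl N ζ avg)))))))
        where
        0≤β : 0ℚ ≤ℚ β
        0≤β = 0≤* 0≤ζ (ℚP.<⇒≤ 0<d)
        term : ∀ v → ι (v ∈ᵇ container A) * w v + ι (not (v ∈ᵇ U)) * w v ≤ℚ w v + ι (v ∈ᵇ A) * w v + β
        term v = go (v ∈? A) (v ∈? U) (v ∈? container A) (w v ℚP.≤? β)
          where
          ι*≤ : ∀ c → ι c * w v ≤ℚ w v
          ι*≤ c = ℚP.≤-trans (*-monoʳ (0≤w v) (ι≤1 c)) (ℚP.≤-reflexive (ℚP.*-identityˡ (w v)))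
          go : (a : Dec (v ∈ A)) (u : Dec (v ∈ U)) (c : Dec (v ∈ container A)) → Dec (w v ≤ℚ β) →
            ι (does c) * w v + ι (not (does u)) * w v ≤ℚ w v + ι (does a) * w v + β
          go (yes _) u c _ = ℚP.≤-trans (ℚP.+-mono-≤ (ι*≤ (does c)) (ℚP.≤-trans (ι*≤ (not (does u))) (ℚP.≤-reflexive (sym (ℚP.*-identityˡ (w v)))))) (≤-+ʳ 0≤β)
          go (no _) (yes _) c _ = ℚP.≤-trans (ℚP.≤-reflexive (solve 2 (λ x w → x :+ con 0ℚ :* w := x) refl (ι (does c) * w v) (w v)))
            (ℚP.≤-trans (ι*≤ (does c)) (ℚP.≤-trans (≤-+ʳ (0≤* ℚP.≤-refl (0≤w v))) (≤-+ʳ 0≤β)))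
          go (no _) (no _) (no _) _ = ℚP.≤-trans (ℚP.≤-reflexive (solve 1 (λ w → con 0ℚ :* w :+ con 1ℚ :* w := w :+ con 0ℚ :* w) refl (w v))) (≤-+ʳ 0≤β)
          go (no _) (no _) (yes _) (yes w≤β) = ℚP.≤-trans (ℚP.≤-reflexive (solve 1 (λ w → con 1ℚ :* w :+ con 1ℚ :* w := w :+ con 0ℚ :* w :+ w) refl (w v))) (ℚP.+-monoʳ-≤ (w v + 0ℚ * w v) w≤β)
          go (no v∉A) (no v∉U) (yes v∈C) (no w≰β) = ⊥-elim (v∉U (U⁺ (v∉A , ℚP.<⇒≤ (ℚP.≰⇒> w≰β) , unselected (container⁻ v∈C))))
            where
            unselected : v ∈ A ⊎ ¬ Selected (R (toℕ v)) v → ¬ Selected (R (toℕ v)) v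
            unselected (inj₁ v∈A) = ⊥-elim (v∉A v∈A)
            unselected (inj₂ ¬sel) = ¬sel

      good : Thin I → Good container I
      good thin = A , A⊆I , ⊆-container I , μ≤ {A} wtA≤ , card≤ , μ≤ {container A} wtC≤
        where
        ζwt≤ : ζ * wt G A ≤ℚ κ 2 * κ r * (τ * W)
        ζwt≤ = wt≤ selected (heavy≤ thin)
        wtA≤ : wt G A ≤ℚ K * W
        wtA≤ = *-cancelˡ 0<ζ (ℚP.≤-trans ζwt≤ (ℚP.≤-reflexive (trans (sym (ℚP.*-assoc (κ 2 * κ r) τ W))
          (trans (cong (_* W) (sym K*ζ)) (solve 3 (λ K z W → K :* z :* W := z :* (K :* W)) refl K ζ W)))))
        card≤ : ℕ→ℚ ∣ A ∣ ≤ℚ ℕ→ℚ (2 ℕ.* r) * τ * ℕ→ℚ n ÷' (ζ * ζ)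
        card≤ = ≤÷' (0<* 0<ζ 0<ζ) (*-cancelˡ 0<d (ℚP.≤-trans (ℚP.≤-reflexive (trans (cong (λ x → avg * (x * (ζ * ζ))) (κ-ℕ→ℚ ∣ A ∣))
            (solve 3 (λ d a z → d :* (a :* (z :* z)) := z :* (z :* d :* a)) refl avg (κ ∣ A ∣) ζ)))
          (ℚP.≤-trans (*-monoˡ 0≤ζ (β∣A∣≤wt selected)) (ℚP.≤-trans ζwt≤ (ℚP.≤-reflexive (trans
            (solve 4 (λ k T N d → k :* (T :* (N :* d)) := d :* (k :* T :* N)) refl (κ 2 * κ r) τ N avg)
            (cong (λ x → avg * (x * τ * N)) (sym (trans (κ-ℕ→ℚ (2 ℕ.* r)) (κ-* 2 r))))))))))
        ρW≤ : ρ * W ≤ℚ ε + 3ℚ * (ζ * W)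
        ρW≤ = ℚP.≤-trans (*-monoˡ 0≤ρ W≤) (ℚP.≤-reflexive (trans (sym (ℚP.*-assoc ρ (κ (r !)) (ε + 3ℚ * (ζ * W))))
          (trans (cong (_* (ε + 3ℚ * (ζ * W))) (trans (cong (ρ *_) (sym (κ-ℕ→ℚ (r !)))) (÷'-* 1ℚ 0<r!))) (ℚP.*-identityˡ (ε + 3ℚ * (ζ * W))))))
        wtC≤ : wt G (container A) ≤ℚ bound * W
        -- Adding `ρW≤` cancels the unknown ε; its 3ζW and the ζW of `container-weight` make up the
        -- 4ζ.
        wtC≤ = +-cancelˡ (ε + ρ * W) (ℚP.≤-trans (ℚP.≤-reflexive (solve 3 (λ e x c → e :+ x :+ c := x :+ (c :+ e)) refl ε (ρ * W) (wt G (container A))))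
          (ℚP.≤-trans (ℚP.+-mono-≤ ρW≤ (ℚP.≤-trans container-weight (ℚP.+-monoˡ-≤ (ζ * W) (ℚP.+-monoʳ-≤ W wtA≤))))
            (ℚP.≤-reflexive (solve 5 (λ e z W K ρ → e :+ con 3ℚ :* (z :* W) :+ (W :+ K :* W :+ z :* W)
              := e :+ ρ :* W :+ (con 1ℚ :- ρ :+ con (ℕ→ℚ 4) :* z :+ K) :* W) refl ε ζ W K ρ))))

  containers : Σ (Subset n → Subset n) λ C → ((I : Subset n) → Thin I → Good C I) × Online C
  containers = go (ℚP.≤-total ζ 1ℚ)
    where
    go : ζ ≤ℚ 1ℚ ⊎ 1ℚ ≤ℚ ζ → Σ (Subset n → Subset n) λ C → ((I : Subset n) → Thin I → Good C I) × Online C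
    go (inj₁ ζ≤1) = container , Small.good ζ≤1 , λ A w _ _ → container-online A w
      where open Algorithm G τ ζ β using (container; container-online)
    go (inj₂ 1≤ζ) = (λ _ → ⊤) , (λ I _ → trivial 1≤ζ I) , λ _ _ _ _ → refl

theorem1p1 : {r n : ℕ} → 2 ≤ r → (G : RGraph r n) → 0ℚ < avgDeg G →
    (τ ζ : ℚ) → 0ℚ < τ → 0ℚ < ζ → δ G τ ≤ℚ ζ →
    Σ (Subset n → Subset n) λ C →
    ((I : Subset n) →
    (Independent G I
    ⊎ InducedDegenerate G I (floor ((τ ^ℚ (r Data.Nat.∸ 1)) * ζ * ℕ→ℚ (e G) ÷' ℕ→ℚ n))
    ⊎ ℕ→ℚ (eInduced G I) ≤ℚ ℕ→ℚ (2 Data.Nat.* r) * (τ ^ℚ r) * ℕ→ℚ (e G) ÷' ζ) →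
    Σ (Subset n) λ T →
    T ⊆ I
    × I ⊆ C T
    × μ G T ≤ℚ ℕ→ℚ (2 Data.Nat.* r) * τ ÷' ζ
    × ℕ→ℚ ∣ T ∣ ≤ℚ ℕ→ℚ (2 Data.Nat.* r) * τ * ℕ→ℚ n ÷' (ζ * ζ)
    × μ G (C T) ≤ℚ 1ℚ - 1ℚ ÷' ℕ→ℚ (r !) + ℕ→ℚ 4 * ζ + ℕ→ℚ (2 Data.Nat.* r) * τ ÷' ζ)
    × ((T : Subset n) (w : ℕ) → 1 ≤ w → w ≤ n →
    C T ∩ prefix n w ≡ C (T ∩ prefix n w) ∩ prefix n w)
theorem1p1 2≤r G 0<d τ ζ 0<τ 0<ζ δ≤ζ = Containers.containers 2≤r G 0<d τ ζ 0<τ 0<ζ δ≤ζ
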